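{- There is an integer $t_0$ such that for every integer $t \ge t_0$ and every integer $n \ge 1$, every graph on $n$ vertices with no strong $K_t$-immersion has at most $2^{t + (\log_2 t)^2}\, n$ cliques. Moreover, this bound is sharp up to a factor $2^{O(\log^2 t)}$: there is an absolute constant $A>0$ such that for every $t\ge t_0$ and every $n \ge t$ there is a graph on $n$ vertices with no strong $K_t$-immersion and with at least $2^{ -A(\log_2 t)^2}\cdot 2^{t + (\log_2 t)^2}\, n$ cliques.
   Context: Graphs are finite and simple. A clique of $G$ is a set of pairwise adjacent vertices of $G$ (the empty set and single vertices count as cliques); the number of cliques is the number of such sets. A weak $H$-immersion in $G$ is a one-to-one mapping $\phi: V(H)\to V(G)$ together with a collection of edge-disjoint paths in $G$, one for each edge $uv$ of $H$, the path for $uv$ having end vertices $\phi(u)$ and $\phi(v)$. If none of the internal vertices of the paths lies in $\phi(V(H))$, it is a strong $H$-immersion. $K_t$ is the complete graph on $t$ vertices. -}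

module Defs where

open import Algebra.Definitions.RawSemiring using (_^_)
open import Data.Bool.Base using (Bool; T; false; not)
open import Data.Bool.Properties using (T?)
open import Data.Fin.Base using (Fin) renaming (_<_ to _<ꟳ_)
open import Data.Fin.Properties using (_≟_; all?)
open import Data.Fin.Subset using (Subset; inside; outside; _∈_)
open import Data.Fin.Subset.Properties using (_∈?_)
open import Data.Integer.Base using (ℤ; +_; -[1+_])
open import Data.List.Base using (List; []; _∷_; _++_; map; filter; length)
open import Data.List.Membership.Propositional
  using () renaming (_∈_ to _∈ˡ_; _∉_ to _∉ˡ_)
open import Data.List.Relation.Unary.Unique.Propositional using (Unique)
open import Data.Nat.Base as ℕ using (ℕ; zero; suc; NonZero)
open import Data.Nat.Properties using (m^n≢0)
open import Data.Product.Base using (_×_; _,_; ∃; ∃₂)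
open import Data.Rational.Unnormalised.Base as ℚ
  using (ℚᵘ; 0ℚᵘ; _/_; ↥_; ↧ₙ_; _<_; _≤_; +-*-rawSemiring)
open import Data.Sum.Base using (_⊎_)
import Data.Vec.Base as Vec
open import Function.Definitions using (Injective)
open import Relation.Binary.PropositionalEquality using (_≡_; _≢_; refl; cong)
open import Relation.Nullary using (¬_; Dec; does; yes; no; ¬?)
open import Relation.Nullary.Decidable using (_→-dec_; dec-true)
open import Relation.Nullary.Negation using (contradiction)

private
  variable
    m n : ℕ

------------------------------------------------------------------------
-- Finite simple graphs

record Graph (n : ℕ) : Set where
  field
    adj    : Fin n → Fin n → Bool
    symm   : ∀ u v → adj u v ≡ adj v u
    irrefl : ∀ u → adj u u ≡ false

  Adj : Fin n → Fin n → Set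
  Adj u v = T (adj u v)

open Graph public

K : ∀ t → Graph t
K t = record
  { adj    = λ u v → not (does (u ≟ v))
  ; symm   = λ u v → cong not (≟-symm u v)
  ; irrefl = λ u → cong not (dec-true (u ≟ u) refl)
  }
  where
  ≟-symm : ∀ (u v : Fin t) → does (u ≟ v) ≡ does (v ≟ u)
  ≟-symm u v with u ≟ v | v ≟ u
  ... | yes _    | yes _    = refl
  ... | no _     | no _     = refl
  ... | yes refl | no v≢v   = contradiction refl v≢v
  ... | no u≢u   | yes refl = contradiction refl u≢u

------------------------------------------------------------------------
-- Cliques

IsClique : Graph n → Subset n → Set
IsClique G S = ∀ u v → u ∈ S → v ∈ S → u ≢ v → Adj G u v

isClique? : (G : Graph n) (S : Subset n) → Dec (IsClique G S)
isClique? G S = all? λ u → all? λ v →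
  (u ∈? S) →-dec ((v ∈? S) →-dec (¬? (u ≟ v) →-dec T? (adj G u v)))

-- Every subset of Fin n occurs exactly once.
allSubsets : ∀ n → List (Subset n)
allSubsets zero    = Vec.[] ∷ []
allSubsets (suc n) = map (outside Vec.∷_) (allSubsets n)
                  ++ map (inside Vec.∷_) (allSubsets n)

numCliques : Graph n → ℕ
numCliques {n} G = length (filter (isClique? G) (allSubsets n))

------------------------------------------------------------------------
-- Paths

data Walk (G : Graph n) : Fin n → Fin n → Set where
  stop : ∀ u → Walk G u u
  step : ∀ u {v w} → Adj G u v → Walk G v w → Walk G u w

module _ {G : Graph n} where

  vertices : ∀ {u v} → Walk G u v → List (Fin n)
  vertices (stop u)     = u ∷ []
  vertices (step u _ p) = u ∷ vertices p

  -- Each edge is listed once, oriented in the direction of travel.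
  edges : ∀ {u v} → Walk G u v → List (Fin n × Fin n)
  edges (stop _)             = []
  edges (step u {v = v} _ p) = (u , v) ∷ edges p

record Path (G : Graph n) (u v : Fin n) : Set where
  field
    walk   : Walk G u v
    simple : Unique (vertices walk)

open Path public

module _ {G : Graph n} where

  Internal : ∀ {u v} → Fin n → Path G u v → Set
  Internal {u} {v} w P = w ∈ˡ vertices (walk P) × w ≢ u × w ≢ v

  -- Edges are undirected, so neither orientation may be shared.
  EdgeDisjoint : ∀ {u v u′ v′} → Path G u v → Path G u′ v′ → Set
  EdgeDisjoint P Q = ∀ x y → (x , y) ∈ˡ edges (walk P) →
    (x , y) ∉ˡ edges (walk Q) × (y , x) ∉ˡ edges (walk Q)

------------------------------------------------------------------------
-- Immersions

-- An edge uv of H is represented by its orientation with u < v, so that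
-- there is exactly one path for each edge.
record WeakImmersion (H : Graph m) (G : Graph n) : Set where
  field
    φ        : Fin m → Fin n
    φ-inj    : Injective _≡_ _≡_ φ
    path     : ∀ {u v} → u <ꟳ v → Adj H u v → Path G (φ u) (φ v)
    disjoint : ∀ {u v u′ v′} (u<v : u <ꟳ v) (uv : Adj H u v)
               (u′<v′ : u′ <ꟳ v′) (u′v′ : Adj H u′ v′) →
               (u , v) ≢ (u′ , v′) →
               EdgeDisjoint (path u<v uv) (path u′<v′ u′v′)

record StrongImmersion (H : Graph m) (G : Graph n) : Set where
  field
    weak : WeakImmersion H G
  open WeakImmersion weak public
  field
    avoids : ∀ {u v} (u<v : u <ꟳ v) (uv : Adj H u v) w →
             Internal w (path u<v uv) → ∀ x → w ≢ φ x

------------------------------------------------------------------------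
-- Real numbers as Dedekind cuts

-- A real x is given by its cut: lower q means q < x, upper q means x < q.
-- The record does not carry the cut axioms (inhabited, rounded, disjoint,
-- located). The operations below are the usual ones and preserve them,
-- log₂ provided its argument is positive.
record ℝ : Set₁ where
  field
    lower : ℚᵘ → Set
    upper : ℚᵘ → Set

open ℝ public

infix  4 _<ℝ_ _≤ℝ_
infixl 6 _+ℝ_
infixl 7 _*ℝ_
infix  8 -ℝ_

_<ℝ_ : ℝ → ℝ → Set
x <ℝ y = ∃ λ q → upper x q × lower y q

_≤ℝ_ : ℝ → ℝ → Set
x ≤ℝ y = ¬ (y <ℝ x)

fromℚ : ℚᵘ → ℝ
fromℚ p = record { lower = λ q → q < p ; upper = λ q → p < q }

fromℕ : ℕ → ℝ
fromℕ k = fromℚ (+ k / 1)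

_+ℝ_ : ℝ → ℝ → ℝ
x +ℝ y = record
  { lower = λ q → ∃₂ λ a b → lower x a × lower y b × q < a ℚ.+ b
  ; upper = λ q → ∃₂ λ a b → upper x a × upper y b × a ℚ.+ b < q
  }

-ℝ_ : ℝ → ℝ
-ℝ x = record { lower = λ q → upper x (ℚ.- q) ; upper = λ q → lower x (ℚ.- q) }

-- For a < x < b and c < y < d, the product xy lies strictly between the
-- least and the greatest of ac, ad, bc, bd, whatever the signs.
_*ℝ_ : ℝ → ℝ → ℝ
x *ℝ y = record
  { lower = λ q → Enclosed λ r → q < r
  ; upper = λ q → Enclosed λ r → r < q
  }
  where
  Enclosed : (ℚᵘ → Set) → Set
  Enclosed P = ∃₂ λ a b → ∃₂ λ c d →
    (lower x a × upper x b) × (lower y c × upper y d) ×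
    P (a ℚ.* c) × P (a ℚ.* d) × P (b ℚ.* c) × P (b ℚ.* d)

2^ℤ_ : ℤ → ℚᵘ
2^ℤ (+ k)    = + (2 ℕ.^ k) / 1
2^ℤ -[1+ k ] = (+ 1 / (2 ℕ.^ suc k)) {{m^n≢0 2 (suc k)}}

_^ℕ_ : ℚᵘ → ℕ → ℚᵘ
q ^ℕ k = _^_ +-*-rawSemiring q k

-- Comparison of q with 2 ^ (a/b): for q > 0, raise both to the power b.
_<2^_ : ℚᵘ → ℚᵘ → Set
q <2^ r = q ≤ 0ℚᵘ ⊎ q ^ℕ (↧ₙ r) < 2^ℤ (↥ r)

2^_<_ : ℚᵘ → ℚᵘ → Set
2^ r < q = 0ℚᵘ < q × 2^ℤ (↥ r) < q ^ℕ (↧ₙ r)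

-- Since 2 ^ _ and log₂ are increasing and continuous, their cuts are
-- determined by rational approximations of the argument.
2^ℝ_ : ℝ → ℝ
2^ℝ x = record
  { lower = λ q → ∃ λ r → lower x r × q <2^ r
  ; upper = λ q → ∃ λ r → upper x r × 2^ r < q
  }

log₂ : ℝ → ℝ
log₂ x = record
  { lower = λ r → ∃ λ q → lower x q × 2^ r < q
  ; upper = λ r → ∃ λ q → upper x q × q <2^ r
  }

_² : ℝ → ℝ
x ² = x *ℝ x

infix  8 2^ℝ_
infix  9 _²

{-# OPTIONS --safe #-}
module Submission where

-- Upper bound. Cliques are counted by branching on a vertex v: those avoiding v, and those through v,
-- which live in the neighbourhood of v. Among t + x vertices without a strong immersion of K t some vertex
-- has at most t + x/2 neighbours, for otherwise any t of them are terminals, the non-adjacent pairs being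
-- joined through common neighbours among the other x. Branching on such vertices from x = 2^k yields
-- 2^(t + k²/2 + O(k)) cliques. Among N vertices with N much larger than t some vertex has degree
-- O(√(N t)), as dense graphs contain an immersion of K t with paths of length four; so finitely many
-- branchings, each costing a factor polynomial in t, pass from any power of t to t^(11/8), and
-- (11/8)²/2 < 1. Finally, polynomial minimum degree forces an immersion: vertices are eliminated by
-- splitting off pairs of their edges so that the degrees are kept. This can only fail at a dense spot or
-- at many vertices with nearly the same neighbourhood, and both contain an immersion of K t.
--
-- Lower bound. Take disjoint copies of K (t - 1).

open import Defs
open import Algebra.Bundles using (CommutativeMonoid)
open import Algebra.Properties.CommutativeMonoid.Sum using ()
import Algebra.Properties.CommutativeSemigroup as CommutativeSemigroupProperties
open import Data.Bool.Base using (Bool; true; false; T; not; _∧_; _∨_; if_then_else_)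
open import Data.Bool.Properties using (T-≡; ∧-comm; ∨-comm) renaming (_≟_ to _≟ᵇ_)
open import Data.Fin.Base using (Fin; zero; suc; toℕ) renaming (_<_ to _<ꟳ_)
open import Data.Fin.Properties using (_≟_; all?; pigeonhole; toℕ-fromℕ<; toℕ-injective) renaming (<-irrefl to <ꟳ-irrefl; <-asym to <ꟳ-asym)
open import Data.Fin.Subset using (Subset; inside; outside; _∈_)
import Data.Integer.Base as ℤ
import Data.Integer.Properties as ℤₚ
open import Data.List.Base using (List; []; _∷_; _++_; map; filter; length)
open import Data.List.Membership.DecPropositional as DecMembership using ()
open import Data.List.Membership.Propositional using () renaming (_∈_ to _∈ˡ_)
open import Data.List.Properties using (filter-++; length-++)
open import Data.List.Relation.Unary.All using () renaming ([] to []ᵃ)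
open import Data.List.Relation.Unary.All.Properties using (¬Any⇒All¬)
open import Data.List.Relation.Unary.AllPairs using () renaming ([] to []ᵖ; _∷_ to _∷ᵖ_)
open import Data.List.Relation.Unary.Any using (here; there)
open import Data.List.Relation.Unary.Unique.Propositional using (Unique)
open import Data.Nat.Base
open import Data.Nat.Divisibility.Core using (divides)
open import Data.Nat.DivMod using (_mod_; +-distrib-/-∣ʳ; m<n⇒m/n≡0; m*n/n≡m; m/n*n≤m; /-monoˡ-≤; m≡m%n+[m/n]*n; m%n<n)
open import Data.Nat.Properties hiding (_≟_)
open import Data.Nat.Tactic.RingSolver using (solve)
open import Data.Product.Base using (Σ-syntax; _×_; _,_; ∃; ∃₂; proj₁; proj₂)
open import Data.Rational.Unnormalised.Base using (ℚᵘ; mkℚᵘ; 0ℚᵘ; *<*; *≤*) renaming (_<_ to _<ℚ_)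
import Data.Rational.Unnormalised.Base as ℚ
import Data.Rational.Unnormalised.Properties as ℚₚ
open import Data.Sum.Base using (_⊎_; inj₁; inj₂; [_,_]′)
open import Data.Unit.Base using (tt)
open import Data.Vec.Base using (lookup; _[_]≔_) renaming ([] to []ᵛ; _∷_ to _∷ᵛ_)
open import Data.Vec.Properties using (lookup⇒[]=; []=⇒lookup; lookup∘update; lookup∘update′)
open import Function.Base using (_∘_; id; case_of_)
open import Function.Bundles using (Equivalence; mk↔ₛ′)
open import Relation.Binary.Definitions using (tri<; tri≈; tri>)
open import Relation.Binary.PropositionalEquality
open import Relation.Nullary using (¬_; Dec; yes; no; does)
open import Relation.Nullary.Decidable using (dec-true; dec-false; _×-dec_; _→-dec_)
open import Relation.Nullary.Negation using (contradiction)

open Algebra.Properties.CommutativeMonoid.Sum +-0-commutativeMonoid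
  using (sum; ∑-distrib-+; ∑-comm; sum-permute; sum-cong-≗)

-- Near `t`, each halving of the surplus over `t` costs a factor about as large as the surplus.
-- Hence the `k²/2`, and hence a starting power `t^c` needs `c < √2`. The elimination argument gives
-- only `c = 4`. The dense step, whose degree bound is essentially the geometric mean of `N` and
-- `t`, sends `c` to `(c + 1) / 2`: 4, 5/2, 7/4, 11/8, the last being the first value below √2.
--
-- The obstacle in the elimination is that graphs must stay simple: the pairs split off at `w` have
-- to be non-adjacent, so the complement of the graph on the neighbourhood of `w` must have an
-- almost perfect matching. Vertices missing almost nothing there (hubs), or about half (medium
-- ones), stand in the way. Moreover an odd degree leaves one edge over, and such losses must not
-- pile up: in each round they all fall on one vertex, which is a hub of the next round and is
-- eliminated there.
--
-- In the lower bound the disjoint cliques fall short by `2^((log₂ t)²)` and a factor polynomial in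
-- `t`, which the constant `A` absorbs.

private
  variable
    k m n t : ℕ

-- Boolean functions and truth tables

_⇉_ : ℕ → Set → Set
zero  ⇉ A = A
suc k ⇉ A = Bool → k ⇉ A

valid : ∀ k → k ⇉ Bool → Bool
valid zero    b = b
valid (suc k) f = valid k (f true) ∧ valid k (f false)

Valid : ∀ k → k ⇉ Bool → Set
Valid zero    b = T b
Valid (suc k) f = ∀ a → Valid k (f a)

∧-split : ∀ {a b} → a ∧ b ≡ true → a ≡ true × b ≡ true
∧-split {true} eq = refl , eq

∧-join : ∀ {a b} → a ≡ true → b ≡ true → a ∧ b ≡ true
∧-join refl refl = refl

T⇒≡ : ∀ {a} → T a → a ≡ true
T⇒≡ = Equivalence.to T-≡

≡⇒T : ∀ {a} → a ≡ true → T a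
≡⇒T = Equivalence.from T-≡

-- Truth-table reflection: a pointwise inequality between indicators is a Boolean formula, and for a
-- concrete formula `valid` evaluates to `true`, so that `tt` proves all its instances.
tauto : ∀ k f → T (valid k f) → Valid k f
tauto zero    f h       = h
tauto (suc k) f h true  = tauto k (f true) (≡⇒T (proj₁ (∧-split (T⇒≡ h))))
tauto (suc k) f h false = tauto k (f false) (≡⇒T (proj₂ (∧-split {valid k (f true)} (T⇒≡ h))))

∨-false : ∀ {a b} → a ∨ b ≡ false → a ≡ false × b ≡ false
∨-false {false} eq = refl , eq

not-true : ∀ {a} → not a ≡ true → a ≡ false
not-true {false} _ = refl

not-false : ∀ {a} → a ≡ false → not a ≡ true
not-false refl = refl

true≢false : ∀ {a} {A : Set} → a ≡ true → a ≡ false → A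
true≢false refl ()

bool? : ∀ a → a ≡ true ⊎ a ≡ false
bool? true  = inj₁ refl
bool? false = inj₂ refl

¬true⇒false : ∀ {a} → ¬ (a ≡ true) → a ≡ false
¬true⇒false {true}  f = contradiction refl f
¬true⇒false {false} f = refl

-- Finite sets as Boolean predicates

⟦_⟧ : Bool → ℕ
⟦ true  ⟧ = 1
⟦ false ⟧ = 0

_==_ : Fin n → Fin n → Bool
u == v = does (u ≟ v)

==-refl : (u : Fin n) → (u == u) ≡ true
==-refl u = dec-true (u ≟ u) refl

==⇒≡ : {u v : Fin n} → (u == v) ≡ true → u ≡ v
==⇒≡ {u = u} {v} eq with u ≟ v
... | yes u≡v = u≡v

≢⇒== : {u v : Fin n} → u ≢ v → (u == v) ≡ false
≢⇒== {u = u} {v} u≢v = dec-false (u ≟ v) u≢v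

==⇒≢ : {u v : Fin n} → (u == v) ≡ false → u ≢ v
==⇒≢ {u = u} {v} eq u≡v = true≢false (dec-true (u ≟ v) u≡v) eq

sum-mono : {f g : Fin n → ℕ} → (∀ i → f i ≤ g i) → sum f ≤ sum g
sum-mono {zero}  f≤g = z≤n
sum-mono {suc n} f≤g = +-mono-≤ (f≤g zero) (sum-mono (f≤g ∘ suc))

sum-const : ∀ n c → sum {n} (λ _ → c) ≡ n * c
sum-const zero    c = refl
sum-const (suc n) c = cong (c +_) (sum-const n c)

sum-* : ∀ c (f : Fin n → ℕ) → sum (λ i → c * f i) ≡ c * sum f
sum-* {zero}  c f = sym (*-zeroʳ c)
sum-* {suc n} c f = trans (cong (c * f zero +_) (sum-* c (f ∘ suc))) (sym (*-distribˡ-+ c (f zero) _))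

sum-+-mono : {f g h : Fin n → ℕ} → (∀ i → f i ≤ g i + h i) → sum f ≤ sum g + sum h
sum-+-mono {f = f} {g} {h} le = ≤-trans (sum-mono le) (≤-reflexive (∑-distrib-+ g h))

sum-+-mono₂ : {f g h k : Fin n → ℕ} → (∀ i → f i + g i ≤ h i + k i) → sum f + sum g ≤ sum h + sum k
sum-+-mono₂ {f = f} {g} {h} {k} le =
  subst₂ _≤_ (∑-distrib-+ f g) (∑-distrib-+ h k) (sum-mono le)

sum-<⇒∃ : (f g : Fin n → ℕ) → sum f < sum g → ∃ λ i → f i < g i
sum-<⇒∃ {suc n} f g lt with f zero <? g zero
... | yes f<g = zero , f<g
... | no  f≮g =
  let i , fi<gi = sum-<⇒∃ (f ∘ suc) (g ∘ suc) (+-cancelˡ-< (f zero) _ _ (<-≤-trans lt (+-monoˡ-≤ _ (≮⇒≥ f≮g))))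
  in suc i , fi<gi

sum-term : (f : Fin n → ℕ) (i : Fin n) → f i ≤ sum f
sum-term f zero    = m≤m+n _ _
sum-term f (suc i) = ≤-trans (sum-term (f ∘ suc) i) (m≤n+m _ _)

⟦⟧-mono : ∀ {a b} → (a ≡ true → b ≡ true) → ⟦ a ⟧ ≤ ⟦ b ⟧
⟦⟧-mono {false} imp = z≤n
⟦⟧-mono {true}  imp rewrite imp refl = ≤-refl

⟦⟧<⇒ : ∀ {a b} → ⟦ a ⟧ < ⟦ b ⟧ → a ≡ false × b ≡ true
⟦⟧<⇒ {false} {true} _ = refl , refl
⟦⟧<⇒ {true} {true} (s≤s ())

⟦⟧≤1 : ∀ a → ⟦ a ⟧ ≤ 1
⟦⟧≤1 true  = ≤-refl
⟦⟧≤1 false = z≤n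

opaque

  count : (Fin n → Bool) → ℕ
  count P = sum λ i → ⟦ P i ⟧

  sum-drop : {f g : Fin n → ℕ} {P : Fin n → Bool} → (∀ i → f i + ⟦ P i ⟧ ≤ g i) → sum f + count P ≤ sum g
  sum-drop {f = f} {P = P} le = ≤-trans (≤-reflexive (sym (∑-distrib-+ f λ i → ⟦ P i ⟧))) (sum-mono le)

  count-≤+ : {P Q R : Fin n → Bool} → (∀ i → ⟦ P i ⟧ ≤ ⟦ Q i ⟧ + ⟦ R i ⟧) → count P ≤ count Q + count R
  count-≤+ le = sum-+-mono le

  count-+≤+ : {P Q R S : Fin n → Bool} → (∀ i → ⟦ P i ⟧ + ⟦ Q i ⟧ ≤ ⟦ R i ⟧ + ⟦ S i ⟧) → count P + count Q ≤ count R + count S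
  count-+≤+ le = sum-+-mono₂ le

  count-mono : {P Q : Fin n → Bool} → (∀ i → P i ≡ true → Q i ≡ true) → count P ≤ count Q
  count-mono imp = sum-mono λ i → ⟦⟧-mono (imp i)

  count-<⇒∃ : (P Q : Fin n → Bool) → count P < count Q → ∃ λ i → Q i ≡ true × P i ≡ false
  count-<⇒∃ P Q lt =
    let i , l = sum-<⇒∃ (λ i → ⟦ P i ⟧) (λ i → ⟦ Q i ⟧) lt
        p , q = ⟦⟧<⇒ l
    in i , q , p

  count-none : {P : Fin n → Bool} → (∀ i → P i ≡ false) → count P ≡ 0
  count-none {n} none = trans (sum-cong-≗ λ i → cong ⟦_⟧ (none i)) (trans (sum-const n 0) (*-zeroʳ n))

  ∃⇒count>0 : (P : Fin n → Bool) (i : Fin n) → P i ≡ true → 0 < count P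
  ∃⇒count>0 P i p = ≤-trans (≤-reflexive (cong ⟦_⟧ (sym p))) (sum-term (λ i → ⟦ P i ⟧) i)

  count-point : (u : Fin n) → count (_== u) ≡ 1
  count-point {suc n} zero = cong suc (count-none {n} λ i → refl)
  count-point (suc u) = trans (sum-cong-≗ λ i → cong ⟦_⟧ (lem i)) (count-point u)
    where
    lem : ∀ i → (suc i == suc u) ≡ (i == u)
    lem i with i ≟ u
    ... | yes refl = refl
    ... | no _     = refl

  count-full : count {n} (λ _ → true) ≡ n
  count-full {n} = trans (sum-const n 1) (*-identityʳ n)

  sum-count-swap : (P : Fin m → Fin n → Bool) → sum (λ i → count (P i)) ≡ sum (λ j → count λ i → P i j)
  sum-count-swap P = ∑-comm λ i j → ⟦ P i j ⟧

  sum-indicator : ∀ c (P : Fin n → Bool) → sum (λ i → c * ⟦ P i ⟧) ≡ c * count P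
  sum-indicator c P = sum-* c λ i → ⟦ P i ⟧

  -- The indicator of "some `i` works" is at most the number of such `i`; exchanging the two sums
  -- bounds the total row by row.
  union-bound : (P : Fin m → Bool) (Q : Fin m → Fin n → Bool) (c : ℕ) → (∀ {i} → P i ≡ true → count (Q i) ≤ c) →
                count (λ v → 0 <ᵇ count λ i → P i ∧ Q i v) ≤ count P * c
  union-bound {n = n} P Q c le = begin
    sum (λ v → ⟦ 0 <ᵇ count (λ i → P i ∧ Q i v) ⟧) ≤⟨ sum-mono (λ v → pos (count λ i → P i ∧ Q i v)) ⟩
    sum (λ v → sum λ i → ⟦ P i ∧ Q i v ⟧)          ≡⟨ ∑-comm (λ v i → ⟦ P i ∧ Q i v ⟧) ⟩
    sum (λ i → sum λ v → ⟦ P i ∧ Q i v ⟧)          ≤⟨ sum-mono row ⟩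
    sum (λ i → c * ⟦ P i ⟧)                        ≡⟨ sum-* c (λ i → ⟦ P i ⟧) ⟩
    c * count P                                    ≡⟨ *-comm c _ ⟩
    count P * c                                    ∎
    where
    open ≤-Reasoning
    pos : ∀ c → ⟦ 0 <ᵇ c ⟧ ≤ c
    pos zero    = z≤n
    pos (suc c) = s≤s z≤n
    row : ∀ i → count (λ v → P i ∧ Q i v) ≤ c * ⟦ P i ⟧
    row i with P i in eq
    ... | true  = ≤-trans (le eq) (≤-reflexive (sym (*-identityʳ c)))
    ... | false = ≤-trans (≤-reflexive (count-none {n} λ _ → refl)) z≤n

  count-involution : (μ : Fin n → Fin n) → (∀ a → μ (μ a) ≡ a) → (P : Fin n → Bool) → count (P ∘ μ) ≡ count P
  count-involution μ inv P = sym (sum-permute (λ i → ⟦ P i ⟧) (mk↔ₛ′ μ μ inv inv))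

count>0⇒∃ : (P : Fin n → Bool) → 0 < count P → ∃ λ i → P i ≡ true
count>0⇒∃ {n} P pos =
  let i , p , _ = count-<⇒∃ (λ _ → false) P (subst (_< count P) (sym (count-none {n} λ _ → refl)) pos)
  in i , p

search : (P : Fin n → Bool) → (∃ λ i → P i ≡ true) ⊎ (∀ i → P i ≡ false)
search {zero}  P = inj₂ λ ()
search {suc n} P with P zero in eq | search (P ∘ suc)
... | true  | _            = inj₁ (zero , eq)
... | false | inj₁ (i , p) = inj₁ (suc i , p)
... | false | inj₂ none    = inj₂ λ { zero → eq ; (suc i) → none i }

_∖_ : (Fin n → Bool) → Fin n → Fin n → Bool
(P ∖ u) v = P v ∧ not (v == u)

∖-∈ : (P : Fin n → Bool) {u v : Fin n} → P v ≡ true → v ≢ u → (P ∖ u) v ≡ true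
∖-∈ P p v≢u = ∧-join p (not-false (≢⇒== v≢u))

∖-⊆ : (P : Fin n → Bool) {u v : Fin n} → (P ∖ u) v ≡ true → P v ≡ true × v ≢ u
∖-⊆ P {u} {v} p =
  let a , b = ∧-split {P v} p in a , ==⇒≢ (not-true b)

count-∨ : (P Q : Fin n → Bool) → count (λ y → P y ∨ Q y) ≤ count P + count Q
count-∨ P Q = count-≤+ λ y → ≤ᵇ⇒≤ _ _ (tauto 2 (λ a b → ⟦ a ∨ b ⟧ ≤ᵇ (⟦ a ⟧ + ⟦ b ⟧)) tt (P y) (Q y))

count-≤+1 : {P Q : Fin n → Bool} (u : Fin n) → (∀ i → ⟦ P i ⟧ ≤ ⟦ Q i ⟧ + ⟦ i == u ⟧) → count P ≤ count Q + 1
count-≤+1 {P = P} {Q} u le = subst (λ z → count P ≤ count Q + z) (count-point u) (count-≤+ le)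

count-∖≤ : (P : Fin n → Bool) (u : Fin n) → count P ≤ suc (count (P ∖ u))
count-∖≤ P u = subst (count P ≤_) (trans (cong (count (P ∖ u) +_) (count-point u)) (+-comm _ 1))
  (count-≤+ λ i → ≤ᵇ⇒≤ _ _ (tauto 2 (λ p e → ⟦ p ⟧ ≤ᵇ (⟦ p ∧ not e ⟧ + ⟦ e ⟧)) tt (P i) (i == u)))

count-+≤ : {P Q R : Fin n → Bool} → (∀ i → ⟦ P i ⟧ + ⟦ Q i ⟧ ≤ ⟦ R i ⟧) → count P + count Q ≤ count R
count-+≤ {n} {P} {Q} {R} le = subst (count P + count Q ≤_) (trans (cong (count R +_) (count-none λ _ → refl)) (+-identityʳ _))
  (count-+≤+ {S = λ _ → false} λ i → ≤-trans (le i) (m≤m+n _ 0))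

count-∖< : (P : Fin n → Bool) {u : Fin n} → P u ≡ true → suc (count (P ∖ u)) ≤ count P
count-∖< P {u} p = subst (_≤ count P) (trans (cong (count (P ∖ u) +_) (count-point u)) (+-comm _ 1)) (count-+≤ pw)
  where
  pw : ∀ i → ⟦ (P ∖ u) i ⟧ + ⟦ i == u ⟧ ≤ ⟦ P i ⟧
  pw i with i ≟ u
  ... | yes refl rewrite p = ≤-refl
  ... | no _ with P i
  ...   | true  = ≤-refl
  ...   | false = ≤-refl

⇒-elim : ∀ {a b} → T (not a ∨ b) → a ≡ true → T b
⇒-elim h refl = h

⇒-intro : ∀ {a b} → (a ≡ true → b ≡ true) → (not a ∨ b) ≡ true
⇒-intro {false} f = refl
⇒-intro {true}  f = f refl

opaque
  choose : ∀ t (P : Fin n → Bool) → t ≤ count P →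
           Σ[ τ ∈ (Fin t → Fin n) ] (∀ {i j} → τ i ≡ τ j → i ≡ j) × (∀ i → P (τ i) ≡ true)
  choose zero    P le = (λ ()) , (λ { {()} }) , λ ()
  choose {n = n} (suc t) P le with count>0⇒∃ P (≤-trans (s≤s z≤n) le)
  ... | u , pu with choose t (P ∖ u) (s≤s⁻¹ (≤-trans le (count-∖≤ P u)))
  ... | τ , inj , mem = τ′ , inj′ , mem′
    where
    τ′ : Fin (suc t) → Fin n
    τ′ zero    = u
    τ′ (suc i) = τ i
    inj′ : ∀ {i j} → τ′ i ≡ τ′ j → i ≡ j
    inj′ {zero}  {zero}  eq = refl
    inj′ {zero}  {suc j} eq = contradiction (sym eq) (proj₂ (∖-⊆ P (mem j)))
    inj′ {suc i} {zero}  eq = contradiction eq (proj₂ (∖-⊆ P (mem i)))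
    inj′ {suc i} {suc j} eq = cong suc (inj eq)
    mem′ : ∀ i → P (τ′ i) ≡ true
    mem′ zero    = pu
    mem′ (suc i) = proj₁ (∖-⊆ P (mem i))

image : (Fin m → Bool) → (Fin m → Fin n) → Fin n → Bool
image P f v = 0 <ᵇ count λ i → P i ∧ (f i == v)

image-∈ : (P : Fin m → Bool) (f : Fin m → Fin n) {i : Fin m} → P i ≡ true → image P f (f i) ≡ true
image-∈ P f {i} p = T⇒≡ (<⇒<ᵇ (∃⇒count>0 _ i (∧-join p (==-refl (f i)))))

image-∃ : (P : Fin m → Bool) (f : Fin m → Fin n) {v : Fin n} → image P f v ≡ true →
          ∃ λ i → P i ≡ true × f i ≡ v
image-∃ P f {v} h =
  let i , q = count>0⇒∃ (λ i → P i ∧ (f i == v)) (<ᵇ⇒< 0 _ (≡⇒T h))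
      p , e = ∧-split {P i} q
  in i , p , ==⇒≡ e

count-image : (P : Fin m → Bool) (f : Fin m → Fin n) → count (image P f) ≤ count P
count-image P f = ≤-trans (union-bound P (λ i v → f i == v) 1 λ {i} _ →
  ≤-trans (count-mono λ v e → trans (cong (λ w → does (v ≟ w)) (==⇒≡ {u = f i} e)) (==-refl v)) (≤-reflexive (count-point (f i))))
  (≤-reflexive (*-identityʳ _))

-- Reduces a linear inequality to a ring identity without subtraction; s is the slack.
≤-by : ∀ {L R l r} s → l ≤ r → L + r + s ≡ R + l → L ≤ R
≤-by {L} {R} {l} {r} s l≤r eq = +-cancelʳ-≤ r L R (begin
  L + r     ≤⟨ m≤m+n _ s ⟩
  L + r + s ≡⟨ eq ⟩
  R + l     ≤⟨ +-monoʳ-≤ R l≤r ⟩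
  R + r     ∎)
  where open ≤-Reasoning

+-interchange : ∀ a b c d → a + b + (c + d) ≡ a + c + (b + d)
+-interchange = CommutativeSemigroupProperties.interchange +-commutativeSemigroup

-- Walks and loop erasure

module _ {G : Graph n} where

  Uses : ∀ {u v} → Walk G u v → Fin n → Fin n → Set
  Uses p x y = (x , y) ∈ˡ edges p ⊎ (y , x) ∈ˡ edges p

  start∈ : ∀ {u v} (p : Walk G u v) → u ∈ˡ vertices p
  start∈ (stop u)     = here refl
  start∈ (step u e p) = here refl

  _++ʷ_ : ∀ {u v w} → Walk G u v → Walk G v w → Walk G u w
  stop _     ++ʷ q = q
  step u e p ++ʷ q = step u e (p ++ʷ q)

  ++ʷ-vertices : ∀ {u v w x} (p : Walk G u v) (q : Walk G v w) →
                 x ∈ˡ vertices (p ++ʷ q) → x ∈ˡ vertices p ⊎ x ∈ˡ vertices q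
  ++ʷ-vertices (stop _)     q h         = inj₂ h
  ++ʷ-vertices (step u e p) q (here eq) = inj₁ (here eq)
  ++ʷ-vertices (step u e p) q (there h) with ++ʷ-vertices p q h
  ... | inj₁ h′ = inj₁ (there h′)
  ... | inj₂ h′ = inj₂ h′

  ++ʷ-edges : ∀ {u v w e} (p : Walk G u v) (q : Walk G v w) →
              e ∈ˡ edges (p ++ʷ q) → e ∈ˡ edges p ⊎ e ∈ˡ edges q
  ++ʷ-edges (stop _)     q h         = inj₂ h
  ++ʷ-edges (step u e p) q (here eq) = inj₁ (here eq)
  ++ʷ-edges (step u e p) q (there h) with ++ʷ-edges p q h
  ... | inj₁ h′ = inj₁ (there h′)
  ... | inj₂ h′ = inj₂ h′

  record SubPath {u v} (p : Walk G u v) (w : Fin n) : Set where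
    field
      walk    : Walk G w v
      simple  : Unique (vertices walk)
      ⊆-verts : ∀ {x} → x ∈ˡ vertices walk → x ∈ˡ vertices p
      ⊆-edges : ∀ {e} → e ∈ˡ edges walk → e ∈ˡ edges p

  suffix : ∀ {u v w} (p : Walk G u v) → Unique (vertices p) → w ∈ˡ vertices p → SubPath p w
  suffix (stop u) uq (here refl) = record { walk = stop u ; simple = uq ; ⊆-verts = id ; ⊆-edges = id }
  suffix (step u e p) uq (here refl) = record { walk = step u e p ; simple = uq ; ⊆-verts = id ; ⊆-edges = id }
  suffix (step u e p) (_ ∷ᵖ uq) (there h) = record
    { walk = S.walk ; simple = S.simple ; ⊆-verts = there ∘ S.⊆-verts ; ⊆-edges = there ∘ S.⊆-edges }
    where module S = SubPath (suffix p uq h)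

  -- Works from the far end: if the first vertex recurs on the erased rest, the rest is cut back to
  -- that occurrence.
  loopErase : ∀ {u v} (p : Walk G u v) → SubPath p u
  loopErase (stop u) = record { walk = stop u ; simple = []ᵃ ∷ᵖ []ᵖ ; ⊆-verts = id ; ⊆-edges = id }
  loopErase (step u e p) with loopErase p
  ... | q with DecMembership._∈?_ _≟_ u (vertices (SubPath.walk q))
  ... | yes u∈ = record
    { walk = S.walk ; simple = S.simple
    ; ⊆-verts = there ∘ SubPath.⊆-verts q ∘ S.⊆-verts ; ⊆-edges = there ∘ SubPath.⊆-edges q ∘ S.⊆-edges }
    where module S = SubPath (suffix (SubPath.walk q) (SubPath.simple q) u∈)
  ... | no u∉ = record
    { walk = step u e (SubPath.walk q) ; simple = ¬Any⇒All¬ _ u∉ ∷ᵖ SubPath.simple q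
    ; ⊆-verts = λ { (here eq) → here eq ; (there h) → there (SubPath.⊆-verts q h) }
    ; ⊆-edges = λ { (here eq) → here eq ; (there h) → there (SubPath.⊆-edges q h) } }

-- Walks suffice in place of paths, since loop erasure only removes vertices and edges.

record Linked (G : Graph n) (τ : Fin t → Fin n) : Set where
  field
    τ-inj    : ∀ {i j} → τ i ≡ τ j → i ≡ j
    walk     : ∀ i j → i <ꟳ j → Walk G (τ i) (τ j)
    inner    : ∀ i j (i<j : i <ꟳ j) l → τ l ∈ˡ vertices (walk i j i<j) → l ≡ i ⊎ l ≡ j
    disjoint : ∀ i j (i<j : i <ꟳ j) i′ j′ (i′<j′ : i′ <ꟳ j′) x y →
               Uses (walk i j i<j) x y → Uses (walk i′ j′ i′<j′) x y → i ≡ i′ × j ≡ j′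

linked⇒immersion : {G : Graph n} {τ : Fin t → Fin n} → Linked G τ → StrongImmersion (K t) G
linked⇒immersion {n = n} {t = t} {G = G} {τ} L = record
  { weak = record { φ = τ ; φ-inj = L.τ-inj ; path = λ u<v _ → path′ u<v ; disjoint = λ u<v _ u<v′ _ → disj u<v u<v′ }
  ; avoids = λ u<v _ → avoids u<v }
  where
  module L = Linked L
  er : ∀ {u v} (u<v : u <ꟳ v) → SubPath (L.walk u v u<v) (τ u)
  er {u} {v} u<v = loopErase (L.walk u v u<v)
  path′ : ∀ {u v : Fin t} → u <ꟳ v → Path G (τ u) (τ v)
  path′ u<v = record { walk = SubPath.walk (er u<v) ; simple = SubPath.simple (er u<v) }
  disj : ∀ {u v u′ v′} (u<v : u <ꟳ v) (u′<v′ : u′ <ꟳ v′) → (u , v) ≢ (u′ , v′) → EdgeDisjoint (path′ u<v) (path′ u′<v′)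
  disj u<v u′<v′ ne x y h =
    (λ h′ → clash (inj₁ (SubPath.⊆-edges (er u′<v′) h′))) , (λ h′ → clash (inj₂ (SubPath.⊆-edges (er u′<v′) h′)))
    where
    clash : ¬ Uses (L.walk _ _ u′<v′) x y
    clash us with L.disjoint _ _ u<v _ _ u′<v′ x y (inj₁ (SubPath.⊆-edges (er u<v) h)) us
    ... | refl , refl = ne refl
  avoids : ∀ {u v} (u<v : u <ꟳ v) w → Internal w (path′ u<v) → ∀ x → w ≢ τ x
  avoids u<v w (w∈ , w≢u , w≢v) x refl with L.inner _ _ u<v x (SubPath.⊆-verts (er u<v) w∈)
  ... | inj₁ refl = w≢u refl
  ... | inj₂ refl = w≢v refl

-- A replacement of the edges of H by edge-disjoint walks of G: an edge uv is either an edge of G (D u v)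
-- or is replaced by the path u, c u v, v. Linkages in H whose terminals are no middle vertices pull back to G.

record Reroute (H G : Graph n) (M : Fin n → Set) : Set where
  field
    D      : Fin n → Fin n → Bool
    c      : Fin n → Fin n → Fin n
    D-sym  : ∀ u v → D u v ≡ D v u
    c-sym  : ∀ u v → c u v ≡ c v u
    direct : ∀ {u v} → adj H u v ≡ true → D u v ≡ true → adj G u v ≡ true
    left   : ∀ {u v} → adj H u v ≡ true → D u v ≡ false → adj G u (c u v) ≡ true
    middle : ∀ {u v} → adj H u v ≡ true → D u v ≡ false → M (c u v)
    free   : ∀ {u v} → adj H u v ≡ true → D u v ≡ false → D u (c u v) ≡ false
    proper : ∀ {u v w} → adj H u v ≡ true → D u v ≡ false → adj H u w ≡ true → D u w ≡ false →
             c u v ≡ c u w → v ≡ w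
    -- Excludes the coincidence that `proper` leaves: one edge of `G` serving as a half from both of
    -- its ends.
    cross  : ∀ {u v u′ v′} → adj H u v ≡ true → D u v ≡ false → adj H u′ v′ ≡ true → D u′ v′ ≡ false →
             u ≡ c u′ v′ → u′ ≢ c u v

SameEdge : Fin n × Fin n → Fin n × Fin n → Set
SameEdge (u , v) (u′ , v′) = (u ≡ u′ × v ≡ v′) ⊎ (u ≡ v′ × v ≡ u′)

sameEdge-swapʳ : {e : Fin n × Fin n} {u v : Fin n} → SameEdge e (u , v) → SameEdge e (v , u)
sameEdge-swapʳ (inj₁ h) = inj₂ h
sameEdge-swapʳ (inj₂ h) = inj₁ h

sameEdge-swapˡ : {e : Fin n × Fin n} {u v : Fin n} → SameEdge (u , v) e → SameEdge (v , u) e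
sameEdge-swapˡ (inj₁ (a , b)) = inj₂ (b , a)
sameEdge-swapˡ (inj₂ (a , b)) = inj₁ (b , a)

module _ {H G : Graph n} {M : Fin n → Set} (R : Reroute H G M) where
  open Reroute R

  H-sym : ∀ {u v} → adj H u v ≡ true → adj H v u ≡ true
  H-sym {u} {v} h = trans (symm H v u) h

  rep′ : ∀ {u v} → adj H u v ≡ true → ∀ b → D u v ≡ b → Walk G u v
  rep′ {u} {v} h true  eq = step u (≡⇒T (direct h eq)) (stop v)
  rep′ {u} {v} h false eq = step u (≡⇒T (left h eq)) (step (c u v)
    (≡⇒T (trans (symm G _ v) (subst (λ z → adj G v z ≡ true) (c-sym v u) (left (H-sym h) (trans (D-sym v u) eq))))) (stop v))

  rep : ∀ u v → adj H u v ≡ true → Walk G u v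
  rep u v h = rep′ h (D u v) refl

  rep-vertices : ∀ {u v x} (h : adj H u v ≡ true) → x ∈ˡ vertices (rep u v h) → x ≡ u ⊎ x ≡ v ⊎ M x
  rep-vertices {u} {v} {x} h = go (D u v) refl
    where
    go : ∀ b (eq : D u v ≡ b) → x ∈ˡ vertices (rep′ h b eq) → x ≡ u ⊎ x ≡ v ⊎ M x
    go true  eq (here refl)                 = inj₁ refl
    go true  eq (there (here refl))         = inj₂ (inj₁ refl)
    go false eq (here refl)                 = inj₁ refl
    go false eq (there (here refl))         = inj₂ (inj₂ (middle h eq))
    go false eq (there (there (here refl))) = inj₂ (inj₁ refl)

  -- The edges `xy` of `G` that may replace `uv`, up to orientation. The clause `D x y` for direct
  -- edges is what `free` contradicts.
  Half : Fin n → Fin n → Fin n → Fin n → Set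
  Half u v x y = (D u v ≡ true × D x y ≡ true × SameEdge (u , v) (x , y)) ⊎
                 (D u v ≡ false × (SameEdge (u , c u v) (x , y) ⊎ SameEdge (v , c v u) (x , y)))

  half-swap : ∀ {u v x y} → Half u v y x → Half u v x y
  half-swap (inj₁ (d , d′ , s)) = inj₁ (d , trans (D-sym _ _) d′ , sameEdge-swapʳ s)
  half-swap (inj₂ (d , inj₁ s)) = inj₂ (d , inj₁ (sameEdge-swapʳ s))
  half-swap (inj₂ (d , inj₂ s)) = inj₂ (d , inj₂ (sameEdge-swapʳ s))

  rep-edge : ∀ {u v x y} (h : adj H u v ≡ true) → (x , y) ∈ˡ edges (rep u v h) → Half u v x y
  rep-edge {u} {v} {x} {y} h = go (D u v) refl
    where
    go : ∀ b (eq : D u v ≡ b) → (x , y) ∈ˡ edges (rep′ h b eq) → Half u v x y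
    go true  eq (here refl)         = inj₁ (eq , eq , inj₁ (refl , refl))
    go false eq (here refl)         = inj₂ (eq , inj₁ (inj₁ (refl , refl)))
    go false eq (there (here refl)) = inj₂ (eq , inj₂ (inj₂ (refl , c-sym v u)))

  private
    halves : ∀ {u v u′ v′ x y} → adj H u v ≡ true → D u v ≡ false → adj H u′ v′ ≡ true → D u′ v′ ≡ false →
             SameEdge (u , c u v) (x , y) → SameEdge (u′ , c u′ v′) (x , y) → SameEdge (u , v) (u′ , v′)
    halves h d h′ d′ (inj₁ (refl , eq)) (inj₁ (refl , eq′)) = inj₁ (refl , proper h d h′ d′ (trans eq (sym eq′)))
    halves h d h′ d′ (inj₁ (refl , eq)) (inj₂ (eq′ , eq″)) = contradiction (trans eq′ (sym eq)) (cross h d h′ d′ (sym eq″))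
    halves h d h′ d′ (inj₂ (eq , eq″)) (inj₁ (refl , eq′)) = contradiction (sym eq″) (cross h d h′ d′ (trans eq (sym eq′)))
    halves h d h′ d′ (inj₂ (refl , eq)) (inj₂ (refl , eq′)) = inj₁ (refl , proper h d h′ d′ (trans eq (sym eq′)))

    half-direct : ∀ {u v x y} {A : Set} → adj H u v ≡ true → D u v ≡ false → D x y ≡ true → SameEdge (u , c u v) (x , y) → A
    half-direct h d dxy (inj₁ (refl , refl)) = true≢false dxy (free h d)
    half-direct h d dxy (inj₂ (refl , refl)) = true≢false (trans (D-sym _ _) dxy) (free h d)

    flip-D : ∀ {u v b} → D u v ≡ b → D v u ≡ b
    flip-D d = trans (D-sym _ _) d

  -- Two direct edges agree outright; a direct edge and a half violate `free`; two halves with the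
  -- same orientation are settled by `proper`, with opposite ones by `cross`.
  rep-disjoint : ∀ {u v u′ v′ x y} (h : adj H u v ≡ true) (h′ : adj H u′ v′ ≡ true) →
                 Half u v x y → Half u′ v′ x y → SameEdge (u , v) (u′ , v′)
  rep-disjoint h h′ (inj₁ (_ , _ , inj₁ (refl , refl))) (inj₁ (_ , _ , inj₁ (refl , refl))) = inj₁ (refl , refl)
  rep-disjoint h h′ (inj₁ (_ , _ , inj₁ (refl , refl))) (inj₁ (_ , _ , inj₂ (refl , refl))) = inj₂ (refl , refl)
  rep-disjoint h h′ (inj₁ (_ , _ , inj₂ (refl , refl))) (inj₁ (_ , _ , inj₁ (refl , refl))) = inj₂ (refl , refl)
  rep-disjoint h h′ (inj₁ (_ , _ , inj₂ (refl , refl))) (inj₁ (_ , _ , inj₂ (refl , refl))) = inj₁ (refl , refl)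
  rep-disjoint h h′ (inj₁ (_ , d , _)) (inj₂ (d′ , inj₁ s)) = half-direct h′ d′ d s
  rep-disjoint h h′ (inj₁ (_ , d , _)) (inj₂ (d′ , inj₂ s)) = half-direct (H-sym h′) (flip-D d′) d s
  rep-disjoint h h′ (inj₂ (d , inj₁ s)) (inj₁ (_ , d′ , _)) = half-direct h d d′ s
  rep-disjoint h h′ (inj₂ (d , inj₂ s)) (inj₁ (_ , d′ , _)) = half-direct (H-sym h) (flip-D d) d′ s
  rep-disjoint h h′ (inj₂ (d , inj₁ s)) (inj₂ (d′ , inj₁ s′)) = halves h d h′ d′ s s′
  rep-disjoint h h′ (inj₂ (d , inj₁ s)) (inj₂ (d′ , inj₂ s′)) =
    sameEdge-swapʳ (halves h d (H-sym h′) (flip-D d′) s s′)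
  rep-disjoint h h′ (inj₂ (d , inj₂ s)) (inj₂ (d′ , inj₁ s′)) =
    sameEdge-swapˡ (halves (H-sym h) (flip-D d) h′ d′ s s′)
  rep-disjoint h h′ (inj₂ (d , inj₂ s)) (inj₂ (d′ , inj₂ s′)) =
    sameEdge-swapˡ (sameEdge-swapʳ (halves (H-sym h) (flip-D d) (H-sym h′) (flip-D d′) s s′))

  expand : ∀ {u v} → Walk H u v → Walk G u v
  expand (stop u)             = stop u
  expand (step u {v = v} e p) = rep u v (T⇒≡ e) ++ʷ expand p

  expand-vertices : ∀ {u v x} (p : Walk H u v) → x ∈ˡ vertices (expand p) → x ∈ˡ vertices p ⊎ M x
  expand-vertices (stop u) h = inj₁ h
  expand-vertices (step u e p) h with ++ʷ-vertices (rep _ _ (T⇒≡ e)) (expand p) h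
  ... | inj₁ h′ with rep-vertices (T⇒≡ e) h′
  ...   | inj₁ refl        = inj₁ (here refl)
  ...   | inj₂ (inj₁ refl) = inj₁ (there (start∈ p))
  ...   | inj₂ (inj₂ m)    = inj₂ m
  expand-vertices (step u e p) h | inj₂ h′ with expand-vertices p h′
  ...   | inj₁ h″ = inj₁ (there h″)
  ...   | inj₂ m  = inj₂ m

  expand-edge : ∀ {u v x y} (p : Walk H u v) → (x , y) ∈ˡ edges (expand p) →
                ∃₂ λ a b → (a , b) ∈ˡ edges p × adj H a b ≡ true × Half a b x y
  expand-edge (step u {v = v} e p) h with ++ʷ-edges (rep u v (T⇒≡ e)) (expand p) h
  ... | inj₁ h′ = u , v , here refl , T⇒≡ e , rep-edge (T⇒≡ e) h′
  ... | inj₂ h′ = let a , b , ab , r = expand-edge p h′ in a , b , there ab , r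

  expand-uses : ∀ {u v x y} (p : Walk H u v) → Uses (expand p) x y →
                ∃₂ λ a b → (a , b) ∈ˡ edges p × adj H a b ≡ true × Half a b x y
  expand-uses p (inj₁ h) = expand-edge p h
  expand-uses p (inj₂ h) = let a , b , ab , e , r = expand-edge p h in a , b , ab , e , half-swap r

  -- Expansion adds only middle vertices to a walk, and these are no terminals; an edge of `G`
  -- shared by two expanded walks comes from an edge of `H` shared by the original ones.
  pullback : {τ : Fin t → Fin n} → Linked H τ → (∀ i → ¬ M (τ i)) → Linked G τ
  pullback {τ = τ} L avoid = record
    { τ-inj = L.τ-inj
    ; walk  = λ i j i<j → expand (L.walk i j i<j)
    ; inner = λ i j i<j l h → case expand-vertices (L.walk i j i<j) h of λ
        { (inj₁ h′) → L.inner i j i<j l h′ ; (inj₂ m) → contradiction m (avoid l) }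
    ; disjoint = disj
    }
    where
    module L = Linked L
    disj : ∀ i j (i<j : i <ꟳ j) i′ j′ (i′<j′ : i′ <ꟳ j′) x y → Uses (expand (L.walk i j i<j)) x y →
           Uses (expand (L.walk i′ j′ i′<j′)) x y → i ≡ i′ × j ≡ j′
    disj i j i<j i′ j′ i′<j′ x y us us′
      with expand-uses (L.walk i j i<j) us | expand-uses (L.walk i′ j′ i′<j′) us′
    ... | a , b , ab∈ , h , r | a′ , b′ , ab∈′ , h′ , r′ with rep-disjoint h h′ r r′
    ... | inj₁ (refl , refl) = L.disjoint i j i<j i′ j′ i′<j′ a b (inj₁ ab∈) (inj₁ ab∈′)
    ... | inj₂ (refl , refl) = L.disjoint i j i<j i′ j′ i′<j′ a b (inj₁ ab∈) (inj₂ ab∈′)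

clique-linked : (H : Graph n) (τ : Fin t → Fin n) → (∀ {i j} → τ i ≡ τ j → i ≡ j) →
                (∀ i j → i ≢ j → adj H (τ i) (τ j) ≡ true) → Linked H τ
clique-linked {t = t} H τ inj cl = record
  { τ-inj = inj
  ; walk  = λ i j i<j → step (τ i) (≡⇒T (cl i j (λ { refl → <ꟳ-irrefl refl i<j }))) (stop (τ j))
  ; inner = λ { i j i<j l (here eq) → inj₁ (inj eq) ; i j i<j l (there (here eq)) → inj₂ (inj eq) }
  ; disjoint = λ
    { i j i<j i′ j′ i′<j′ x y (inj₁ (here refl)) (inj₁ (here eq)) → inj (cong proj₁ eq) , inj (cong proj₂ eq)
    ; i j i<j i′ j′ i′<j′ x y (inj₁ (here refl)) (inj₂ (here eq)) →
        contradiction (subst₂ _<ꟳ_ (sym (inj (cong proj₁ eq))) (sym (inj (cong proj₂ eq))) i′<j′) (<ꟳ-asym i<j)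
    ; i j i<j i′ j′ i′<j′ x y (inj₂ (here refl)) (inj₁ (here eq)) →
        contradiction (subst₂ _<ꟳ_ (sym (inj (cong proj₁ eq))) (sym (inj (cong proj₂ eq))) i′<j′) (<ꟳ-asym i<j)
    ; i j i<j i′ j′ i′<j′ x y (inj₂ (here refl)) (inj₂ (here eq)) → inj (cong proj₁ eq) , inj (cong proj₂ eq) }
  }

-- List edge colouring

record Colouring (Q : Fin k → Fin k → Bool) (L : Fin k → Fin k → Fin n → Bool) : Set where
  field
    c        : Fin k → Fin k → Fin n
    c-sym    : ∀ i j → c i j ≡ c j i
    c-list   : ∀ {i j} → Q i j ≡ true → L i j (c i j) ≡ true
    c-proper : ∀ {i j l} → Q i j ≡ true → Q i l ≡ true → c i j ≡ c i l → j ≡ l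

module _ (a b : Fin k) where

  end : Fin k → Bool
  end i = (i == a) ∨ (i == b)

  pair : Fin k → Fin k → Bool
  pair i j = ((i == a) ∧ (j == b)) ∨ ((i == b) ∧ (j == a))

  pair-sym : ∀ i j → pair i j ≡ pair j i
  pair-sym i j = trans (∨-comm (i == a ∧ j == b) _) (cong₂ _∨_ (∧-comm (i == b) _) (∧-comm (i == a) _))

  pair-elim : ∀ {i j} → pair i j ≡ true → (i ≡ a × j ≡ b) ⊎ (i ≡ b × j ≡ a)
  pair-elim {i} {j} h with i ≟ a | j ≟ b | i ≟ b | j ≟ a
  ... | yes p | yes q | _     | _     = inj₁ (p , q)
  ... | _     | _     | yes p | yes q = inj₂ (p , q)
  ... | no _  | _     | no _  | _     = contradiction h λ ()
  ... | no _  | _     | yes _ | no _  = contradiction h λ ()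
  ... | yes _ | no _  | no _  | _     = contradiction h λ ()
  ... | yes _ | no _  | yes _ | no _  = contradiction h λ ()

  pair-ab : pair a b ≡ true
  pair-ab rewrite ==-refl a | ==-refl b = refl

  pair-ba : pair b a ≡ true
  pair-ba = trans (pair-sym b a) pair-ab

  end-elim : ∀ {i} → end i ≡ true → i ≡ a ⊎ i ≡ b
  end-elim {i} h with i ≟ a | i ≟ b
  ... | yes p | _     = inj₁ p
  ... | no _  | yes p = inj₂ p
  ... | no _  | no _  = contradiction h λ ()

  end-a : end a ≡ true
  end-a rewrite ==-refl a = refl

  pair-end : ∀ {i j} → pair i j ≡ true → end i ≡ true
  pair-end {i} h with i ≟ a | i ≟ b
  ... | yes _ | _     = refl
  ... | no _  | yes _ = refl
  ... | no _  | no _  = h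

opaque
  lists-shrink : ∀ p p′ q q′ e e′ l l′ → p + e ≤ p′ → q + e′ ≤ q′ → p′ + q′ ≤ suc l → l ≤ l′ + e + e′ → p + q ≤ suc l′
  lists-shrink p p′ q q′ e e′ l l′ h₁ h₂ h₃ h₄ =
    ≤-by 0 (+-mono-≤ (+-mono-≤ h₁ h₂) (+-mono-≤ h₃ h₄))
      (solve (p ∷ p′ ∷ q ∷ q′ ∷ e ∷ e′ ∷ l ∷ l′ ∷ []))

-- Colour one edge ab with any w of its list and delete w from the lists of the edges at a and b:
-- the degree sum of such an edge drops along with its list.
colouring′ : ∀ f (δ : Fin n) (Q : Fin k → Fin k → Bool) (L : Fin k → Fin k → Fin n → Bool) →
  (∀ i j → Q i j ≡ Q j i) → (∀ i → Q i i ≡ false) → (∀ i j y → L i j y ≡ L j i y) →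
  (∀ {i j} → Q i j ≡ true → count (Q i) + count (Q j) ≤ suc (count (L i j))) →
  sum (λ i → count (Q i)) < f → Colouring Q L
colouring′ {k = k} (suc f) δ Q L Q-sym Q-irr L-sym long fuel with search (λ i → 0 <ᵇ count (Q i))
... | inj₂ none = record
  { c = λ _ _ → δ ; c-sym = λ _ _ → refl
  ; c-list = λ {i} {j} q → absurd q ; c-proper = λ q _ _ → absurd q }
  where
  absurd : ∀ {i j} {A : Set} → Q i j ≡ true → A
  absurd {i} {j} q = true≢false (T⇒≡ (<⇒<ᵇ (∃⇒count>0 (Q i) j q))) (none i)
... | inj₁ (a , posa) with count>0⇒∃ (Q a) (<ᵇ⇒< 0 _ (≡⇒T posa))
-- Both ends of `ab` have degree at least one, so its list is not empty.
... | b , qab with count>0⇒∃ (L a b) (s≤s⁻¹ (≤-trans (+-mono-≤ (∃⇒count>0 (Q a) b qab) (∃⇒count>0 (Q b) a (trans (Q-sym b a) qab))) (long qab)))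
... | w , lw = record { c = c′ ; c-sym = c′-sym ; c-list = c′-list ; c-proper = c′-proper }
  where
  Q′ : Fin k → Fin k → Bool
  Q′ i j = Q i j ∧ not (pair a b i j)
  touch : Fin k → Fin k → Bool
  touch i j = end a b i ∨ end a b j
  L′ : Fin k → Fin k → Fin _ → Bool
  L′ i j y = L i j y ∧ not (touch i j ∧ (y == w))
  Q-drop : ∀ i → count (Q′ i) + ⟦ end a b i ⟧ ≤ count (Q i)
  Q-drop i with end a b i in eq
  ... | false = ≤-trans (≤-reflexive (+-identityʳ _)) (count-mono λ j h → proj₁ (∧-split h))
  ... | true  = ≤-trans (≤-reflexive (+-comm _ 1)) (case end-elim a b {i} eq of λ
        { (inj₁ refl) → lem b qab (pair-ab a b) ; (inj₂ refl) → lem a (trans (Q-sym b a) qab) (pair-ba a b) })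
    where
    lem : ∀ j → Q i j ≡ true → pair a b i j ≡ true → suc (count (Q′ i)) ≤ count (Q i)
    lem j q p = ≤-trans (s≤s (count-mono λ l h → let x , y = ∧-split {Q i l} h in
      ∖-∈ (Q i) x λ { refl → true≢false p (not-true y) })) (count-∖< (Q i) q)
  L-drop : ∀ i j → count (L i j) ≤ count (L′ i j) + ⟦ end a b i ⟧ + ⟦ end a b j ⟧
  L-drop i j with end a b i | end a b j
  ... | false | false = ≤-trans (count-mono {P = L i j} λ y h → ∧-join h refl) (≤-reflexive (sym (trans (+-identityʳ _) (+-identityʳ _))))
  ... | false | true  = ≤-trans (count-∖≤ (L i j) w) (≤-reflexive (sym (trans (cong (_+ 1) (+-identityʳ _)) (+-comm _ 1))))
  ... | true  | false = ≤-trans (count-∖≤ (L i j) w) (≤-reflexive (sym (trans (+-identityʳ _) (+-comm _ 1))))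
  ... | true  | true  = ≤-trans (count-∖≤ (L i j) w) (≤-trans (≤-reflexive (+-comm 1 _)) (m≤m+n _ 1))
  Q′-Q : ∀ {i j} → Q′ i j ≡ true → Q i j ≡ true
  Q′-Q {i} {j} h = proj₁ (∧-split {Q i j} h)
  Q′-sym : ∀ i j → Q′ i j ≡ Q′ j i
  Q′-sym i j rewrite Q-sym i j | pair-sym a b i j = refl
  Q′-irr : ∀ i → Q′ i i ≡ false
  Q′-irr i rewrite Q-irr i = refl
  L′-sym : ∀ i j y → L′ i j y ≡ L′ j i y
  L′-sym i j y rewrite L-sym i j y | ∨-comm (end a b i) (end a b j) = refl
  long′ : ∀ {i j} → Q′ i j ≡ true → count (Q′ i) + count (Q′ j) ≤ suc (count (L′ i j))
  long′ {i} {j} h = lists-shrink (count (Q′ i)) (count (Q i)) (count (Q′ j)) (count (Q j)) ⟦ end a b i ⟧ ⟦ end a b j ⟧ (count (L i j)) (count (L′ i j)) (Q-drop i) (Q-drop j) (long {i} {j} (Q′-Q {i} {j} h)) (L-drop i j)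
  fuel′ : sum (λ i → count (Q′ i)) < f
  fuel′ = begin-strict
    sum (λ i → count (Q′ i))                   <⟨ m<m+n _ (∃⇒count>0 (end a b) a (end-a a b)) ⟩
    sum (λ i → count (Q′ i)) + count (end a b) ≤⟨ sum-drop Q-drop ⟩
    sum (λ i → count (Q i))                    ≤⟨ s≤s⁻¹ fuel ⟩
    f ∎
    where open ≤-Reasoning
  rec : Colouring Q′ L′
  rec = colouring′ f δ Q′ L′ Q′-sym Q′-irr L′-sym long′ fuel′
  module R = Colouring rec
  c′ : Fin k → Fin k → Fin _
  c′ i j = if pair a b i j then w else R.c i j
  c′-sym : ∀ i j → c′ i j ≡ c′ j i
  c′-sym i j rewrite pair-sym a b i j | R.c-sym i j = refl
  c′-list : ∀ {i j} → Q i j ≡ true → L i j (c′ i j) ≡ true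
  c′-list {i} {j} q with pair a b i j in eq
  ... | false = proj₁ (∧-split (R.c-list (∧-join q (not-false eq))))
  ... | true with pair-elim a b {i} {j} eq
  ...   | inj₁ (refl , refl) = lw
  ...   | inj₂ (refl , refl) = trans (L-sym b a w) lw
  -- The remaining edges at `a` or `b` were coloured from lists without `w`.
  ≢w : ∀ i j l → Q i j ≡ true → pair a b i j ≡ false → pair a b i l ≡ true → R.c i j ≢ w
  ≢w i j l q p p′ e = true≢false (cong₂ _∧_ (cong (_∨ end a b j) (pair-end a b {i} {l} p′)) (trans (cong (_== w) e) (==-refl w)))
    (not-true (proj₂ (∧-split {L i j _} (R.c-list (∧-join q (not-false p))))))
  other : ∀ i j l → a ≢ b → pair a b i j ≡ true → pair a b i l ≡ true → j ≡ l
  other i j l a≢b p p′ with pair-elim a b {i} {j} p | pair-elim a b {i} {l} p′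
  ... | inj₁ (refl , refl) | inj₁ (_ , refl) = refl
  ... | inj₁ (refl , refl) | inj₂ (e , refl) = contradiction e a≢b
  ... | inj₂ (refl , refl) | inj₁ (e , refl) = contradiction (sym e) a≢b
  ... | inj₂ (refl , refl) | inj₂ (_ , refl) = refl
  c′-proper : ∀ {i j l} → Q i j ≡ true → Q i l ≡ true → c′ i j ≡ c′ i l → j ≡ l
  c′-proper {i} {j} {l} q q′ e with pair a b i j in p | pair a b i l in p′
  ... | true  | true  = other i j l (λ { refl → true≢false qab (Q-irr a) }) p p′
  ... | true  | false = contradiction (sym e) (≢w i l j q′ p′ p)
  ... | false | true  = contradiction e (≢w i j l q p p′)
  ... | false | false = R.c-proper (∧-join q (not-false p)) (∧-join q′ (not-false p′)) e

opaque
  -- The degree sum of the ends of an edge, less one, bounds the number of edges meeting it, itself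
  -- included: the greedy condition. The colour `δ` is a default for non-edges.
  colouring : (δ : Fin n) (Q : Fin k → Fin k → Bool) (L : Fin k → Fin k → Fin n → Bool) →
    (∀ i j → Q i j ≡ Q j i) → (∀ i → Q i i ≡ false) → (∀ i j y → L i j y ≡ L j i y) →
    (∀ {i j} → Q i j ≡ true → count (Q i) + count (Q j) ≤ suc (count (L i j))) → Colouring Q L
  colouring δ Q L Q-sym Q-irr L-sym long = colouring′ _ δ Q L Q-sym Q-irr L-sym long ≤-refl

-- Immersions through common neighbours

==-sym : (u v : Fin n) → (u == v) ≡ (v == u)
==-sym u v with u ≟ v
... | yes refl = sym (==-refl u)
... | no u≢v   = sym (≢⇒== (u≢v ∘ sym))

distinct : (Fin n → Bool) → Fin n → Fin n → Bool
distinct T u v = T u ∧ T v ∧ not (u == v)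

distinct-intro : (T : Fin n → Bool) {u v : Fin n} → T u ≡ true → T v ≡ true → u ≢ v → distinct T u v ≡ true
distinct-intro T tu tv u≢v rewrite tu | tv | ≢⇒== u≢v = refl

distinct-elim : (T : Fin n → Bool) {u v : Fin n} → distinct T u v ≡ true → T u ≡ true × T v ≡ true × u ≢ v
distinct-elim T {u} {v} h =
  let a , h′ = ∧-split {T u} h ; b , e = ∧-split {T v} h′ in a , b , ==⇒≢ (not-true e)

distinct-sym : (T : Fin n → Bool) (u v : Fin n) → distinct T u v ≡ distinct T v u
distinct-sym T u v rewrite ==-sym u v with T u | T v
... | true  | true  = refl
... | true  | false = refl
... | false | true  = refl
... | false | false = refl

distinct-irr : (T : Fin n → Bool) (u : Fin n) → distinct T u u ≡ false
distinct-irr T u rewrite ==-refl u with T u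
... | true  = refl
... | false = refl

complete : (Fin n → Bool) → Graph n
complete T = record
  { adj = distinct T ; symm = distinct-sym T ; irrefl = distinct-irr T }

range : (Fin t → Fin n) → Fin n → Bool
range τ = image (λ _ → true) τ

range-∈ : (τ : Fin t → Fin n) (i : Fin t) → range τ (τ i) ≡ true
range-∈ τ i = image-∈ (λ _ → true) τ refl

range-⊆ : (τ : Fin t → Fin n) (P : Fin n → Bool) → (∀ i → P (τ i) ≡ true) → ∀ {v} → range τ v ≡ true → P v ≡ true
range-⊆ τ P mem h = let i , _ , eq = image-∃ (λ _ → true) τ h in subst (λ v → P v ≡ true) eq (mem i)

count-range : (τ : Fin t → Fin n) → count (range τ) ≤ t
count-range τ = ≤-trans (count-image (λ _ → true) τ) (≤-reflexive count-full)

module _ (G : Graph n) (τ : Fin t → Fin n) where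
  private
    X = range τ

  -- Reroutes the complete graph on the terminals: adjacent pairs keep their edge, the others pass
  -- through a vertex outside. No terminal is a middle vertex, which settles `cross`.
  linked-via : (∀ {i j} → τ i ≡ τ j → i ≡ j) → (c : Fin n → Fin n → Fin n) → (∀ u v → c u v ≡ c v u) →
    (∀ {u v} → distinct X u v ≡ true → adj G u v ≡ false → adj G u (c u v) ≡ true × X (c u v) ≡ false) →
    (∀ {u v w} → distinct X u v ≡ true → adj G u v ≡ false → distinct X u w ≡ true → adj G u w ≡ false →
       c u v ≡ c u w → v ≡ w) → Linked G τ
  linked-via inj c c-sym mid proper = pullback R
    (clique-linked (complete X) τ inj λ i j i≢j → distinct-intro X (range-∈ τ i) (range-∈ τ j) (i≢j ∘ inj))
    λ i out → true≢false (range-∈ τ i) out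
    where
    D : Fin n → Fin n → Bool
    -- Direct edges are confined to pairs of terminals, so that an edge to a middle vertex never
    -- counts as direct.
    D u v = adj G u v ∧ distinct X u v
    non : ∀ {u v} → distinct X u v ≡ true → D u v ≡ false → adj G u v ≡ false
    non {u} {v} h d with adj G u v
    ... | false = refl
    ... | true  = true≢false h d
    R : Reroute (complete X) G (λ y → X y ≡ false)
    R = record
      { D = D ; c = c
      ; D-sym  = λ u v → cong₂ _∧_ (symm G u v) (distinct-sym X u v)
      ; c-sym  = c-sym
      ; direct = λ {u} {v} h d → proj₁ (∧-split {adj G u v} d)
      ; left   = λ h d → proj₁ (mid h (non h d))
      ; middle = λ h d → proj₂ (mid h (non h d))
      ; free   = λ {u} {v} h d → free′ {u} {v} (proj₂ (mid h (non h d)))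
      ; proper = λ h d h′ d′ → proper h (non h d) h′ (non h′ d′)
      ; cross  = λ h d h′ d′ eq _ →
          true≢false (proj₁ (distinct-elim X h)) (trans (cong X eq) (proj₂ (mid h′ (non h′ d′))))
      }
      where
      free′ : ∀ {u v} → X (c u v) ≡ false → D u (c u v) ≡ false
      free′ {u} {v} out with adj G u (c u v) | X u
      ... | false | _     = refl
      ... | true  | false = refl
      ... | true  | true rewrite out = refl

  private
    Q : Fin n → Fin n → Bool
    Q u v = distinct X u v ∧ not (adj G u v)
    L : Fin n → Fin n → Fin n → Bool
    L u v y = adj G u y ∧ adj G v y ∧ not (X y)

  -- Choosing middle vertices is a list edge colouring of the missing edges between terminals, the
  -- list of a pair being its common neighbours outside. Only pairs sharing a terminal need
  -- different middle vertices.
  linked-common : (∀ {i j} → τ i ≡ τ j → i ≡ j) → Fin n →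
    (∀ {u v} → distinct X u v ≡ true → adj G u v ≡ false →
      count (λ y → distinct X u y ∧ not (adj G u y)) + count (λ y → distinct X v y ∧ not (adj G v y)) ≤
      suc (count λ y → adj G u y ∧ adj G v y ∧ not (X y))) → Linked G τ
  linked-common inj δ long = linked-via inj Col.c Col.c-sym
    (λ {u} {v} h d → let a , b = ∧-split {adj G u (Col.c u v)} (Col.c-list (∧-join h (not-false d)))
                     in a , not-true (proj₂ (∧-split {adj G v (Col.c u v)} b)))
    (λ h d h′ d′ → Col.c-proper (∧-join h (not-false d)) (∧-join h′ (not-false d′)))
    where
    L-sym : ∀ u v y → L u v y ≡ L v u y
    L-sym u v y with adj G u y | adj G v y
    ... | true  | true  = refl
    ... | true  | false = refl
    ... | false | true  = refl
    ... | false | false = refl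
    Q-irr : ∀ u → Q u u ≡ false
    Q-irr u rewrite distinct-irr X u = refl
    col : Colouring Q L
    col = colouring δ Q L
      (λ u v → cong₂ (λ a b → a ∧ not b) (distinct-sym X u v) (symm G u v)) Q-irr L-sym
      (λ {u} {v} q → let h , a = ∧-split {distinct X u v} q in long h (not-true a))
    module Col = Colouring col

codegree : Graph n → Fin n → Fin n → ℕ
codegree G u v = count λ y → adj G u y ∧ adj G v y

opaque
  two-thirds : ∀ a b c x t → a ≤ t → b ≤ t → c ≤ t → t + t + t ≤ x + c → a + b ≤ suc x
  two-thirds a b c x t ha hb hc h = ≤-by 1 (+-mono-≤ (+-mono-≤ ha hb) (+-mono-≤ hc h))
    (solve (a ∷ b ∷ c ∷ x ∷ t ∷ []))

-- Each end of a pair has at most `t` missing edges, and at most `t` common neighbours are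
-- terminals: together `3t`.
linked-codegree : (G : Graph n) (X : Fin n → Bool) → 0 < t → t ≤ count X →
  (∀ {u v} → X u ≡ true → X v ≡ true → u ≢ v → t + t + t ≤ codegree G u v) →
  Σ[ τ ∈ (Fin t → Fin n) ] Linked G τ × (∀ i → X (τ i) ≡ true)
linked-codegree {t = suc t} G X _ le cod with choose (suc t) X le
... | τ , inj , mem = τ , linked-common G τ inj (τ zero) long , mem
  where
  Y = range τ
  sub : (f : Fin _ → Bool) (u : Fin _) → count (λ y → distinct Y u y ∧ f y) ≤ suc t
  sub f u = ≤-trans (count-mono λ y h → proj₁ (∧-split {Y y} (proj₂ (∧-split {Y u} (proj₁ (∧-split {distinct Y u y} h)))))) (count-range τ)
  long : ∀ {u v} → distinct Y u v ≡ true → adj G u v ≡ false →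
      count (λ y → distinct Y u y ∧ not (adj G u y)) + count (λ y → distinct Y v y ∧ not (adj G v y)) ≤
      suc (count λ y → adj G u y ∧ adj G v y ∧ not (Y y))
  long {u} {v} h _ with distinct-elim Y h
  ... | tu , tv , u≢v = two-thirds _ _ (count Y) _ (suc t) (sub (not ∘ adj G u) u) (sub (not ∘ adj G v) v) (count-range τ)
    (≤-trans (cod (range-⊆ τ X mem tu) (range-⊆ τ X mem tv) u≢v)
      (count-≤+ λ y → ≤ᵇ⇒≤ _ _ (tauto 3 (λ a b c → ⟦ a ∧ b ⟧ ≤ᵇ (⟦ a ∧ b ∧ not c ⟧ + ⟦ c ⟧)) tt (adj G u y) (adj G v y) (Y y))))

-- Any t vertices of S serve as terminals.

degree : Graph n → (Fin n → Bool) → Fin n → ℕ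
degree G S u = count λ y → S y ∧ adj G u y

opaque
  dense-arith : ∀ s x h t o ou ov mu mv du dv l → s ≤ t + x → x ≤ suc (h + h) → s ≤ o + t → o ≤ l + (ou + ov) →
    mu + ou + du ≤ s → mv + ov + dv ≤ s → t + h < du → t + h < dv → mu + mv ≤ suc l
  dense-arith s x h t o ou ov mu mv du dv l h₁ h₂ h₃ h₄ h₅ h₆ h₇ h₈ =
    ≤-by 2 (+-mono-≤ (+-mono-≤ (+-mono-≤ h₁ h₂) (+-mono-≤ h₃ h₄)) (+-mono-≤ (+-mono-≤ h₅ h₆) (+-mono-≤ h₇ h₈)))
      (solve (s ∷ x ∷ h ∷ t ∷ o ∷ ou ∷ ov ∷ mu ∷ mv ∷ du ∷ dv ∷ l ∷ []))

-- A terminal has at most `x - h - 1` non-neighbours other than itself in `S`. Those among the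
-- terminals are edges to colour, those outside shorten the lists of the `x` other vertices; two
-- terminals account for at most `2 (x - h - 1) < x` of both kinds together.
linked-dense : (G : Graph n) (S : Fin n → Bool) (x h : ℕ) → 0 < t → count S ≡ t + x → x ≤ suc (h + h) →
  (∀ {u} → S u ≡ true → t + h < degree G S u) → Σ[ τ ∈ (Fin t → Fin n) ] Linked G τ
linked-dense {t = suc t} G S x h _ size x≤ deg with choose (suc t) S (≤-trans (m≤m+n _ x) (≤-reflexive (sym size)))
... | τ , inj , mem = τ , linked-common G τ inj (τ zero) long
  where
  Y = range τ
  out : Fin _ → Fin _ → Bool
  out u y = S y ∧ not (Y y) ∧ not (adj G u y)
  miss : Fin _ → Fin _ → Bool
  miss u y = distinct Y u y ∧ not (adj G u y)
  total : ∀ u → count (miss u) + count (out u) + degree G S u ≤ count S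
  total u = ≤-trans (+-monoˡ-≤ (degree G S u) (count-+≤ {R = λ y → S y ∧ not (adj G u y)} λ y → ≤ᵇ⇒≤ _ _ (⇒-elim
      (tauto 5 (λ t s v e a → not (not t ∨ s) ∨ (⟦ (v ∧ t ∧ not e) ∧ not a ⟧ + ⟦ s ∧ not t ∧ not a ⟧ ≤ᵇ ⟦ s ∧ not a ⟧)) tt
        (Y y) (S y) (Y u) (u == y) (adj G u y)) (⇒-intro (range-⊆ τ S mem)))))
    (count-+≤ λ y → ≤ᵇ⇒≤ _ _ (tauto 2 (λ s a → (⟦ s ∧ not a ⟧ + ⟦ s ∧ a ⟧) ≤ᵇ ⟦ s ⟧) tt (S y) (adj G u y)))
  long : ∀ {u v} → distinct Y u v ≡ true → adj G u v ≡ false →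
      count (miss u) + count (miss v) ≤ suc (count λ y → adj G u y ∧ adj G v y ∧ not (Y y))
  long {u} {v} h′ _ with distinct-elim Y h′
  ... | tu , tv , _ = dense-arith (count S) x h (suc t) (count λ y → S y ∧ not (Y y)) (count (out u)) (count (out v)) _ _
    (degree G S u) (degree G S v) _ (≤-reflexive size) x≤
    (≤-trans (count-≤+ λ y → ≤ᵇ⇒≤ _ _ (tauto 2 (λ s t → ⟦ s ⟧ ≤ᵇ (⟦ s ∧ not t ⟧ + ⟦ t ⟧)) tt (S y) (Y y)))
      (+-monoʳ-≤ _ (count-range τ)))
    (≤-trans (count-≤+ {R = λ y → out u y ∨ out v y} λ y → ≤ᵇ⇒≤ _ _ (tauto 4 (λ s t a b → ⟦ s ∧ not t ⟧ ≤ᵇ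
        (⟦ a ∧ b ∧ not t ⟧ + ⟦ (s ∧ not t ∧ not a) ∨ (s ∧ not t ∧ not b) ⟧)) tt (S y) (Y y) (adj G u y) (adj G v y)))
      (+-monoʳ-≤ _ (count-∨ (out u) (out v))))
    (total u) (total v) (deg (range-⊆ τ S mem tu)) (deg (range-⊆ τ S mem tv))

-- Independent sets

module _ (bad : Fin n → Fin n → Bool) (bad-sym : ∀ u v → bad u v ≡ bad v u) where

  badIn : (Fin n → Bool) → Fin n → Fin n → Bool
  badIn X u v = (X ∖ u) v ∧ bad u v

  Independent : (Fin n → Bool) → Set
  Independent Y = ∀ {u v} → Y u ≡ true → Y v ≡ true → u ≢ v → bad u v ≡ false

  -- Each chosen vertex uses up at most `t` vertices of `X`: itself and fewer than `t` that are bad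
  -- with it.
  greedy-independent : ∀ k (X : Fin n → Bool) → 0 < t → (∀ {u} → X u ≡ true → count (badIn X u) < t) → k * t ≤ count X →
    Σ[ Y ∈ (Fin n → Bool) ] (∀ {u} → Y u ≡ true → X u ≡ true) × k ≤ count Y × Independent Y
  greedy-independent zero X _ few le = (λ _ → false) , (λ ()) , z≤n , λ ()
  greedy-independent {t = suc t} (suc k) X pos few le with count>0⇒∃ X (≤-trans (s≤s z≤n) le)
  ... | u , xu = Y′ , Y′⊆X , card , ind
    where
    X′ : Fin n → Bool
    X′ v = (X ∖ u) v ∧ not (bad u v)
    X′⊆X : ∀ {v} → X′ v ≡ true → X v ≡ true
    X′⊆X {v} h = proj₁ (∖-⊆ X (proj₁ (∧-split {(X ∖ u) v} h)))
    size : k * suc t ≤ count X′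
    size = +-cancelˡ-≤ (suc t) _ _ (begin
      suc t + k * suc t                 ≤⟨ le ⟩
      count X                           ≤⟨ count-∖≤ X u ⟩
      suc (count (X ∖ u))               ≤⟨ s≤s (count-≤+ λ v → ≤ᵇ⇒≤ _ _ (tauto 2 (λ a b → ⟦ a ⟧ ≤ᵇ (⟦ a ∧ b ⟧ + ⟦ a ∧ not b ⟧)) tt ((X ∖ u) v) (bad u v))) ⟩
      suc (count (badIn X u) + count X′) ≤⟨ +-monoˡ-≤ (count X′) (few xu) ⟩
      suc t + count X′                  ∎)
      where open ≤-Reasoning
    IH = greedy-independent k X′ pos (λ {v} h → ≤-<-trans (count-mono λ w h′ →
           let a , b = ∧-split {(X′ ∖ v) w} h′ ; c , d = ∖-⊆ X′ a in ∧-join (∖-∈ X (X′⊆X c) d) b) (few (X′⊆X h))) size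
    Y = proj₁ IH
    Y⊆X′ : ∀ {v} → Y v ≡ true → X′ v ≡ true
    Y⊆X′ = proj₁ (proj₂ IH)
    Y′ : Fin n → Bool
    Y′ v = (v == u) ∨ Y v
    Y′-elim : ∀ {v} → Y′ v ≡ true → v ≡ u ⊎ Y v ≡ true
    Y′-elim {v} h with v ≟ u
    ... | yes e = inj₁ e
    ... | no _  = inj₂ h
    Y′⊆X : ∀ {v} → Y′ v ≡ true → X v ≡ true
    Y′⊆X h with Y′-elim h
    ... | inj₁ refl = xu
    ... | inj₂ y    = X′⊆X (Y⊆X′ y)
    card : suc k ≤ count Y′
    card = begin
      suc k                    ≤⟨ s≤s (proj₁ (proj₂ (proj₂ IH))) ⟩
      suc (count Y)            ≤⟨ s≤s (count-mono λ v y → ∖-∈ Y′ (lem v y) λ { refl → proj₂ (∖-⊆ X (proj₁ (∧-split {(X ∖ u) u} (Y⊆X′ y)))) refl }) ⟩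
      suc (count (Y′ ∖ u))     ≤⟨ count-∖< Y′ (cong (_∨ Y u) (==-refl u)) ⟩
      count Y′                 ∎
      where
      open ≤-Reasoning
      lem : ∀ v → Y v ≡ true → Y′ v ≡ true
      lem v y with v == u
      ... | true  = refl
      ... | false = y
    good : ∀ {v} → Y v ≡ true → bad u v ≡ false
    good {v} y = not-true (proj₂ (∧-split {(X ∖ u) v} (Y⊆X′ y)))
    ind : Independent Y′
    ind {v} {w} yv yw v≢w with Y′-elim yv | Y′-elim yw
    ... | inj₁ refl | inj₁ refl = contradiction refl v≢w
    ... | inj₁ refl | inj₂ y    = good y
    ... | inj₂ y    | inj₁ refl = trans (bad-sym v u) (good y)
    ... | inj₂ y    | inj₂ y′   = proj₂ (proj₂ (proj₂ IH)) y y′ v≢w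

  -- The bound `t²` for a triangle against an independent set of size `t`: without triangles the bad
  -- partners of a vertex are independent, and if all have fewer than `t` of them, the greedy choice
  -- works.
  ramsey : (X : Fin n → Bool) → 0 < t →
    (∀ {u v w} → X u ≡ true → X v ≡ true → X w ≡ true → u ≢ v → u ≢ w → v ≢ w →
       bad u v ≡ true → bad u w ≡ true → bad v w ≡ false) →
    t * t ≤ count X →
    Σ[ Y ∈ (Fin n → Bool) ] (∀ {u} → Y u ≡ true → X u ≡ true) × t ≤ count Y × Independent Y
  ramsey {t = t} X pos free le with search (λ u → X u ∧ (t ≤ᵇ count (badIn X u)))
  ... | inj₁ (u , h) =
    let xu , big = ∧-split {X u} h
        split : ∀ {v} → badIn X u v ≡ true → X v ≡ true × v ≢ u × bad u v ≡ true
        split {v} h = let a , b = ∧-split {(X ∖ u) v} h ; c , d = ∖-⊆ X a in c , d , b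
    in badIn X u , (λ h → proj₁ (split h)) , ≤ᵇ⇒≤ t _ (≡⇒T big) , λ hv hw v≢w →
         let xv , v≢u , b = split hv ; xw , w≢u , b′ = split hw
         in free xu xv xw (v≢u ∘ sym) (w≢u ∘ sym) v≢w b b′
  ... | inj₂ none = greedy-independent t X pos (λ {u} xu → ≰⇒> λ le′ → true≢false (∧-join xu (T⇒≡ (≤⇒≤ᵇ le′))) (none u)) le

-- Matchings, encoded as involutions whose fixed points are the unmatched vertices

module _ (H : Fin n → Fin n → Bool) (H-sym : ∀ u v → H u v ≡ H v u) (H-irr : ∀ u → H u u ≡ false) where

  record Matching : Set where
    field
      μ    : Fin n → Fin n
      invo : ∀ a → μ (μ a) ≡ a
      edge : ∀ a → μ a ≢ a → H a (μ a) ≡ true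

  open Matching

  -- Match u with y, leaving the former partner of y unmatched.
  module PairUp (N : Matching) {u y : Fin n} (fix : μ N u ≡ u) (h : H u y ≡ true) where

    μ′ : Fin n → Fin n
    μ′ a with a ≟ u | a ≟ y | a ≟ μ N y
    ... | yes _ | _     | _     = y
    ... | no _  | yes _ | _     = u
    ... | no _  | no _  | yes _ = a
    ... | no _  | no _  | no _  = μ N a

    u≢y : u ≢ y
    u≢y refl = true≢false h (H-irr u)

    at-u : μ′ u ≡ y
    at-u with u ≟ u
    ... | yes _  = refl
    ... | no u≢u = contradiction refl u≢u

    at-y : μ′ y ≡ u
    at-y with y ≟ u | y ≟ y
    ... | yes e | _      = contradiction (sym e) u≢y
    ... | no _  | yes _  = refl
    ... | no _  | no y≢y = contradiction refl y≢y

    at-z : μ N y ≢ y → μ′ (μ N y) ≡ μ N y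
    at-z z≢y with μ N y ≟ u | μ N y ≟ y | μ N y ≟ μ N y
    ... | yes e | _     | _     = contradiction (sym (trans (sym (invo N y)) (trans (cong (μ N) e) fix))) u≢y
    ... | no _  | yes e | _     = contradiction e z≢y
    ... | no _  | no _  | yes _ = refl
    ... | no _  | no _  | no ne = contradiction refl ne

    other : ∀ {a} → a ≢ u → a ≢ y → a ≢ μ N y → μ′ a ≡ μ N a
    other {a} a≢u a≢y a≢z with a ≟ u | a ≟ y | a ≟ μ N y
    ... | yes e | _     | _     = contradiction e a≢u
    ... | no _  | yes e | _     = contradiction e a≢y
    ... | no _  | no _  | yes e = contradiction e a≢z
    ... | no _  | no _  | no _  = refl

    paired : Matching
    paired = record { μ = μ′ ; invo = invo′ ; edge = edge′ }
      where
      invo′ : ∀ a → μ′ (μ′ a) ≡ a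
      invo′ a with a ≟ u
      ... | yes refl = at-y
      ... | no a≢u with a ≟ y
      ...   | yes refl = at-u
      ...   | no a≢y with a ≟ μ N y
      ...     | yes refl = at-z λ e → a≢y e
      ...     | no a≢z   = trans (other
                  (λ e → a≢u (trans (sym (invo N a)) (trans (cong (μ N) e) fix)))
                  (λ e → a≢z (trans (sym (invo N a)) (cong (μ N) e)))
                  (λ e → a≢y (trans (sym (invo N a)) (trans (cong (μ N) e) (invo N y))))) (invo N a)
      edge′ : ∀ a → μ′ a ≢ a → H a (μ′ a) ≡ true
      edge′ a ne with a ≟ u
      ... | yes refl = h
      ... | no a≢u with a ≟ y
      ...   | yes refl = trans (H-sym y u) h
      ...   | no a≢y with a ≟ μ N y
      ...     | yes _  = contradiction refl ne
      ...     | no _   = edge N a ne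

    fixed-new : ∀ {a} → μ′ a ≡ a → a ≢ u × (a ≡ μ N y ⊎ μ N a ≡ a)
    fixed-new {a} e with a ≟ u
    ... | yes refl = contradiction (sym e) u≢y
    ... | no a≢u with a ≟ y
    ...   | yes refl = contradiction e u≢y
    ...   | no a≢y with a ≟ μ N y
    ...     | yes z = a≢u , inj₁ z
    ...     | no _  = a≢u , inj₂ e

  -- If `y` is matched, `u, y, μ N y, u′` is an augmenting path: pairing `u` with `y` frees the old
  -- partner, which `u′` then takes. If `y` is unmatched, it is paired with `u`. The last clause
  -- serves to keep `x` free.
  augment : (N : Matching) {u u′ y : Fin n} → μ N u ≡ u → μ N u′ ≡ u′ → u ≢ u′ →
            H u y ≡ true → H u′ (μ N y) ≡ true →
            Σ[ N′ ∈ Matching ] (∀ {a} → μ N′ a ≡ a → a ≢ u × μ N a ≡ a) ×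
              (∀ {a} → μ N a ≡ a → a ≢ u → a ≢ u′ → a ≢ y → μ N′ a ≡ a)
  augment N {u} {u′} {y} fu fu′ u≢u′ h h′ with μ N y ≟ y
  ... | yes fy = P.paired , (λ e → proj₁ (P.fixed-new e) , [ (λ a≡z → trans (cong (μ N) (trans a≡z fy)) (trans fy (sym (trans a≡z fy)))) , id ]′ (proj₂ (P.fixed-new e)))
               , λ fa a≢u _ a≢y → trans (P.other a≢u a≢y (λ e → a≢y (trans e fy))) fa
    where module P = PairUp N fu h
  ... | no z≢y = P₂.paired , fixed-P₂ , kept
    where
    module P₁ = PairUp N fu h
    u′≢y : u′ ≢ y
    u′≢y refl = true≢false (subst (λ w → H u′ w ≡ true) fu′ h′) (H-irr u′)
    u′≢z : u′ ≢ μ N y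
    u′≢z e = true≢false (subst (λ w → H u′ w ≡ true) (sym e) h′) (H-irr u′)
    fix₁ : P₁.μ′ u′ ≡ u′
    fix₁ = trans (P₁.other (u≢u′ ∘ sym) u′≢y u′≢z) fu′
    module P₂ = PairUp P₁.paired {u′} {μ N y} fix₁ h′
    fixed-P₂ : ∀ {a} → P₂.μ′ a ≡ a → a ≢ u × μ N a ≡ a
    fixed-P₂ {a} e with P₂.fixed-new e
    ... | _ , inj₁ a≡ = contradiction (trans (cong P₂.μ′ (sym (trans a≡ (P₁.at-z z≢y)))) (trans e (trans a≡ (P₁.at-z z≢y)))) λ e′ →
            P₂.u≢y (trans (sym P₂.at-y) e′)
    ... | _ , inj₂ fa with P₁.fixed-new fa
    ...   | a≢u , inj₂ f  = a≢u , f
    ...   | a≢u , inj₁ a≡ = contradiction (trans (cong P₂.μ′ (sym a≡)) (trans e a≡)) λ e′ → P₂.u≢y (trans (sym P₂.at-y) e′)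
    kept : ∀ {a} → μ N a ≡ a → a ≢ u → a ≢ u′ → a ≢ y → P₂.μ′ a ≡ a
    kept {a} fa a≢u a≢u′ a≢y = trans (P₂.other a≢u′ a≢z (λ e → a≢z (trans e (P₁.at-z z≢y)))) (trans (P₁.other a≢u a≢y a≢z) fa)
      where
      a≢z : a ≢ μ N y
      a≢z refl = z≢y (sym (trans (sym (invo N y)) fa))

  -- Vertices of small degree (med) are matched first; the others have degree over half, so any two
  -- unmatched ones admit an augmenting path of length at most three.
  module NearPerfect (R med : Fin n → Bool) (x : Fin n)
    (H⊆R : ∀ {u v} → H u v ≡ true → R v ≡ true)
    (x-large : med x ≡ false) (x∈R : R x ≡ true)
    (small : ∀ {u} → med u ≡ true → suc (count med) < count (H u))
    (large : ∀ {u} → R u ≡ true → med u ≡ false → suc (suc (count R)) ≤ count (H u) + count (H u)) where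

    fixed : Matching → Fin n → Bool
    fixed N a = μ N a == a

    -- A small vertex has more than `count med + 1` neighbours, so one of them is neither `x` nor
    -- the partner of a small vertex; pairing with it unmatches no small vertex.
    matchSmall : ∀ f (N : Matching) → μ N x ≡ x → count (λ a → med a ∧ fixed N a) < f →
                 Σ[ N′ ∈ Matching ] μ N′ x ≡ x × (∀ {a} → med a ≡ true → μ N′ a ≢ a)
    matchSmall (suc f) N fx fuel with search (λ a → med a ∧ fixed N a)
    ... | inj₂ none = N , fx , λ {a} m e → true≢false (∧-join m (trans (cong (_== a) e) (==-refl a))) (none a)
    ... | inj₁ (u , h) with ∧-split {med u} h
    ... | mu , fu with count-<⇒∃ (λ y → med (μ N y) ∨ (y == x)) (H u) (≤-<-trans
           (count-∨ (med ∘ μ N) (_== x))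
           (≤-<-trans (≤-reflexive (trans (cong₂ _+_ (count-involution (μ N) (invo N) med) (count-point x)) (+-comm _ 1))) (small mu)))
    ... | y , hy , ny = matchSmall f P.paired fx′ (<-≤-trans (≤-trans (s≤s (count-mono shrink)) (count-∖< _ {u} h)) (s≤s⁻¹ fuel))
      where
      module P = PairUp N (==⇒≡ fu) hy
      nz : med (μ N y) ≡ false
      nz = proj₁ (∨-false ny)
      y≢x : y ≢ x
      y≢x = ==⇒≢ (proj₂ (∨-false {med (μ N y)} ny))
      fx′ : P.μ′ x ≡ x
      fx′ = trans (P.other (λ { refl → true≢false mu x-large }) (y≢x ∘ sym) (λ e → y≢x (trans (sym (invo N y)) (trans (cong (μ N) (sym e)) fx)))) fx
      shrink : ∀ a → (med a ∧ fixed P.paired a) ≡ true → ((λ a → med a ∧ fixed N a) ∖ u) a ≡ true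
      shrink a h with ∧-split {med a} h
      ... | ma , fa with P.fixed-new {a} (==⇒≡ fa)
      ... | a≢u , inj₁ refl = true≢false ma nz
      ... | a≢u , inj₂ f = ∖-∈ (λ a → med a ∧ fixed N a) (∧-join ma (trans (cong (_== a) f) (==-refl a))) a≢u

    -- `H u` and the set of `y` with `μ N y` in `H u′` both lie in `R`, and their sizes add up to at
    -- least `count R + 2`. So they share two vertices, one of which is not `x`.
    extend : (N : Matching) → (∀ {a} → med a ≡ true → μ N a ≢ a) → ∀ {u u′} → μ N u ≡ u → μ N u′ ≡ u′ →
             R u ≡ true → R u′ ≡ true → ∃ λ y → H u y ≡ true × H u′ (μ N y) ≡ true × y ≢ x
    extend N done {u} {u′} fu fu′ ru ru′ with count-<⇒∃ (_== x) (λ y → H u y ∧ H u′ (μ N y)) (subst (_< _) (sym (count-point x)) two)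
      where
      inR : ∀ y → H u′ (μ N y) ≡ true → R y ≡ true
      inR y h with μ N y ≟ y
      ... | yes e = subst (λ w → R w ≡ true) e (H⊆R h)
      ... | no ne = H⊆R (trans (H-sym (μ N y) y) (edge N y ne))
      not-med : ∀ {a} → μ N a ≡ a → med a ≡ false
      not-med {a} f with med a in eq
      ... | true  = contradiction f (done eq)
      ... | false = refl
      both : count (H u) + count (H u′ ∘ μ N) ≤ count R + count (λ y → H u y ∧ H u′ (μ N y))
      both = count-+≤+ λ y → ≤ᵇ⇒≤ _ _ (⇒-elim (⇒-elim {H u y ∨ not (H u y)}
        (tauto 3 (λ a b r → not (a ∨ not a) ∨ (not ((not a ∨ r) ∧ (not b ∨ r)) ∨ (⟦ a ⟧ + ⟦ b ⟧ ≤ᵇ ⟦ r ⟧ + ⟦ a ∧ b ⟧))) tt (H u y) (H u′ (μ N y)) (R y))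
        (T⇒≡ (tauto 1 (λ a → a ∨ not a) tt (H u y))))
        (∧-join (⇒-intro H⊆R) (⇒-intro (inR y))))
      two : 1 < count (λ y → H u y ∧ H u′ (μ N y))
      two = arith {a = count (H u)} {count (H u′)} (large ru (not-med fu)) (large ru′ (not-med fu′))
        (≤-trans (≤-reflexive (cong (count (H u) +_) (sym (count-involution (μ N) (invo N) (H u′))))) both)
        where
        arith : ∀ {r a b c} → suc (suc r) ≤ a + a → suc (suc r) ≤ b + b → a + b ≤ r + c → 2 ≤ c
        arith {r} {a} {b} {c} h₁ h₂ h₃ with 2 ≤? c
        ... | yes p = p
        ... | no ¬p = contradiction (begin-strict
            (r + c) + (r + c)       <⟨ +-mono-< (+-monoʳ-< r (≰⇒> ¬p)) (+-monoʳ-< r (≰⇒> ¬p)) ⟩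
            (r + 2) + (r + 2)       ≡⟨ cong₂ _+_ (+-comm r 2) (+-comm r 2) ⟩
            (2 + r) + (2 + r)       ≤⟨ +-mono-≤ h₁ h₂ ⟩
            (a + a) + (b + b)       ≡⟨ +-interchange a a b b ⟩
            (a + b) + (a + b)       ≤⟨ +-mono-≤ h₃ h₃ ⟩
            (r + c) + (r + c)       ∎) (n≮n _)
          where
          open ≤-Reasoning
    ... | y , h , y≢x = y , proj₁ (∧-split {H u y} h) , proj₂ (∧-split {H u y} h) , ==⇒≢ y≢x

    -- While two unmatched vertices other than `x` remain, they are augmented with `x` kept free. A
    -- single one left over is augmented together with `x`, which settles the parity.
    matchLarge : ∀ f (N : Matching) → μ N x ≡ x → (∀ {a} → med a ≡ true → μ N a ≢ a) → count (λ a → R a ∧ fixed N a) < f →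
                 Σ[ N′ ∈ Matching ] (∀ {a} → R a ≡ true → a ≢ x → μ N′ a ≢ a)
    matchLarge (suc f) N fx done fuel with search (λ a → (R ∖ x) a ∧ fixed N a)
    ... | inj₂ none = N , λ {a} ra a≢x e → true≢false (∧-join (∖-∈ R ra a≢x) (trans (cong (_== a) e) (==-refl a))) (none a)
    ... | inj₁ (u , hu) with ∧-split {(R ∖ x) u} hu
    ... | ru′ , fu′ with ∖-⊆ R ru′ | ==⇒≡ fu′ | search (λ a → ((R ∖ x) ∖ u) a ∧ fixed N a)
    ... | ru , u≢x | fu | inj₁ (v , hv) with ∧-split {((R ∖ x) ∖ u) v} hv
    ... | rv′ , fv with ∖-⊆ (R ∖ x) rv′
    ... | rv″ , v≢u with ∖-⊆ R rv″
    ... | rv , v≢x with extend N done fu (==⇒≡ fv) ru rv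
    ... | y , h , h′ , y≢x with augment N fu (==⇒≡ fv) (v≢u ∘ sym) h h′
    ... | N′ , old , kept = matchLarge f N′ (kept fx (u≢x ∘ sym) (v≢x ∘ sym) (y≢x ∘ sym)) (λ m e → done m (proj₂ (old e)))
          (<-≤-trans (≤-trans (s≤s (count-mono shrink)) (count-∖< _ {u} (∧-join ru fu′))) (s≤s⁻¹ fuel))
      where
      shrink : ∀ a → (R a ∧ fixed N′ a) ≡ true → ((λ a → R a ∧ fixed N a) ∖ u) a ≡ true
      shrink a h with ∧-split {R a} h
      ... | ra , fa with old {a} (==⇒≡ fa)
      ... | a≢u , f = ∖-∈ (λ a → R a ∧ fixed N a) (∧-join ra (trans (cong (_== a) f) (==-refl a))) a≢u
    matchLarge (suc f) N fx done fuel | inj₁ (u , hu) | ru′ , fu′ | ru , u≢x | fu | inj₂ none with extend N done fu fx ru x∈R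
    ... | y , h , h′ , _ with augment N fu fx u≢x h h′
    ... | N′ , old , _ = N′ , λ {a} ra a≢x e → let a≢u , fa = old e in
            true≢false (∧-join (∖-∈ (R ∖ x) (∖-∈ R ra a≢x) a≢u) (trans (cong (_== a) fa) (==-refl a))) (none a)

    nearPerfect : Σ[ N ∈ Matching ] (∀ {a} → R a ≡ true → a ≢ x → μ N a ≢ a)
    nearPerfect =
      let N , fx , done = matchSmall _ (record { μ = id ; invo = λ _ → refl ; edge = λ a ne → contradiction refl ne }) refl ≤-refl
      in matchLarge _ N fx done ≤-refl

-- Eliminating a vertex by splitting off pairs of its edges

module _ (G : Graph n) (w : Fin n) (R : Fin n → Bool) where

  -- Non-adjacency is required because a new edge must not double an old one.
  splittable : Fin n → Fin n → Bool
  splittable u v = distinct R u v ∧ not (adj G u v)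

  splittable-sym : ∀ u v → splittable u v ≡ splittable v u
  splittable-sym u v = cong₂ (λ a b → a ∧ not b) (distinct-sym R u v) (symm G u v)

  splittable-irr : ∀ u → splittable u u ≡ false
  splittable-irr u rewrite distinct-irr R u = refl

  module Eliminate (N : Matching splittable splittable-sym splittable-irr)
    (R⊆N : ∀ {u} → R u ≡ true → adj G u w ≡ true) (w∉R : R w ≡ false) where
    open Matching N

    kept : Fin n → Fin n → Bool
    kept a b = adj G a b ∧ (not (a == w) ∧ not (b == w))

    new : Fin n → Fin n → Bool
    new a b = not (a == b) ∧ (b == μ a)

    new-elim : ∀ {a b} → new a b ≡ true → b ≡ μ a × R a ≡ true × R b ≡ true × adj G a b ≡ false
    new-elim {a} {b} h =
      let ne , e = ∧-split {not (a == b)} h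
          b≡μa = ==⇒≡ e
          q , r = ∧-split {distinct R a b} (subst (λ z → splittable a z ≡ true) (sym b≡μa)
                    (edge a λ e′ → ==⇒≢ (not-true ne) (sym (trans b≡μa e′))))
          ra , rb , _ = distinct-elim R q
      in b≡μa , ra , rb , not-true r

    new-intro : ∀ {a} → μ a ≢ a → new a (μ a) ≡ true
    new-intro {a} ne rewrite ≢⇒== (ne ∘ sym) = ==-refl (μ a)

    new-sym : ∀ a b → new a b ≡ new b a
    new-sym a b rewrite ==-sym a b = cong (not (b == a) ∧_) (lem a b)
      where
      lem : ∀ a b → (b == μ a) ≡ (a == μ b)
      lem a b with b ≟ μ a | a ≟ μ b
      ... | yes _ | yes _ = refl
      ... | no _  | no _  = refl
      ... | yes e | no ne = contradiction (trans (sym (invo a)) (cong μ (sym e))) ne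
      ... | no ne | yes e = contradiction (trans (sym (invo b)) (cong μ (sym e))) ne

    G′ : Graph n
    G′ = record
      { adj    = λ a b → kept a b ∨ new a b
      ; symm   = λ a b → cong₂ _∨_ (cong₂ _∧_ (symm G a b) (∧-comm (not (a == w)) _)) (new-sym a b)
      ; irrefl = irr }
      where
      irr : ∀ a → (kept a a ∨ new a a) ≡ false
      irr a rewrite irrefl G a | ==-refl a = refl

    new-of : ∀ {a b} → adj G′ a b ≡ true → kept a b ≡ false → new a b ≡ true
    new-of {a} {b} h k with kept a b
    ... | false = h

    -- A new edge stands for a path through `w`. The new edges form a matching, so no edge at `w` is
    -- used twice.
    reroute : Reroute G′ G (_≡ w)
    reroute = record
      { D = kept ; c = λ _ _ → w
      ; D-sym  = λ a b → cong₂ _∧_ (symm G a b) (∧-comm (not (a == w)) _)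
      ; c-sym  = λ _ _ → refl
      ; direct = λ {a} {b} _ k → proj₁ (∧-split {adj G a b} k)
      ; left   = λ h k → R⊆N (proj₁ (proj₂ (new-elim (new-of h k))))
      ; middle = λ _ _ → refl
      ; free   = λ {a} _ _ → free′ a
      ; proper = λ h k h′ k′ _ → trans (proj₁ (new-elim (new-of h k))) (sym (proj₁ (new-elim (new-of h′ k′))))
      ; cross  = λ h k _ _ e _ → true≢false (proj₁ (proj₂ (new-elim (new-of h k)))) (trans (cong R e) w∉R)
      }
      where
      free′ : ∀ a → kept a w ≡ false
      free′ a rewrite ==-refl w with adj G a w | a == w
      ... | true  | true  = refl
      ... | true  | false = refl
      ... | false | _     = refl

    kept-adj : ∀ {a b} → adj G a b ≡ true → a ≢ w → b ≢ w → adj G′ a b ≡ true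
    kept-adj a≡ ne ne′ rewrite a≡ | ≢⇒== ne | ≢⇒== ne′ = refl

    new-adj : ∀ {a b} → new a b ≡ true → adj G′ a b ≡ true
    new-adj {a} {b} h with kept a b
    ... | true  = refl
    ... | false = h

opaque
  large-arith : ∀ r h a d e t → r ≤ h + a + 1 → a ≤ d + e → e ≤ t → d + d + (t + t) + 4 ≤ r → suc (suc r) ≤ h + h
  large-arith r h a d e t h₁ h₂ h₃ h₄ =
    ≤-by 0 (+-mono-≤ (+-mono-≤ (+-mono-≤ h₁ h₁) (+-mono-≤ h₂ h₂)) (+-mono-≤ (+-mono-≤ h₃ h₃) h₄))
      (solve (r ∷ h ∷ a ∷ d ∷ e ∷ t ∷ []))

  small-arith : ∀ b h e t m c → b ≤ h + 1 + e → e ≤ t → m + t + 3 ≤ b → c ≤ m → suc c < h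
  small-arith b h e t m c h₁ h₂ h₃ h₄ =
    ≤-by 0 (+-mono-≤ (+-mono-≤ h₁ h₂) (+-mono-≤ h₃ h₄)) (solve (b ∷ h ∷ e ∷ t ∷ m ∷ c ∷ []))

-- Eliminate the vertices of W one after the other. Degrees outside W are preserved, except at x,
-- which absorbs the parity defects.

module Epoch (G₀ : Graph n) (S W : Fin n → Bool) (x : Fin n) (t m d : ℕ) where

  R : Fin n → Fin n → Bool
  R w y = S y ∧ adj G₀ w y ∧ not (W y)

  -- Adjacent to nearly half of `R w` or more. The slack `2t + 4` allows for `t` new edges at each
  -- vertex, so that the other vertices of `R w` still have more than half of it as non-neighbours
  -- when `w` is reached.
  med : Fin n → Fin n → Bool
  med w u = R w u ∧ (count (R w) <ᵇ degree G₀ (R w) u + degree G₀ (R w) u + (t + t) + 4)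

  -- The state after `k` eliminations, `Sc` being the surviving vertices. An elimination adds at
  -- most one edge at a vertex and none at `W`, so the data `R` and `med` can be read off from `G₀`
  -- throughout.
  record Stage (k : ℕ) : Set where
    field
      G     : Graph n
      Sc    : Fin n → Bool
      Sc⊆S  : ∀ {u} → Sc u ≡ true → S u ≡ true
      Sc⊇   : ∀ {u} → S u ≡ true → W u ≡ false → Sc u ≡ true
      left  : k + count (λ u → Sc u ∧ W u) ≤ t
      extra : ∀ u → count (λ y → adj G u y ∧ not (adj G₀ u y)) ≤ k
      rows  : ∀ {w y} → W w ≡ true → Sc w ≡ true → Sc y ≡ true → adj G w y ≡ adj G₀ w y
      deg   : ∀ {u} → S u ≡ true → W u ≡ false → u ≢ x → d ≤ degree G Sc u
      deg-x : d ≤ degree G Sc x + k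
      pull  : ∀ {s} {τ : Fin s → Fin n} → Linked G τ → (∀ i → Sc (τ i) ≡ true) → Linked G₀ τ

  module _ (x∈S : S x ≡ true) (x∉W : W x ≡ false)
    (x-adj : ∀ {w} → W w ≡ true → adj G₀ w x ≡ true)
    (x-large : ∀ {w} → W w ≡ true → med w x ≡ false)
    (few : ∀ {w} → W w ≡ true → count (med w) ≤ m)
    (hub : ∀ {w u} → W w ≡ true → R w u ≡ true → m + t + 3 ≤ count (λ y → R w y ∧ not (adj G₀ u y))) where

    module Step {k} (st : Stage k) (w : Fin n) (w∈Sc : Stage.Sc st w ≡ true) (w∈W : W w ≡ true) where
      open Stage st

      k≤t : k ≤ t
      k≤t = ≤-trans (m≤m+n k _) left

      R-elim : ∀ {u} → R w u ≡ true → S u ≡ true × adj G₀ w u ≡ true × W u ≡ false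
      R-elim {u} h = let a , b = ∧-split {S u} h ; c , e = ∧-split {adj G₀ w u} b in a , c , not-true e

      R⊆Sc : ∀ {u} → R w u ≡ true → Sc u ≡ true
      R⊆Sc h = let a , _ , c = R-elim h in Sc⊇ a c

      R⊆N : ∀ {u} → R w u ≡ true → adj G u w ≡ true
      R⊆N {u} h = trans (symm G u w) (trans (rows w∈W w∈Sc (R⊆Sc h)) (proj₁ (proj₂ (R-elim h))))

      w∉R : R w w ≡ false
      w∉R rewrite irrefl G₀ w with S w
      ... | true  = refl
      ... | false = refl

      H : Fin n → Fin n → Bool
      H = splittable G w (R w)

      few-new : ∀ u → count (λ y → R w y ∧ adj G u y) ≤ degree G₀ (R w) u + count (λ y → adj G u y ∧ not (adj G₀ u y))
      few-new u = count-≤+ λ y → ≤ᵇ⇒≤ _ _ (tauto 3 (λ r a b → ⟦ r ∧ a ⟧ ≤ᵇ (⟦ r ∧ b ⟧ + ⟦ a ∧ not b ⟧)) tt (R w y) (adj G u y) (adj G₀ u y))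

      H-self : ∀ {u} (f : Fin n → Bool) → R w u ≡ true → count (λ y → R w y ∧ f y) ≤
               count (λ y → H u y ∨ (R w y ∧ f y ∧ adj G u y)) + 1
      H-self {u} f ru = count-≤+1 u pw
        where
        pw : ∀ y → ⟦ R w y ∧ f y ⟧ ≤ ⟦ H u y ∨ (R w y ∧ f y ∧ adj G u y) ⟧ + ⟦ y == u ⟧
        pw y rewrite ru | ==-sym u y = ≤ᵇ⇒≤ _ _ (tauto 4 (λ r f a e → ⟦ r ∧ f ⟧ ≤ᵇ (⟦ ((r ∧ not e) ∧ not a) ∨ (r ∧ f ∧ a) ⟧ + ⟦ e ⟧)) tt
          (R w y) (f y) (adj G u y) (y == u))

      large : ∀ {u} → R w u ≡ true → med w u ≡ false → suc (suc (count (R w))) ≤ count (H u) + count (H u)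
      large {u} ru nm = large-arith (count (R w)) (count (H u)) (count λ y → R w y ∧ adj G u y) (degree G₀ (R w) u) _ t
        (≤-trans (≤-trans (count-mono λ y r → ∧-join r refl) (H-self {u} (λ _ → true) ru)) (+-monoˡ-≤ 1 (count-∨ (H u) _)))
        (few-new u) (≤-trans (extra u) k≤t)
        (≮⇒≥ λ lt → true≢false (∧-join ru (T⇒≡ (<⇒<ᵇ lt))) nm)

      small : ∀ {u} → med w u ≡ true → suc (count (med w)) < count (H u)
      small {u} mu = small-arith _ (count (H u)) (count λ y → adj G u y ∧ not (adj G₀ u y)) t m _
        (≤-trans (≤-trans (H-self (λ y → not (adj G₀ u y)) ru) (+-monoˡ-≤ 1 (≤-trans (count-∨ (H u) _)
            (+-monoʳ-≤ (count (H u)) (count-mono λ y h → let a , b = ∧-split {not (adj G₀ u y)} (proj₂ (∧-split {R w y} h)) in ∧-join b a)))))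
          (≤-reflexive (trans (+-assoc (count (H u)) _ 1) (trans (cong (count (H u) +_) (+-comm _ 1)) (sym (+-assoc (count (H u)) 1 _))))))
        (≤-trans (extra u) k≤t) (hub w∈W ru) (few w∈W)
        where ru = proj₁ (∧-split {R w u} mu)

      x∈R : R w x ≡ true
      x∈R rewrite x∈S | x-adj w∈W | x∉W = refl

      matched = NearPerfect.nearPerfect H (splittable-sym G w (R w)) (splittable-irr G w (R w)) (R w) (med w) x
        (λ {u} {v} h → proj₁ (proj₂ (distinct-elim (R w) (proj₁ (∧-split {distinct (R w) u v} h)))))
        (x-large w∈W) x∈R small large
      N = proj₁ matched
      open Matching N
      module E = Eliminate G w (R w) N R⊆N w∉R

      Sc′ : Fin n → Bool
      Sc′ = Sc ∖ w

      moves : ∀ {u} → S u ≡ true → W u ≡ false → u ≢ x → adj G u w ≡ true → μ u ≢ u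
      moves {u} su wu u≢x h = proj₂ matched (∧-join su (∧-join
        (trans (sym (rows w∈W w∈Sc (Sc⊇ su wu))) (trans (symm G w u) h)) (not-false wu))) u≢x

      W≢ : ∀ {u} → W u ≡ false → u ≢ w
      W≢ wu refl = true≢false w∈W wu

      point≥1 : {u v : Fin n} → u ≡ v → 1 ≤ ⟦ u == v ⟧
      point≥1 {u} refl = ≤-reflexive (cong ⟦_⟧ (sym (==-refl u)))

      survives : ∀ {u} y → W u ≡ false → y ≢ w → ⟦ Sc y ∧ adj G u y ⟧ ≤ ⟦ Sc′ y ∧ adj E.G′ u y ⟧
      survives {u} y wu y≢w = ⟦⟧-mono λ h → let a , b = ∧-split {Sc y} h in
        ∧-join (∖-∈ Sc a y≢w) (E.kept-adj b (W≢ wu) y≢w)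

      deg-drop : ∀ u → W u ≡ false → degree G Sc u ≤ degree E.G′ Sc′ u + 1
      deg-drop u wu = count-≤+1 w pw
        where
        pw : ∀ y → ⟦ Sc y ∧ adj G u y ⟧ ≤ ⟦ Sc′ y ∧ adj E.G′ u y ⟧ + ⟦ y == w ⟧
        pw y = case y ≟ w of λ
          { (yes e) → ≤-trans (⟦⟧≤1 (Sc y ∧ adj G u y)) (≤-trans (point≥1 e) (m≤n+m _ _))
          ; (no ne) → ≤-trans (survives y wu ne) (m≤m+n _ _) }

      -- A neighbour `u` of `w` other than `x` is matched: it loses `w` and gains `μ u`, which was
      -- not adjacent to it.
      deg-keep : ∀ {u} → S u ≡ true → W u ≡ false → u ≢ x → degree G Sc u ≤ degree E.G′ Sc′ u
      deg-keep {u} su wu u≢x with adj G u w in eq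
      ... | false = count-mono λ y h → let a , b = ∧-split {Sc y} h ; ne = λ { refl → true≢false b eq } in
            ∧-join (∖-∈ Sc a ne) (E.kept-adj b (W≢ wu) ne)
      ... | true = +-cancelʳ-≤ 1 _ _ (subst₂ (λ a b → degree G Sc u + a ≤ degree E.G′ Sc′ u + b) (count-point (μ u)) (count-point w) (count-+≤+ pw))
        where
        μu≢u = moves su wu u≢x eq
        nw = E.new-elim (E.new-intro μu≢u)
        pw : ∀ y → ⟦ Sc y ∧ adj G u y ⟧ + ⟦ y == μ u ⟧ ≤ ⟦ Sc′ y ∧ adj E.G′ u y ⟧ + ⟦ y == w ⟧
        pw y = case y ≟ μ u of λ
          { (yes refl) → ≤-trans (+-mono-≤ {y = 0} (⟦⟧-mono {b = false} λ h →
                 true≢false (proj₂ (∧-split {Sc y} h)) (proj₂ (proj₂ (proj₂ nw)))) (⟦⟧≤1 (y == μ u)))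
              (≤-trans (≤-reflexive (cong ⟦_⟧ (sym (∧-join (∖-∈ Sc {w} {y} (R⊆Sc (proj₁ (proj₂ (proj₂ nw))))
                  (λ e → true≢false (proj₁ (proj₂ (proj₂ nw))) (trans (cong (R w) e) w∉R))) (E.new-adj (E.new-intro μu≢u)))))) (m≤m+n _ _))
          ; (no ne) → ≤-trans (≤-reflexive (trans (cong (λ b → ⟦ Sc y ∧ adj G u y ⟧ + ⟦ b ⟧) (≢⇒== ne)) (+-identityʳ _))) (case y ≟ w of λ
            { (yes e)  → ≤-trans (⟦⟧≤1 (Sc y ∧ adj G u y)) (≤-trans (point≥1 e) (m≤n+m _ _))
            ; (no ne′) → ≤-trans (survives y wu ne′) (m≤m+n _ _) }) }

      next : Stage (suc k)
      next = record
        { G = E.G′ ; Sc = Sc′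
        ; Sc⊆S  = λ h → Sc⊆S (proj₁ (∖-⊆ Sc h))
        ; Sc⊇   = λ su wu → ∖-∈ Sc (Sc⊇ su wu) (W≢ wu)
        ; left  = ≤-trans (≤-reflexive (sym (+-suc k _))) (≤-trans (+-monoʳ-≤ k (≤-trans (s≤s (count-mono λ u h →
                    let a , b = ∧-split {Sc′ u} h ; c , e = ∖-⊆ Sc a in ∖-∈ (λ u → Sc u ∧ W u) (∧-join c b) e))
                    (count-∖< (λ u → Sc u ∧ W u) {w} (∧-join w∈Sc w∈W)))) left)
        ; extra = λ u → ≤-trans (count-≤+1 (μ u) (λ y → ≤ᵇ⇒≤ _ _
                    (tauto 5 (λ a o e e′ f → ⟦ ((a ∧ e′) ∨ (f ∧ e)) ∧ not o ⟧ ≤ᵇ (⟦ a ∧ not o ⟧ + ⟦ e ⟧)) tt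
                      (adj G u y) (adj G₀ u y) (y == μ u) (not (u == w) ∧ not (y == w)) (not (u == y)))))
                    (≤-trans (≤-reflexive (+-comm _ 1)) (s≤s (extra u)))
        ; rows  = λ {w′} {y} ww sw sy → trans (rows′ ww sw sy) (rows ww (proj₁ (∖-⊆ Sc sw)) (proj₁ (∖-⊆ Sc sy)))
        ; deg   = λ su wu u≢x → ≤-trans (deg su wu u≢x) (deg-keep su wu u≢x)
        ; deg-x = ≤-trans deg-x (≤-trans (+-monoˡ-≤ k (deg-drop x x∉W)) (≤-reflexive (+-assoc _ 1 k)))
        ; pull  = λ L mem → pull (pullback E.reroute L λ i → proj₂ (∖-⊆ Sc (mem i))) (λ i → proj₁ (∖-⊆ Sc (mem i)))
        }
        where
        -- New edges stay inside `R w`, which avoids `W`.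
        rows′ : ∀ {w′ y} → W w′ ≡ true → Sc′ w′ ≡ true → Sc′ y ≡ true → adj E.G′ w′ y ≡ adj G w′ y
        rows′ {w′} {y} ww sw sy with ∖-⊆ Sc sw | ∖-⊆ Sc sy | E.new w′ y in eq
        ... | _ , _  | _ , _   | true  = true≢false ww (proj₂ (proj₂ (R-elim (proj₁ (proj₂ (E.new-elim eq))))))
        ... | _ , ne | _ , ne′ | false rewrite ≢⇒== ne | ≢⇒== ne′ = lem (adj G w′ y)
          where
          lem : ∀ a → (a ∧ true) ∨ false ≡ a
          lem true  = refl
          lem false = refl

    run : ∀ {k} f (st : Stage k) → count (λ u → Stage.Sc st u ∧ W u) < f →
          ∃ λ k′ → Σ[ st′ ∈ Stage k′ ] (∀ {u} → Stage.Sc st′ u ≡ true → W u ≡ false)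
    run {k} (suc f) st fuel with search (λ u → Stage.Sc st u ∧ W u)
    ... | inj₂ none = k , st , λ {u} h → lem h (none u)
      where
      lem : ∀ {a b} → a ≡ true → a ∧ b ≡ false → b ≡ false
      lem refl e = e
    ... | inj₁ (w , h) = let sw , ww = ∧-split {Stage.Sc st w} h in
      run f (Step.next st w sw ww) (<-≤-trans (≤-trans (s≤s (count-mono λ u h′ →
        let a , b = ∧-split {(Stage.Sc st ∖ w) u} h′ ; c , e = ∖-⊆ (Stage.Sc st) a in
        ∖-∈ (λ u → Stage.Sc st u ∧ W u) {w} (∧-join c b) e)) (count-∖< (λ u → Stage.Sc st u ∧ W u) {w} h)) (s≤s⁻¹ fuel))

-- Large minimum degree forces a strong immersion

opaque
  hubs-arith : ∀ t g b c m₁ m₂ → t + t + t + (t * g + t * g) ≤ b → b ≤ c + (m₁ + m₂) → m₁ ≤ t * g → m₂ ≤ t * g → t + t + t ≤ c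
  hubs-arith t g b c m₁ m₂ h₁ h₂ h₃ h₄ = ≤-by 0 (+-mono-≤ (+-mono-≤ h₁ h₂) (+-mono-≤ h₃ h₄))
    (solve (t ∷ g ∷ b ∷ c ∷ m₁ ∷ m₂ ∷ []))

  medium-arith : ∀ t r d₁ d₂ d₃ c₁ c₂ c₃ → d₁ + d₂ + d₃ ≤ r + (c₁ + (c₂ + c₃)) → c₁ < t + t + t → c₂ < t + t + t → c₃ < t + t + t →
    r < d₁ + d₁ + (t + t) + 4 → r < d₂ + d₂ + (t + t) + 4 → r < d₃ + d₃ + (t + t) + 4 → r ≤ 24 * t + 9
  medium-arith t r d₁ d₂ d₃ c₁ c₂ c₃ h e₁ e₂ e₃ f₁ f₂ f₃ =
    ≤-by 6 (+-mono-≤ (+-mono-≤ (+-mono-≤ h h) (+-mono-≤ (+-mono-≤ e₁ e₁) (+-mono-≤ e₂ e₂))) (+-mono-≤ (+-mono-≤ e₃ e₃) (+-mono-≤ f₁ (+-mono-≤ f₂ f₃))))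
      (solve (t ∷ r ∷ d₁ ∷ d₂ ∷ d₃ ∷ c₁ ∷ c₂ ∷ c₃ ∷ []))

  gap-arith : ∀ i t m mu mw c w → (i + 1) * (m + t + t + 2) < mu → mw ≤ i * (m + t + t + 2) → w ≤ t →
    mu ≤ c + (mw + w) → m + t + 3 ≤ c
  gap-arith i t m mu mw c w h₁ h₂ h₃ h₄ = ≤-by 0 (+-mono-≤ (+-mono-≤ h₁ h₂) (+-mono-≤ h₃ h₄))
    (solve (i ∷ t ∷ m ∷ mu ∷ mw ∷ c ∷ w ∷ []))

  size-arith : ∀ p s t b r mw w → s + 26 * t + 10 ≤ b → b ≤ r + (mw + w) → mw ≤ p → p ≤ s → w ≤ t → 24 * t + 9 < r
  size-arith p s t b r mw w h₁ h₂ h₃ h₄ h₅ = ≤-by t (+-mono-≤ (+-mono-≤ h₁ h₂) (+-mono-≤ (+-mono-≤ h₃ h₄) h₅))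
    (solve (p ∷ s ∷ t ∷ b ∷ r ∷ mw ∷ w ∷ []))

-- medBound bounds the number of vertices of medium degree, gap separates consecutive thresholds for
-- hubs, and rootDegree is the degree required of the special vertex.
medBound gap rootDegree minDegree : ℕ → ℕ
medBound t   = t * t
gap t        = medBound t + t + t + 2
rootDegree t = t * (t * gap t + medBound t) + (t * gap t + t * gap t) + 26 * t + 10
minDegree t  = rootDegree t + t

-- Without a plateau `c` grows by at least one at every step.
plateau : (c : ℕ → ℕ) → 1 ≤ c 0 → ∀ j → (∃ λ i → i < j × c (suc i) ≤ c i) ⊎ j < c j
plateau c pos zero = inj₂ pos
plateau c pos (suc j) with plateau c pos j
... | inj₁ (i , i<j , le) = inj₁ (i , m<n⇒m<1+n i<j , le)
... | inj₂ j<c with c (suc j) ≤? c j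
...   | yes le = inj₁ (j , ≤-refl , le)
...   | no ¬le = inj₂ (≤-<-trans j<c (≰⇒> ¬le))

-- Bonferroni's inequality for three subsets of `P`.
count-triple : (P a b c : Fin n → Bool) → count (λ y → P y ∧ a y) + count (λ y → P y ∧ b y) + count (λ y → P y ∧ c y) ≤
  count P + (count (λ y → a y ∧ b y) + (count (λ y → a y ∧ c y) + count (λ y → b y ∧ c y)))
count-triple P a b c = begin
  count (λ y → P y ∧ a y) + count (λ y → P y ∧ b y) + count (λ y → P y ∧ c y)
    ≤⟨ +-monoˡ-≤ _ (count-+≤+ {R = λ y → P y ∧ (a y ∨ b y)} {S = λ y → a y ∧ b y} λ y → ≤ᵇ⇒≤ _ _
         (tauto 3 (λ p a b → (⟦ p ∧ a ⟧ + ⟦ p ∧ b ⟧) ≤ᵇ (⟦ p ∧ (a ∨ b) ⟧ + ⟦ a ∧ b ⟧)) tt (P y) (a y) (b y))) ⟩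
  A + count (λ y → a y ∧ b y) + count (λ y → P y ∧ c y)
    ≡⟨ trans (+-assoc A _ _) (trans (cong (A +_) (+-comm (count λ y → a y ∧ b y) _)) (sym (+-assoc A _ _))) ⟩
  A + count (λ y → P y ∧ c y) + count (λ y → a y ∧ b y)
    ≤⟨ +-monoˡ-≤ _ (count-+≤+ {R = P} {S = λ y → (a y ∨ b y) ∧ c y} λ y → ≤ᵇ⇒≤ _ _
         (tauto 4 (λ p a b c → (⟦ p ∧ (a ∨ b) ⟧ + ⟦ p ∧ c ⟧) ≤ᵇ (⟦ p ⟧ + ⟦ (a ∨ b) ∧ c ⟧)) tt (P y) (a y) (b y) (c y))) ⟩
  count P + count (λ y → (a y ∨ b y) ∧ c y) + count (λ y → a y ∧ b y)
    ≤⟨ +-monoˡ-≤ _ (+-monoʳ-≤ (count P) (count-≤+ λ y → ≤ᵇ⇒≤ _ _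
         (tauto 3 (λ a b c → ⟦ (a ∨ b) ∧ c ⟧ ≤ᵇ (⟦ a ∧ c ⟧ + ⟦ b ∧ c ⟧)) tt (a y) (b y) (c y)))) ⟩
  count P + (count (λ y → a y ∧ c y) + count (λ y → b y ∧ c y)) + count (λ y → a y ∧ b y)
    ≡⟨ trans (+-assoc (count P) _ _) (cong (count P +_) (+-comm _ (count λ y → a y ∧ b y))) ⟩
  count P + (count (λ y → a y ∧ b y) + (count (λ y → a y ∧ c y) + count (λ y → b y ∧ c y))) ∎
  where
  open ≤-Reasoning
  A = count (λ y → P y ∧ (a y ∨ b y))

-- Of three vertices adjacent to nearly half of R, two have many common neighbours, so Ramsey applies.
linked-medium : (G : Graph n) (R X : Fin n → Bool) → 0 < t → 24 * t + 9 < count R →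
  (∀ {u} → X u ≡ true → count R < degree G R u + degree G R u + (t + t) + 4) → t * t ≤ count X →
  Σ[ τ ∈ (Fin t → Fin n) ] Linked G τ × (∀ i → X (τ i) ≡ true)
linked-medium {t = t} G R X pos big half le =
  let Y , Y⊆X , le′ , ind = ramsey bad bad-sym X pos (λ {u} {v} {w} xu xv xw _ _ _ b₁ b₂ → triangle {u} {v} {w} xu xv xw b₁ b₂) le
      τ , L , mem = linked-codegree G Y pos le′ λ {u} {v} yu yv u≢v →
        ≮⇒≥ λ lt → true≢false (T⇒≡ (<⇒<ᵇ lt)) (ind yu yv u≢v)
  in τ , L , λ i → Y⊆X (mem i)
  where
  bad : Fin _ → Fin _ → Bool
  bad u v = codegree G u v <ᵇ t + t + t
  codegree-sym : ∀ u v → codegree G u v ≤ codegree G v u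
  codegree-sym u v = count-mono λ y h → trans (∧-comm (adj G v y) _) h
  bad-sym : ∀ u v → bad u v ≡ bad v u
  bad-sym u v = cong (_<ᵇ t + t + t) (≤-antisym (codegree-sym u v) (codegree-sym v u))
  -- Three degrees of nearly half of `count R` would exceed `count R` plus three codegrees below
  -- `3t`, since `count R` is large.
  triangle : ∀ {u v w} → X u ≡ true → X v ≡ true → X w ≡ true → bad u v ≡ true → bad u w ≡ true → bad v w ≡ false
  triangle {u} {v} {w} xu xv xw b₁ b₂ with bad v w in b₃
  ... | false = refl
  ... | true  = contradiction (medium-arith t (count R) (degree G R u) (degree G R v) (degree G R w) _ _ _
    (count-triple R (adj G u) (adj G v) (adj G w))
    (<ᵇ⇒< _ _ (≡⇒T b₁)) (<ᵇ⇒< _ _ (≡⇒T b₂)) (<ᵇ⇒< _ _ (≡⇒T b₃)) (half xu) (half xv) (half xw)) (<⇒≱ big)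

module _ {t : ℕ} (0<t : 0 < t) where

  Found : Graph n → (Fin n → Bool) → Set
  Found {n} G S = Σ[ τ ∈ (Fin t → Fin n) ] Linked G τ × (∀ i → S (τ i) ≡ true)

  -- All vertices of S have degree at least minDegree in S except for the special vertex v. The vertices
  -- nearly complete to the neighbourhood B of v (the hubs) are eliminated; at a plateau of the number of
  -- hubs as a function of the threshold, all other vertices have many non-neighbours in B.
  module Descent (G : Graph n) (S : Fin n → Bool) (v : Fin n) (v∈S : S v ≡ true) (root : rootDegree t ≤ degree G S v)
    (min : ∀ {u} → S u ≡ true → u ≢ v → minDegree t ≤ degree G S u) where

    B : Fin n → Bool
    B y = S y ∧ adj G v y

    miss : Fin n → ℕ
    miss u = count λ y → B y ∧ not (adj G u y)

    Hub : ℕ → Fin n → Bool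
    Hub i u = S u ∧ (miss u ≤ᵇ i * gap t)

    hub-elim : ∀ {i u} → Hub i u ≡ true → S u ≡ true × miss u ≤ i * gap t
    hub-elim {i} {u} h = let a , b = ∧-split {S u} h in a , ≤ᵇ⇒≤ _ _ (≡⇒T b)

    hub-intro : ∀ {i u} → S u ≡ true → miss u ≤ i * gap t → Hub i u ≡ true
    hub-intro su le = ∧-join su (T⇒≡ (≤⇒≤ᵇ le))

    v-hub : Hub 0 v ≡ true
    v-hub = hub-intro {0} v∈S (≤-reflexive (count-none none))
      where
      none : ∀ y → B y ∧ not (adj G v y) ≡ false
      none y with S y | adj G v y
      ... | true  | true  = refl
      ... | true  | false = refl
      ... | false | _     = refl

    -- Two hubs miss at most `2t * gap t` vertices of `B` together, so they have at least `3t`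
    -- common neighbours.
    manyHubs : t ≤ count (Hub t) → Found G S
    manyHubs le =
      let τ , L , mem = linked-codegree G (Hub t) 0<t le λ {u} {w} hu hw _ →
            hubs-arith t (gap t) (count B) _ (miss u) (miss w)
              (≤-trans rootBig root)
              (≤-trans (count-≤+ {R = λ y → B y ∧ not (adj G u y) ∨ B y ∧ not (adj G w y)} λ y → ≤ᵇ⇒≤ _ _
                  (tauto 3 (λ b p q → ⟦ b ⟧ ≤ᵇ (⟦ p ∧ q ⟧ + ⟦ b ∧ not p ∨ b ∧ not q ⟧)) tt (B y) (adj G u y) (adj G w y)))
                (+-monoʳ-≤ _ (count-∨ (λ y → B y ∧ not (adj G u y)) (λ y → B y ∧ not (adj G w y)))))
              (proj₂ (hub-elim {t} hu)) (proj₂ (hub-elim {t} hw))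
      in τ , L , λ i → proj₁ (hub-elim {t} (mem i))
      where
      opaque
        three : ∀ t a b → t + t + t + b ≤ a + b + 26 * t + 10
        three t a b = ≤-by (a + 23 * t + 10) (z≤n {0}) (solve (t ∷ a ∷ b ∷ []))
      rootBig : t + t + t + (t * gap t + t * gap t) ≤ rootDegree t
      rootBig = three t (t * (t * gap t + medBound t)) (t * gap t + t * gap t)

    module Level (i : ℕ) (i<t : i < t) (flat : count (Hub (suc i)) ≤ count (Hub i)) (few-hubs : count (Hub i) < t) where

      W : Fin n → Bool
      W = Hub i

      -- By flatness the next threshold admits no further hub, so a vertex outside `W` is a full
      -- `gap t` beyond the hubs.
      W-closed : ∀ {u} → S u ≡ true → W u ≡ false → suc i * gap t < miss u
      W-closed {u} su nw = ≰⇒> λ le → n≮n _ (<-≤-trans (<-≤-trans (s≤s (count-mono λ y h → ∖-∈ (Hub (suc i)) {u} {y}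
          (let a , b = hub-elim {i} h in hub-intro {suc i} a (≤-trans b (m≤n+m _ (gap t)))) λ { refl → true≢false h nw }))
          (count-∖< (Hub (suc i)) (hub-intro {suc i} su le))) flat)

      R′ : Fin n → Fin n → Bool
      R′ = Epoch.R G S W v t (medBound t) (minDegree t)
      med′ : Fin n → Fin n → Bool
      med′ = Epoch.med G S W v t (medBound t) (minDegree t)

      i*gap≤ : i * gap t ≤ t * gap t
      i*gap≤ = *-monoˡ-≤ (gap t) (<⇒≤ i<t)

      R-big : ∀ {w} → W w ≡ true → 24 * t + 9 < count (R′ w)
      R-big {w} ww = size-arith (t * gap t) (t * (t * gap t + medBound t) + (t * gap t + t * gap t)) t (count B) (count (R′ w)) (miss w) (count W)
        root (≤-trans (count-≤+ {R = λ y → B y ∧ not (adj G w y) ∨ W y} λ y → ≤ᵇ⇒≤ _ _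
            (tauto 4 (λ s a b c → ⟦ s ∧ a ⟧ ≤ᵇ (⟦ s ∧ b ∧ not c ⟧ + ⟦ (s ∧ a) ∧ not b ∨ c ⟧)) tt (S y) (adj G v y) (adj G w y) (W y)))
          (+-monoʳ-≤ _ (count-∨ (λ y → B y ∧ not (adj G w y)) W)))
        (≤-trans (proj₂ (hub-elim {i} ww)) i*gap≤) (≤-trans (m≤m+n _ _) (m≤n+m _ (t * (t * gap t + medBound t)))) (<⇒≤ few-hubs)

      -- The purpose of `gap`: of the more than `(i + 1) * gap t` vertices of `B` missed by `u`, at
      -- most `i * gap t` are missed by `w` and at most `t` lie in `W`. The others are in `R′ w`.
      nonhub : ∀ {w u} → W w ≡ true → R′ w u ≡ true → medBound t + t + 3 ≤ count (λ y → R′ w y ∧ not (adj G u y))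
      nonhub {w} {u} ww ru = gap-arith i t (medBound t) (miss u) (miss w) _ (count W)
        (subst (λ z → z * gap t < miss u) (+-comm 1 i) (W-closed su wu)) (proj₂ (hub-elim {i} ww)) (<⇒≤ few-hubs)
        (≤-trans (count-≤+ {R = λ y → B y ∧ not (adj G w y) ∨ W y} λ y → ≤ᵇ⇒≤ _ _
            (tauto 5 (λ s a b c d → ⟦ (s ∧ a) ∧ not d ⟧ ≤ᵇ (⟦ (s ∧ b ∧ not c) ∧ not d ⟧ + ⟦ (s ∧ a) ∧ not b ∨ c ⟧)) tt
              (S y) (adj G v y) (adj G w y) (W y) (adj G u y)))
          (+-monoʳ-≤ _ (count-∨ (λ y → B y ∧ not (adj G w y)) W)))
        where
        su = proj₁ (∧-split {S u} ru)
        wu = not-true (proj₂ (∧-split {adj G w u} (proj₂ (∧-split {S u} ru))))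

      spoils : Fin n → Fin n → Bool
      spoils w y = B y ∧ not (adj G w y) ∨ med′ w y

      unfit : Fin n → Bool
      unfit y = W y ∨ (0 <ᵇ count λ w → W w ∧ spoils w y)

      -- Union bound over the hubs: each spoils at most `t * gap t + medBound t` vertices of `B`.
      -- This explains the first summand of `rootDegree`.
      absorber : (∀ {w} → W w ≡ true → count (med′ w) ≤ medBound t) →
        ∃ λ x → B x ≡ true × W x ≡ false × (∀ {w} → W w ≡ true → adj G w x ≡ true × med′ w x ≡ false)
      absorber few with count-<⇒∃ unfit B small
        where
        cost : ∀ {w} → W w ≡ true → count (spoils w) ≤ t * gap t + medBound t
        cost {w} ww = ≤-trans (count-∨ (λ y → B y ∧ not (adj G w y)) (med′ w))
          (+-mono-≤ (≤-trans (proj₂ (hub-elim {i} ww)) i*gap≤) (few ww))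
        opaque
          last : ∀ t p q → t + p < p + q + 26 * t + 10
          last t p q = ≤-by (9 + q + 25 * t) (z≤n {0}) (solve (t ∷ p ∷ q ∷ []))
        small : count unfit < count B
        small = begin-strict
          count unfit ≤⟨ count-∨ W (λ y → 0 <ᵇ count λ w → W w ∧ spoils w y) ⟩
          count W + count (λ y → 0 <ᵇ count λ w → W w ∧ spoils w y) ≤⟨ +-mono-≤ (<⇒≤ few-hubs) (≤-trans (union-bound W spoils _ cost) (*-monoˡ-≤ _ (<⇒≤ few-hubs))) ⟩
          t + t * (t * gap t + medBound t) <⟨ last t (t * (t * gap t + medBound t)) (t * gap t + t * gap t) ⟩
          rootDegree t ≤⟨ root ⟩
          count B ∎
          where open ≤-Reasoning
      ... | x , bx , ux = x , bx , proj₁ (∨-false ux) , λ {w} ww → fit bx (λ h → true≢false (T⇒≡ (<⇒<ᵇ (∃⇒count>0 (λ w → W w ∧ spoils w x) w (∧-join ww h)))) (proj₂ (∨-false {W x} ux)))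
        where
        fit : ∀ {b a c} → b ≡ true → ¬ (b ∧ not a ∨ c ≡ true) → a ≡ true × c ≡ false
        fit {a = true}  {false} refl h = refl , refl
        fit {a = true}  {true}  refl h = contradiction refl h
        fit {a = false} {c}     refl h = contradiction refl h

      -- `x` loses at most `t` in degree, hence keeps `rootDegree t` and becomes the next special
      -- vertex. The current one is itself a hub, so `S` shrinks.
      outcome : Found G S ⊎ (Σ[ G′ ∈ Graph n ] Σ[ S′ ∈ (Fin n → Bool) ] ∃ λ x → S′ x ≡ true × rootDegree t ≤ degree G′ S′ x ×
        (∀ {u} → S′ u ≡ true → u ≢ x → minDegree t ≤ degree G′ S′ u) × count S′ < count S × (Found G′ S′ → Found G S))
      outcome with search (λ w → W w ∧ (t * t <ᵇ count (med′ w)))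
      ... | inj₁ (w , h) =
        let ww , many = ∧-split {W w} h
            τ , L , mem = linked-medium G (R′ w) (med′ w) 0<t (R-big ww) (λ {u} mu → <ᵇ⇒< _ _ (≡⇒T (proj₂ (∧-split {R′ w u} mu))))
                            (<⇒≤ (<ᵇ⇒< (t * t) _ (≡⇒T many)))
        in inj₁ (τ , L , λ j → proj₁ (∧-split {S (τ j)} (proj₁ (∧-split {R′ w (τ j)} (mem j)))))
      ... | inj₂ none with few ← (λ {w} (ww : W w ≡ true) → ≮⇒≥ {t * t} {count (med′ w)} λ lt → true≢false (∧-join ww (T⇒≡ (<⇒<ᵇ lt))) (none w)) with absorber few
      ... | x , bx , wx , fit with Epoch.run G S W x t (medBound t) (minDegree t) (proj₁ (∧-split {S x} bx)) wx (proj₁ ∘ fit) (proj₂ ∘ fit) few nonhub _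
            (record { G = G ; Sc = S ; Sc⊆S = id ; Sc⊇ = λ s _ → s
                    ; left = ≤-trans (count-mono λ u h → proj₂ (∧-split {S u} h)) (<⇒≤ few-hubs)
                    ; extra = λ u → ≤-reflexive (count-none λ y → ∧-not (adj G u y))
                    ; rows = λ _ _ _ → refl ; deg = λ su nw _ → min su (≢v nw)
                    ; deg-x = ≤-trans (min (proj₁ (∧-split {S x} bx)) (≢v wx)) (m≤m+n _ 0)
                    ; pull = λ L _ → L }) ≤-refl
        where
        ∧-not : ∀ a → a ∧ not a ≡ false
        ∧-not true  = refl
        ∧-not false = refl
        v∈W : W v ≡ true
        v∈W = let a , b = hub-elim {0} v-hub in hub-intro {i} a (≤-trans b z≤n)
        ≢v : ∀ {u} → W u ≡ false → u ≢ v
        ≢v nw refl = true≢false v∈W nw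
      ... | k , st , out = inj₂ (St.G , St.Sc , x , St.Sc⊇ (proj₁ (∧-split {S x} bx)) wx
              , +-cancelʳ-≤ t _ _ (≤-trans St.deg-x (+-monoʳ-≤ _ (≤-trans (m≤m+n k _) St.left)))
              , (λ s ne → St.deg (St.Sc⊆S s) (out s) ne)
              , ≤-trans (s≤s (count-mono λ u s → ∖-∈ S {v} (St.Sc⊆S s) λ { refl → true≢false v∈W (out s) })) (count-∖< S v∈S)
              , λ { (τ , L , mem) → τ , St.pull L mem , λ j → St.Sc⊆S (mem j) })
        where
        module St = Epoch.Stage st
        v∈W : W v ≡ true
        v∈W = let a , b = hub-elim {0} v-hub in hub-intro {i} a (≤-trans b z≤n)

  descent : ∀ f (G : Graph n) (S : Fin n → Bool) (v : Fin n) → S v ≡ true → rootDegree t ≤ degree G S v →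
    (∀ {u} → S u ≡ true → u ≢ v → minDegree t ≤ degree G S u) → count S < f → Found G S
  descent (suc f) G S v v∈S root min fuel with t ≤? count (Descent.Hub G S v v∈S root min t)
  ... | yes many = Descent.manyHubs G S v v∈S root min many
  ... | no few with plateau (λ i → count (Descent.Hub G S v v∈S root min i)) (∃⇒count>0 _ v (Descent.v-hub G S v v∈S root min)) t
  ...   | inj₂ many = contradiction (<⇒≤ many) few
  ...   | inj₁ (i , i<t , flat) with Descent.Level.outcome G S v v∈S root min i i<t flat (≤-<-trans (count-mono λ u h →
            let a , b = Descent.hub-elim G S v v∈S root min {i} h in Descent.hub-intro G S v v∈S root min {t} a (≤-trans b (*-monoˡ-≤ (gap t) (<⇒≤ i<t)))) (≰⇒> few))
  ...     | inj₁ found = found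
  ...     | inj₂ (G′ , S′ , x , x∈S′ , root′ , min′ , smaller , back) =
              back (descent f G′ S′ x x∈S′ root′ min′ (<-≤-trans smaller (s≤s⁻¹ fuel)))

  linked-minDegree : (G : Graph n) (S : Fin n → Bool) {v : Fin n} → S v ≡ true →
    (∀ {u} → S u ≡ true → minDegree t ≤ degree G S u) → Σ[ τ ∈ (Fin t → Fin n) ] Linked G τ
  linked-minDegree G S {v} v∈S min =
    let τ , L , _ = descent _ G S v v∈S (≤-trans (m≤m+n _ t) (min v∈S)) (λ s _ → min s) ≤-refl in τ , L

-- Dense graphs: a vertex w is chosen by averaging so that few pairs of its lower neighbours have few
-- common neighbours above. Terminals are joined through a third lower neighbour z of w by paths of length
-- four; the middle vertex x between a terminal and z lies above z, which keeps these paths edge-disjoint.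

opaque
  average-arith : ∀ s t l A → 0 < s → 3 * s * t < 8 * l * l → s * (32 * l) ≤ A + A → 3 * t * s * s + l * (8 * l) * s < l * A
  average-arith (suc s) t l A _ h₁ h₂ = *-cancelʳ-< 2 _ _ (begin-strict
    (3 * t * suc s * suc s + l * (8 * l) * suc s) * 2      ≡⟨ eq₁ s t l ⟩
    (3 * suc s * t + 8 * l * l) * suc s * 2                <⟨ *-monoˡ-< 2 (*-monoˡ-< (suc s) (+-monoˡ-< (8 * l * l) h₁)) ⟩
    (8 * l * l + 8 * l * l) * suc s * 2                    ≡⟨ eq₂ s l ⟩
    l * (suc s * (32 * l))                                 ≤⟨ *-monoʳ-≤ l h₂ ⟩
    l * (A + A)                                            ≡⟨ eq₃ l A ⟩
    l * A * 2                                              ∎)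
    where
    open ≤-Reasoning
    eq₁ : ∀ s t l → (3 * t * suc s * suc s + l * (8 * l) * suc s) * 2 ≡ (3 * suc s * t + 8 * l * l) * suc s * 2
    eq₁ s t l = solve (s ∷ t ∷ l ∷ [])
    eq₂ : ∀ s l → (8 * l * l + 8 * l * l) * suc s * 2 ≡ l * (suc s * (32 * l))
    eq₂ s l = solve (s ∷ l ∷ [])
    eq₃ : ∀ l A → l * (A + A) ≡ l * A * 2
    eq₃ l A = solve (l ∷ A ∷ [])

  nice-arith : ∀ t l a g b → t ≤ l → 8 * l < a → a ≤ g + b → b < 4 * l → t ≤ g
  nice-arith t l a g b h₁ h₂ h₃ h₄ = ≤-by (l + l + l + 2) (+-mono-≤ (+-mono-≤ h₁ h₂) (+-mono-≤ h₃ h₄))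
    (solve (t ∷ l ∷ a ∷ g ∷ b ∷ []))

  lists-arith : ∀ t l a L b₁ b₂ y p q → t ≤ l → 8 * l < a → a ≤ L + (b₁ + (b₂ + y)) → 4 * b₁ ≤ a → 4 * b₂ ≤ a → y ≤ t → p ≤ t → q ≤ t →
    p + q ≤ suc L
  lists-arith t l a L b₁ b₂ y p q h₁ h₂ h₃ h₄ h₅ h₆ h₇ h₈ = *-cancelˡ-≤ 4 (subst (4 * (p + q) ≤_) (sym (*-suc 4 L))
    (≤-by (t + t + t + t + 6) (+-mono-≤ (+-mono-≤ (+-mono-≤ (times 16 h₁) (+-mono-≤ h₂ h₂)) (times 4 h₃)) (+-mono-≤ (+-mono-≤ h₄ h₅) (+-mono-≤ (times 4 h₆) (+-mono-≤ (times 4 h₇) (times 4 h₈)))))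
      (solve (t ∷ l ∷ a ∷ L ∷ b₁ ∷ b₂ ∷ y ∷ p ∷ q ∷ []))))
    where
    times : ∀ k {a b} → a ≤ b → k * a ≤ k * b
    times k = *-monoʳ-≤ k

  up-arith : ∀ t p q L y → p ≤ t → q ≤ t → t + t + t ≤ L + y → y ≤ t → p + q ≤ suc L
  up-arith t p q L y h₁ h₂ h₃ h₄ = ≤-by 1 (+-mono-≤ (+-mono-≤ h₁ h₂) (+-mono-≤ h₃ h₄)) (solve (t ∷ p ∷ q ∷ L ∷ y ∷ []))

module Dense (G : Graph n) (S : Fin n → Bool) (t : ℕ) where

  below : Fin n → Fin n → Bool
  below z x = toℕ z <ᵇ toℕ x

  low : Fin n → Fin n → Bool
  low w z = S w ∧ S z ∧ adj G w z ∧ below z w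

  up : Fin n → Fin n → Fin n → Bool
  up u z x = S x ∧ adj G u x ∧ adj G z x ∧ below z x

  -- Not symmetric: the common neighbours counted have to lie above the second vertex only.
  bad : Fin n → Fin n → Bool
  bad u z = count (up u z) <ᵇ t + t + t

  badPair : Fin n → Fin n → Fin n → Bool
  badPair w u z = low w u ∧ low w z ∧ bad u z

  low-elim : ∀ {w z} → low w z ≡ true → S w ≡ true × S z ≡ true × adj G w z ≡ true × below z w ≡ true
  low-elim {w} {z} h = let a , b = ∧-split {S w} h ; c , d = ∧-split {S z} b ; e , f = ∧-split {adj G w z} d in a , c , e , f

  badness : Fin n → ℕ
  badness w = sum λ u → count λ z → badPair w u z

  -- After exchanging the sums, a bad pair `u, z` is counted only for `w` in `up u z`, hence fewer
  -- than `3t` times.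
  total-badness : sum badness ≤ 3 * t * count S * count S
  total-badness = begin
    sum badness                                                  ≡⟨ ∑-comm (λ w u → count λ z → badPair w u z) ⟩
    sum (λ u → sum λ w → count λ z → badPair w u z)              ≡⟨ sum-cong-≗ (λ u → sum-count-swap λ w z → badPair w u z) ⟩
    sum (λ u → sum λ z → count λ w → badPair w u z)              ≤⟨ sum-mono row ⟩
    sum (λ u → 3 * t * count S * ⟦ S u ⟧)                        ≡⟨ sum-indicator (3 * t * count S) S ⟩
    3 * t * count S * count S                                    ∎
    where
    open ≤-Reasoning
    empty : ∀ {P : Fin n → Bool} {k} → (∀ w → ¬ (P w ≡ true)) → count P ≤ k
    empty none = ≤-trans (≤-reflexive (count-none λ w → ¬true⇒false (none w))) z≤n
    split : ∀ {w u z} → badPair w u z ≡ true → low w u ≡ true × low w z ≡ true × bad u z ≡ true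
    split {w} {u} {z} h = let a , b = ∧-split {low w u} h ; c , d = ∧-split {low w z} b in a , c , d
    cell : ∀ u z → count (λ w → badPair w u z) ≤ 3 * t * ⟦ S z ⟧
    cell u z = case bool? (S z) of λ
      { (inj₂ nz) → empty λ w h → true≢false (proj₁ (proj₂ (low-elim {w} {z} (proj₁ (proj₂ (split {w} {u} {z} h)))))) nz
      ; (inj₁ sz) → subst (λ k → count (λ w → badPair w u z) ≤ 3 * t * k) (cong ⟦_⟧ (sym sz)) (case bool? (bad u z) of λ
        { (inj₂ nb) → empty λ w h → true≢false (proj₂ (proj₂ (split {w} {u} {z} h))) nb
        ; (inj₁ b)  → ≤-trans (count-mono λ w h →
            let lu , lz , _ = split {w} {u} {z} h
                a , _ , c , _ = low-elim {w} {u} lu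
                _ , _ , d , e = low-elim {w} {z} lz
            in ∧-join a (∧-join (trans (symm G u w) c) (∧-join (trans (symm G z w) d) e)))
          (≤-trans (<⇒≤ (<ᵇ⇒< (count (up u z)) _ (≡⇒T b))) (≤-reflexive (trans (+-assoc t t t) (trans (cong (λ k → t + (t + k)) (sym (+-identityʳ t))) (sym (*-identityʳ (3 * t))))))) }) }
    row : ∀ u → sum (λ z → count λ w → badPair w u z) ≤ 3 * t * count S * ⟦ S u ⟧
    row u = case bool? (S u) of λ
      { (inj₁ su) → ≤-trans (sum-mono (cell u)) (≤-reflexive (trans (sum-indicator (3 * t) S)
            (trans (sym (*-identityʳ _)) (cong (λ b → 3 * t * count S * ⟦ b ⟧) (sym su)))))
      ; (inj₂ nu) → ≤-trans (sum-mono λ z → empty {k = 0} λ w h → true≢false (proj₁ (proj₂ (low-elim {w} {u} (proj₁ (split {w} {u} {z} h))))) nu)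
            (≤-trans (≤-reflexive (trans (sum-const n 0) (*-zeroʳ n))) z≤n) }

  -- Handshake count: every edge inside `S` has exactly one lower end.
  total-low : ∀ δ → (∀ {u} → S u ≡ true → δ ≤ degree G S u) → count S * δ ≤ sum (λ w → count (low w)) + sum (λ w → count (low w))
  total-low δ deg = begin
    count S * δ                                          ≡⟨ *-comm (count S) δ ⟩
    δ * count S                                          ≡⟨ sum-indicator δ S ⟨
    sum (λ w → δ * ⟦ S w ⟧)                              ≤⟨ sum-mono row ⟩
    sum (λ w → count (low w) + count λ z → low z w)      ≡⟨ ∑-distrib-+ (λ w → count (low w)) (λ w → count λ z → low z w) ⟩
    sum (λ w → count (low w)) + sum (λ w → count λ z → low z w) ≡⟨ cong (sum (λ w → count (low w)) +_) (sum-count-swap (λ w z → low z w)) ⟩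
    sum (λ w → count (low w)) + sum (λ w → count (low w)) ∎
    where
    open ≤-Reasoning
    row : ∀ w → δ * ⟦ S w ⟧ ≤ count (low w) + count λ z → low z w
    row w = case bool? (S w) of λ
      { (inj₂ nw) → ≤-trans (≤-reflexive (trans (cong (λ b → δ * ⟦ b ⟧) nw) (*-zeroʳ δ))) z≤n
      ; (inj₁ sw) → ≤-trans (≤-reflexive (trans (cong (λ b → δ * ⟦ b ⟧) sw) (*-identityʳ δ))) (≤-trans (deg sw) (count-≤+ λ z → ⟦⟧-∨ (lem sw z))) }
      where
      ⟦⟧-∨ : ∀ {a b c} → (a ≡ true → b ≡ true ⊎ c ≡ true) → ⟦ a ⟧ ≤ ⟦ b ⟧ + ⟦ c ⟧
      ⟦⟧-∨ {false} _ = z≤n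
      ⟦⟧-∨ {true} {b} {c} f with f refl
      ... | inj₁ refl = s≤s z≤n
      ... | inj₂ refl = m≤n+m 1 ⟦ b ⟧
      lem : S w ≡ true → ∀ z → S z ∧ adj G w z ≡ true → low w z ≡ true ⊎ low z w ≡ true
      lem sw z h with ∧-split {S z} h | <-cmp (toℕ z) (toℕ w)
      ... | sz , a | tri< lt _ _ = inj₁ (∧-join sw (∧-join sz (∧-join a (T⇒≡ (<⇒<ᵇ lt)))))
      ... | sz , a | tri> _ _ gt = inj₂ (∧-join sz (∧-join sw (∧-join (trans (symm G z w) a) (T⇒≡ (<⇒<ᵇ gt)))))
      ... | sz , a | tri≈ _ eq _ with toℕ-injective eq
      ...   | refl = true≢false a (irrefl G w)

  module Route (l : ℕ) (0<t : 0 < t) (t≤l : t ≤ l) (w : Fin n) (8l<a : 8 * l < count (low w)) (few : badness w < l * count (low w)) where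

    a = count (low w)

    badAt : Fin n → ℕ
    badAt u = count λ z → low w z ∧ bad u z

    nice : Fin n → Bool
    nice u = low w u ∧ (4 * badAt u ≤ᵇ a)

    nasty : Fin n → Bool
    nasty u = low w u ∧ not (4 * badAt u ≤ᵇ a)

    -- Markov's inequality: a nasty vertex accounts for more than `a / 4` bad pairs.
    few-nasty : count nasty < 4 * l
    few-nasty = *-cancelˡ-< a _ _ (begin-strict
      a * count nasty                   ≡⟨ sum-indicator a nasty ⟨
      sum (λ u → a * ⟦ nasty u ⟧)       ≤⟨ sum-mono row ⟩
      sum (λ u → 4 * count λ z → badPair w u z) ≡⟨ sum-* 4 (λ u → count λ z → badPair w u z) ⟩
      4 * badness w                     <⟨ *-monoʳ-< 4 few ⟩
      4 * (l * a)                       ≡⟨ trans (sym (*-assoc 4 l a)) (*-comm (4 * l) a) ⟩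
      a * (4 * l)                       ∎)
      where
      open ≤-Reasoning
      row : ∀ u → a * ⟦ nasty u ⟧ ≤ 4 * count λ z → badPair w u z
      row u with low w u | 4 * badAt u ≤ᵇ a in eq
      ... | false | _     = ≤-trans (≤-reflexive (*-zeroʳ a)) z≤n
      ... | true  | true  = ≤-trans (≤-reflexive (*-zeroʳ a)) z≤n
      ... | true  | false = ≤-trans (≤-reflexive (*-identityʳ a)) (<⇒≤ (≰⇒> λ le → true≢false (T⇒≡ (≤⇒≤ᵇ le)) eq))

    many-nice : t ≤ count nice
    many-nice = nice-arith t l a (count nice) (count nasty) t≤l 8l<a
      (count-≤+ λ u → ≤ᵇ⇒≤ _ _ (tauto 2 (λ p q → ⟦ p ⟧ ≤ᵇ (⟦ p ∧ q ⟧ + ⟦ p ∧ not q ⟧)) tt (low w u) (4 * badAt u ≤ᵇ a))) few-nasty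

    module Terminals (τ : Fin t → Fin n) (τ-inj : ∀ {i j} → τ i ≡ τ j → i ≡ j) (τ-nice : ∀ i → nice (τ i) ≡ true) where
      Y : Fin n → Bool
      Y = range τ

      Y-bad : ∀ {u} → Y u ≡ true → 4 * badAt u ≤ a
      Y-bad {u} yu = ≤ᵇ⇒≤ _ _ (≡⇒T (proj₂ (∧-split {low w u} (range-⊆ τ nice τ-nice yu))))

      distinct-few : ∀ u → count (distinct Y u) ≤ t
      distinct-few u = ≤-trans (count-mono λ y h → proj₁ (proj₂ (distinct-elim Y h))) (count-range τ)

      L₁ : Fin n → Fin n → Fin n → Bool
      L₁ u v z = low w z ∧ ((not (bad u z) ∧ not (bad v z)) ∧ not (Y z))

      -- At most half of `low w` is bad for `u` or `v`. The other half has more than `4t` vertices,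
      -- enough for discarding the terminals and for colours at both ends.
      col₁ : Colouring (distinct Y) L₁
      col₁ = colouring w (distinct Y) L₁ (distinct-sym Y) (distinct-irr Y)
        (λ u v z → cong (λ b → low w z ∧ (b ∧ not (Y z))) (∧-comm (not (bad u z)) _))
        λ {u} {v} q → let yu , yv , _ = distinct-elim Y q in
          lists-arith t l a (count (L₁ u v)) (badAt u) (badAt v) (count Y) _ _ t≤l 8l<a
            (≤-trans (count-≤+ {R = λ z → (low w z ∧ bad u z) ∨ ((low w z ∧ bad v z) ∨ Y z)} λ z → ≤ᵇ⇒≤ _ _
                (tauto 4 (λ p q r y → ⟦ p ⟧ ≤ᵇ (⟦ p ∧ ((not q ∧ not r) ∧ not y) ⟧ + ⟦ (p ∧ q) ∨ ((p ∧ r) ∨ y) ⟧)) tt (low w z) (bad u z) (bad v z) (Y z)))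
              (+-monoʳ-≤ _ (≤-trans (count-∨ (λ z → low w z ∧ bad u z) _) (+-monoʳ-≤ (badAt u) (count-∨ (λ z → low w z ∧ bad v z) Y)))))
            (Y-bad yu) (Y-bad yv) (count-range τ) (distinct-few u) (distinct-few v)

      module Links (col₁ : Colouring (distinct Y) L₁) where
        module C₁ = Colouring col₁

        link : Fin n → Fin n → Bool
        link u z = image (distinct Y u) (C₁.c u) z

        link-elim : ∀ {u z} → link u z ≡ true → Y u ≡ true × Y z ≡ false × bad u z ≡ false
        link-elim {u} {z} h =
          let v , d , e = image-∃ (distinct Y u) (C₁.c u) h
              _ , ok = ∧-split {low w z} (subst (λ x → L₁ u v x ≡ true) e (C₁.c-list d))
              b , y = ∧-split {not (bad u z) ∧ not (bad v z)} ok
          in proj₁ (distinct-elim Y d) , not-true y , not-true (proj₁ (∧-split {not (bad u z)} b))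

        -- Bipartite between the terminals and the vertices `z` chosen for their pairs. In `Γ` the
        -- terminals are linked by paths of length two, whose edges are in turn replaced by paths of
        -- length two in `G`.
        Γ : Graph n
        Γ = record { adj = λ u z → link u z ∨ link z u ; symm = λ u z → ∨-comm (link u z) (link z u) ; irrefl = irr }
          where
          irr : ∀ u → link u u ∨ link u u ≡ false
          irr u with link u u in eq
          ... | false = refl
          ... | true  = let a , b , _ = link-elim {u} {u} eq in true≢false a b

        Γ-elim : ∀ {u z} → adj Γ u z ≡ true → link u z ≡ true ⊎ link z u ≡ true
        Γ-elim {u} {z} h with link u z
        ... | true  = inj₁ refl
        ... | false = inj₂ h

        Γ-few : ∀ u → count (adj Γ u) ≤ t
        Γ-few u = case bool? (Y u) of λ
          { (inj₁ yu) → ≤-trans (≤-trans (count-mono λ z h → case Γ-elim {u} {z} h of λ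
              { (inj₁ h′) → h′ ; (inj₂ h′) → true≢false yu (proj₁ (proj₂ (link-elim {z} {u} h′))) })
              (count-image (distinct Y u) (C₁.c u))) (distinct-few u)
          ; (inj₂ nu) → ≤-trans (count-mono {Q = Y} λ z h → case Γ-elim {u} {z} h of λ
              { (inj₁ h′) → true≢false (proj₁ (link-elim {u} {z} h′)) nu ; (inj₂ h′) → proj₁ (link-elim {z} {u} h′) })
              (count-range τ) }

        -- The factor `Y u` marks the terminal, so that `L₂` is symmetric although the order is
        -- imposed at the other end only.
        up′ : Fin n → Fin n → Fin n → Bool
        up′ u z x = Y u ∧ (up u z x ∧ not (Y x))

        L₂ : Fin n → Fin n → Fin n → Bool
        L₂ u v x = up′ u v x ∨ up′ v u x

        L₂-long : ∀ {u z} → link u z ≡ true → t + t + t ≤ count (up′ u z) + count Y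
        L₂-long {u} {z} h with link-elim {u} {z} h
        ... | yu , _ , ok = ≤-trans (≮⇒≥ λ lt → true≢false (T⇒≡ (<⇒<ᵇ lt)) ok) (count-≤+ λ x → ≤ᵇ⇒≤ _ _ (⇒-elim
              (tauto 3 (λ p y q → not p ∨ (⟦ q ⟧ ≤ᵇ (⟦ p ∧ (q ∧ not y) ⟧ + ⟦ y ⟧))) tt (Y u) (Y x) (up u z x)) yu))

        col₂ : Colouring (adj Γ) L₂
        col₂ = colouring w (adj Γ) L₂ (symm Γ) (irrefl Γ) (λ u v x → ∨-comm (up′ u v x) _) λ {u} {v} h → [
            (λ h′ → up-arith t _ _ (count (L₂ u v)) (count Y) (Γ-few u) (Γ-few v) (≤-trans (L₂-long {u} {v} h′) (+-monoˡ-≤ (count Y) (count-mono λ x e → cong (_∨ up′ v u x) e))) (count-range τ))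
          , (λ h′ → up-arith t _ _ (count (L₂ u v)) (count Y) (Γ-few u) (Γ-few v) (≤-trans (L₂-long {v} {u} h′) (+-monoˡ-≤ (count Y) (count-mono λ x e → trans (cong (up′ u v x ∨_) e) (∨-true (up′ u v x))))) (count-range τ))
          ]′ (Γ-elim {u} {v} h)
          where
          ∨-true : ∀ a → a ∨ true ≡ true
          ∨-true true  = refl
          ∨-true false = refl

        module Paths (col₂ : Colouring (adj Γ) L₂) where
          module C₂ = Colouring col₂

          up′-elim : ∀ {u z x} → up′ u z x ≡ true → Y u ≡ true × adj G u x ≡ true × adj G z x ≡ true × below z x ≡ true × Y x ≡ false
          up′-elim {u} {z} {x} h =
            let yu , h₁ = ∧-split {Y u} h
                p , y = ∧-split {up u z x} h₁
                _ , h₂ = ∧-split {S x} p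
                q , h₃ = ∧-split {adj G u x} h₂
                r , b = ∧-split {adj G z x} h₃
            in yu , q , r , b , not-true y

          L₂-elim : ∀ {u v x} → L₂ u v x ≡ true → up′ u v x ≡ true ⊎ up′ v u x ≡ true
          L₂-elim {u} {v} {x} h with up′ u v x
          ... | true  = inj₁ refl
          ... | false = inj₂ h

          c₂-elim : ∀ {u v} → adj Γ u v ≡ true → adj G u (C₂.c u v) ≡ true × Y (C₂.c u v) ≡ false × (Y u ≡ false → below u (C₂.c u v) ≡ true)
          c₂-elim {u} {v} h with L₂-elim {u} {v} (C₂.c-list h)
          ... | inj₁ p = let yu , q , _ , _ , y = up′-elim {u} {v} p in q , y , λ yu′ → true≢false yu yu′
          ... | inj₂ p = let _ , _ , r , b , y = up′-elim {v} {u} p in r , y , λ _ → b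

          reroute : Reroute Γ G (λ x → Y x ≡ false)
          reroute = record
            { D = λ _ _ → false ; c = C₂.c ; D-sym = λ _ _ → refl ; c-sym = C₂.c-sym ; direct = λ _ ()
            ; left   = λ h _ → proj₁ (c₂-elim h)
            ; middle = λ h _ → proj₁ (proj₂ (c₂-elim h))
            ; free   = λ _ _ → refl
            ; proper = λ h _ h′ _ → C₂.c-proper h h′
            -- Middle vertices are no terminals, so `u` and `u′` would both be non-terminals of `Γ`,
            -- each lying above the other.
            ; cross  = λ {u} {v} {u′} {v′} h _ h′ _ e e′ →
                let _ , y , b  = c₂-elim {u} {v} h
                    _ , y′ , b′ = c₂-elim {u′} {v′} h′
                in <-asym (<ᵇ⇒< (toℕ u) (toℕ u′) (≡⇒T (subst (λ x → below u x ≡ true) (sym e′) (b (trans (cong Y e) y′)))))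
                          (<ᵇ⇒< (toℕ u′) (toℕ u) (≡⇒T (subst (λ x → below u′ x ≡ true) (sym e) (b′ (trans (cong Y e′) y)))))
            }

          linked : Linked G τ
          linked = pullback reroute
            (linked-via Γ τ τ-inj C₁.c C₁.c-sym
              (λ {u} {v} d _ → let e = image-∈ (distinct Y u) (C₁.c u) {v} d in
                 cong (_∨ link (C₁.c u v) u) e , proj₁ (proj₂ (link-elim {u} e)))
              (λ d _ d′ _ → C₁.c-proper d d′))
            λ i out → true≢false (range-∈ τ i) out

    linked : Σ[ τ ∈ (Fin t → Fin n) ] Linked G τ
    linked = let τ , inj , mem = choose t nice many-nice
                 col₁ = Terminals.col₁ τ inj mem
             in τ , Terminals.Links.Paths.linked τ inj mem col₁ (Terminals.Links.col₂ τ inj mem col₁)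

  -- One averaging gives both properties of `w`: `badness w + 8 l² < l * count (low w)` forces many
  -- lower neighbours and few bad pairs. With `s = count S` the totals are at most `3 t s² + 8 l² s`
  -- on the left and at least `16 l² s` on the right, and `3 s t < 8 l²`.
  linked-degree : (l : ℕ) → 0 < t → t ≤ l → 3 * count S * t < 8 * l * l → (∃ λ u → S u ≡ true) →
    (∀ {u} → S u ≡ true → 32 * l ≤ degree G S u) → Σ[ τ ∈ (Fin t → Fin n) ] Linked G τ
  linked-degree l 0<t t≤l small (u , su) deg
    with sum-<⇒∃ (λ w → badness w + l * (8 * l) * ⟦ S w ⟧) (λ w → l * count (low w)) (begin-strict
      sum (λ w → badness w + l * (8 * l) * ⟦ S w ⟧)          ≡⟨ ∑-distrib-+ badness (λ w → l * (8 * l) * ⟦ S w ⟧) ⟩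
      sum badness + sum (λ w → l * (8 * l) * ⟦ S w ⟧)        ≡⟨ cong (sum badness +_) (sum-indicator (l * (8 * l)) S) ⟩
      sum badness + l * (8 * l) * count S                    ≤⟨ +-monoˡ-≤ _ total-badness ⟩
      3 * t * count S * count S + l * (8 * l) * count S      <⟨ average-arith (count S) t l _ (∃⇒count>0 S u su) small (total-low (32 * l) deg) ⟩
      l * sum (λ w → count (low w))                          ≡⟨ sum-* l (λ w → count (low w)) ⟨
      sum (λ w → l * count (low w))                          ∎)
    where open ≤-Reasoning
  ... | w , lt = case bool? (S w) of λ
    { (inj₂ sw) → contradiction lt (≤⇒≯ (≤-trans (≤-reflexive (trans (cong (l *_) (count-none λ z → cong (_∧ (S z ∧ adj G w z ∧ below z w)) sw)) (*-zeroʳ l))) z≤n))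
    ; (inj₁ sw) → let lt′ = subst (λ k → badness w + l * (8 * l) * k < l * count (low w)) (cong ⟦_⟧ sw) lt in
        Route.linked l 0<t t≤l w
          (*-cancelˡ-< l _ _ (≤-<-trans (≤-trans (≤-reflexive (sym (*-identityʳ (l * (8 * l))))) (m≤n+m _ _)) lt′))
          (≤-<-trans (m≤m+n _ _) lt′) }

-- Counting cliques

sumS : ∀ n → (Subset n → ℕ) → ℕ
sumS zero    f = f []ᵛ
sumS (suc n) f = sumS n (f ∘ (outside ∷ᵛ_)) + sumS n (f ∘ (inside ∷ᵛ_))

sumS-mono : ∀ n {f g : Subset n → ℕ} → (∀ A → f A ≤ g A) → sumS n f ≤ sumS n g
sumS-mono zero    le = le []ᵛ
sumS-mono (suc n) le = +-mono-≤ (sumS-mono n (le ∘ (outside ∷ᵛ_))) (sumS-mono n (le ∘ (inside ∷ᵛ_)))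

sumS-+ : ∀ n (f g : Subset n → ℕ) → sumS n (λ A → f A + g A) ≡ sumS n f + sumS n g
sumS-+ zero    f g = refl
sumS-+ (suc n) f g = trans (cong₂ _+_ (sumS-+ n _ _) (sumS-+ n _ _))
  (+-interchange (sumS n (f ∘ (outside ∷ᵛ_))) (sumS n (g ∘ (outside ∷ᵛ_))) (sumS n (f ∘ (inside ∷ᵛ_))) (sumS n (g ∘ (inside ∷ᵛ_))))

-- The subsets are compared in pairs that differ in `v` only.
sumS-toggle : ∀ n (v : Fin n) {f g : Subset n → ℕ} →
  (∀ A → lookup A v ≡ false → f A + f (A [ v ]≔ inside) ≤ g A + g (A [ v ]≔ inside)) → sumS n f ≤ sumS n g
sumS-toggle (suc n) zero {f} {g} le = subst₂ _≤_ (sumS-+ n _ _) (sumS-+ n (g ∘ (outside ∷ᵛ_)) _) (sumS-mono n λ A → le (outside ∷ᵛ A) refl)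
sumS-toggle (suc n) (suc v) le = +-mono-≤ (sumS-toggle n v λ A → le (outside ∷ᵛ A)) (sumS-toggle n v λ A → le (inside ∷ᵛ A))

sumS-zero : ∀ n {f : Subset n → ℕ} → (∀ A → f A ≡ 0) → sumS n f ≡ 0
sumS-zero zero    z = z []ᵛ
sumS-zero (suc n) z = cong₂ _+_ (sumS-zero n λ A → z _) (sumS-zero n λ A → z _)

sumS-empty : ∀ n {f : Subset n → ℕ} → (∀ A → f A ≤ 1) → (∀ A u → lookup A u ≡ true → f A ≡ 0) → sumS n f ≤ 1
sumS-empty zero    le one = le []ᵛ
sumS-empty (suc n) le one = ≤-trans (+-mono-≤ (sumS-empty n (λ A → le _) λ A u → one (outside ∷ᵛ A) (suc u))
  (≤-reflexive (sumS-zero n λ A → one (inside ∷ᵛ A) zero refl))) (≤-reflexive (+-identityʳ 1))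

length-filter-map : {A B : Set} {P : B → Set} (P? : ∀ x → Dec (P x)) (f : A → B) (xs : List A) →
  length (filter P? (map f xs)) ≡ length (filter (P? ∘ f) xs)
length-filter-map P? f []       = refl
length-filter-map P? f (x ∷ xs) with does (P? (f x))
... | true  = cong suc (length-filter-map P? f xs)
... | false = length-filter-map P? f xs

length-filter-subsets : ∀ n {P : Subset n → Set} (P? : ∀ A → Dec (P A)) →
  length (filter P? (allSubsets n)) ≡ sumS n (λ A → ⟦ does (P? A) ⟧)
length-filter-subsets zero P? with does (P? []ᵛ)
... | true  = refl
... | false = refl
length-filter-subsets (suc n) P? = begin
  length (filter P? (map (outside ∷ᵛ_) (allSubsets n) ++ map (inside ∷ᵛ_) (allSubsets n)))
    ≡⟨ cong length (filter-++ P? (map (outside ∷ᵛ_) (allSubsets n)) _) ⟩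
  length (filter P? (map (outside ∷ᵛ_) (allSubsets n)) ++ filter P? (map (inside ∷ᵛ_) (allSubsets n)))
    ≡⟨ length-++ (filter P? (map (outside ∷ᵛ_) (allSubsets n))) ⟩
  length (filter P? (map (outside ∷ᵛ_) (allSubsets n))) + length (filter P? (map (inside ∷ᵛ_) (allSubsets n)))
    ≡⟨ cong₂ _+_ (length-filter-map P? (outside ∷ᵛ_) (allSubsets n)) (length-filter-map P? (inside ∷ᵛ_) (allSubsets n)) ⟩
  length (filter (P? ∘ (outside ∷ᵛ_)) (allSubsets n)) + length (filter (P? ∘ (inside ∷ᵛ_)) (allSubsets n))
    ≡⟨ cong₂ _+_ (length-filter-subsets n (P? ∘ (outside ∷ᵛ_))) (length-filter-subsets n (P? ∘ (inside ∷ᵛ_))) ⟩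
  sumS n (λ A → ⟦ does (P? (outside ∷ᵛ A)) ⟧) + sumS n (λ A → ⟦ does (P? (inside ∷ᵛ A)) ⟧) ∎
  where open ≡-Reasoning

does-mono : {P Q : Set} (p : Dec P) (q : Dec Q) → (P → Q) → ⟦ does p ⟧ ≤ ⟦ does q ⟧
does-mono (no _)  q       f = z≤n
does-mono (yes p) (yes _) f = ≤-refl
does-mono (yes p) (no ¬q) f = contradiction (f p) ¬q

CliqueIn : Graph n → (Fin n → Bool) → Subset n → Set
CliqueIn G S A = (∀ u → lookup A u ≡ true → S u ≡ true) × IsClique G A

cliqueIn? : (G : Graph n) (S : Fin n → Bool) (A : Subset n) → Dec (CliqueIn G S A)
cliqueIn? G S A = all? (λ u → (lookup A u ≟ᵇ true) →-dec (S u ≟ᵇ true)) ×-dec isClique? G A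

cliquesIn : Graph n → (Fin n → Bool) → ℕ
cliquesIn {n} G S = sumS n λ A → ⟦ does (cliqueIn? G S A) ⟧

numCliques≤cliquesIn : (G : Graph n) → numCliques G ≤ cliquesIn G (λ _ → true)
numCliques≤cliquesIn {n} G = ≤-trans (≤-reflexive (length-filter-subsets n (isClique? G)))
  (sumS-mono n λ A → does-mono (isClique? G A) (cliqueIn? G (λ _ → true) A) λ c → (λ _ _ → refl) , c)

cliques-split : (G : Graph n) (S : Fin n → Bool) (v : Fin n) →
  cliquesIn G S ≤ cliquesIn G (S ∖ v) + cliquesIn G (λ y → S y ∧ adj G v y)
cliques-split {n} G S v = subst (cliquesIn G S ≤_) (sumS-+ n _ _) (sumS-toggle n v pw)
  where
  N : Fin n → Bool
  N y = S y ∧ adj G v y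
  pw : ∀ A → lookup A v ≡ false → ⟦ does (cliqueIn? G S A) ⟧ + ⟦ does (cliqueIn? G S (A [ v ]≔ inside)) ⟧ ≤
       (⟦ does (cliqueIn? G (S ∖ v) A) ⟧ + ⟦ does (cliqueIn? G N A) ⟧) +
       (⟦ does (cliqueIn? G (S ∖ v) (A [ v ]≔ inside)) ⟧ + ⟦ does (cliqueIn? G N (A [ v ]≔ inside)) ⟧)
  pw A v∉A = ≤-trans (+-mono-≤
      (does-mono (cliqueIn? G S A) (cliqueIn? G (S ∖ v) A) λ { (sub , cl) → (λ u h → ∖-∈ S (sub u h) (≢v h)) , cl })
      (does-mono (cliqueIn? G S B) (cliqueIn? G N A) λ { (sub , cl) →
        (λ u h → ∧-join (sub u (inB h)) (T⇒≡ (cl v u v∈B (lookup⇒[]= u B (inB h)) (≢v h ∘ sym))))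
        , λ u w u∈ w∈ → cl u w (inB′ u∈) (inB′ w∈) }))
    (m≤m+n _ _)
    where
    B = A [ v ]≔ inside
    ≢v : ∀ {u} → lookup A u ≡ true → u ≢ v
    ≢v h refl = true≢false h v∉A
    inB : ∀ {u} → lookup A u ≡ true → lookup B u ≡ true
    inB {u} h = trans (lookup∘update′ (≢v h) A inside) h
    inB′ : ∀ {u} → u ∈ A → u ∈ B
    inB′ {u} u∈ = lookup⇒[]= u B (inB ([]=⇒lookup u∈))
    v∈B : v ∈ B
    v∈B = lookup⇒[]= v B (lookup∘update v A inside)

cliques-empty : (G : Graph n) (S : Fin n → Bool) → (∀ u → S u ≡ false) → cliquesIn G S ≤ 1
cliques-empty {n} G S none = sumS-empty n (λ A → ⟦⟧≤1 _) λ A u h → lem (cliqueIn? G S A) λ { (sub , _) → true≢false (sub u h) (none u) }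
  where
  lem : {P : Set} (p : Dec P) → ¬ P → ⟦ does p ⟧ ≡ 0
  lem (yes p) ¬p = contradiction p ¬p
  lem (no _)  _  = refl

cliques≤2^ : (G : Graph n) (k : ℕ) (S : Fin n → Bool) → count S ≤ k → cliquesIn G S ≤ 2 ^ k
cliques≤2^ G k S le with search S
... | inj₂ none = ≤-trans (cliques-empty G S none) (m^n>0 2 k)
cliques≤2^ G zero S le | inj₁ (v , sv) = contradiction (≤-trans (∃⇒count>0 S v sv) le) λ ()
cliques≤2^ G (suc k) S le | inj₁ (v , sv) = ≤-trans (cliques-split G S v) (≤-trans (+-mono-≤
    (cliques≤2^ G k (S ∖ v) small)
    (cliques≤2^ G k (λ y → S y ∧ adj G v y) (≤-trans (count-mono λ y h → let a , b = ∧-split {S y} h in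
       ∖-∈ S {v} a λ { refl → true≢false b (irrefl G v) }) small)))
  (≤-reflexive (cong (2 ^ k +_) (sym (+-identityʳ _)))))
  where
  small : count (S ∖ v) ≤ k
  small = s≤s⁻¹ (≤-trans (count-∖< S sv) le)

-- Branching on a vertex v of low degree removes v from S at the cost of one summand a.
cliques-peel : (G : Graph n) (a m N : ℕ) → (∀ S → count S ≤ m → cliquesIn G S ≤ a) →
  (∀ S → m < count S → count S ≤ N → ∃ λ v → S v ≡ true × degree G S v ≤ m) →
  ∀ f S → count S ≤ N → count S ≤ m + f → cliquesIn G S ≤ a * suc f
cliques-peel G a m N base low f S le≤N le with count S ≤? m
... | yes small = ≤-trans (base S small) (m≤m*n a (suc f))
cliques-peel G a m N base low zero S le≤N le | no big = contradiction (≤-trans le (≤-reflexive (+-identityʳ m))) big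
cliques-peel G a m N base low (suc f) S le≤N le | no big with low S (≰⇒> big) le≤N
... | v , sv , deg = ≤-trans (cliques-split G S v) (≤-trans (+-mono-≤
    (cliques-peel G a m N base low f (S ∖ v) (≤-trans (<⇒≤ (count-∖< S sv)) le≤N)
      (s≤s⁻¹ (≤-trans (count-∖< S sv) (≤-trans le (≤-reflexive (+-suc m f))))))
    (base (λ y → S y ∧ adj G v y) deg))
  (≤-reflexive (trans (+-comm (a * suc f) a) (sym (*-suc a (suc f))))))

lowDegree : (G : Graph n) (S : Fin n → Bool) (m : ℕ) → ¬ (∀ {u} → S u ≡ true → m < degree G S u) →
            ∃ λ v → S v ≡ true × degree G S v ≤ m
lowDegree G S m ¬high with search (λ v → S v ∧ (degree G S v ≤ᵇ m))
... | inj₁ (v , h) = let a , b = ∧-split {S v} h in v , a , ≤ᵇ⇒≤ _ _ (≡⇒T b)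
... | inj₂ none = contradiction (λ {u} su → ≰⇒> λ le → true≢false (∧-join su (T⇒≡ (≤⇒≤ᵇ le))) (none u)) ¬high

-- Branching in graphs without a strong immersion of `K t`

triangular : ℕ → ℕ
triangular zero    = 0
triangular (suc k) = triangular k + suc k

1+2^≤ : ∀ k → suc (2 ^ k) ≤ 2 ^ suc k
1+2^≤ k = ≤-trans (+-monoˡ-≤ (2 ^ k) (m^n>0 2 k)) (≤-reflexive (cong (2 ^ k +_) (sym (+-identityʳ _))))

module NoImmersion {t : ℕ} (0<t : 0 < t) (G : Graph n) (none : ¬ StrongImmersion (K t) G) where

  refute : ¬ (Σ[ τ ∈ (Fin t → Fin n) ] Linked G τ)
  refute (τ , L) = none (linked⇒immersion L)

  -- From surplus `2 ^ suc k` down to `2 ^ k` there are at most `2 ^ k` branchings, so the factor is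
  -- at most `2 ^ suc k`; the exponents add up to a triangular number.
  near-bound : ∀ k S → count S ≤ t + 2 ^ k → cliquesIn G S ≤ 2 ^ (t + 1 + triangular k)
  near-bound zero S le = ≤-trans (cliques≤2^ G (t + 1) S le) (≤-reflexive (cong (2 ^_) (sym (+-identityʳ (t + 1)))))
  near-bound (suc k) S le = begin
    cliquesIn G S                                          ≤⟨ cliques-peel G _ (t + 2 ^ k) (t + 2 ^ suc k) (near-bound k) low (2 ^ k) S le
                                                                (≤-trans le (≤-reflexive (trans (cong (λ z → t + (2 ^ k + z)) (+-identityʳ (2 ^ k))) (sym (+-assoc t (2 ^ k) (2 ^ k)))))) ⟩
    2 ^ (t + 1 + triangular k) * suc (2 ^ k)               ≤⟨ *-monoʳ-≤ (2 ^ (t + 1 + triangular k)) (1+2^≤ k) ⟩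
    2 ^ (t + 1 + triangular k) * 2 ^ suc k                 ≡⟨ ^-distribˡ-+-* 2 (t + 1 + triangular k) (suc k) ⟨
    2 ^ (t + 1 + triangular k + suc k)                     ≡⟨ cong (2 ^_) (+-assoc (t + 1) (triangular k) (suc k)) ⟩
    2 ^ (t + 1 + triangular (suc k))                       ∎
    where
    open ≤-Reasoning
    low : ∀ S → t + 2 ^ k < count S → count S ≤ t + 2 ^ suc k → ∃ λ v → S v ≡ true × degree G S v ≤ t + 2 ^ k
    low S lo hi = lowDegree G S (t + 2 ^ k) λ high → refute
      (linked-dense G S (count S ∸ t) (2 ^ k) 0<t (sym (m+[n∸m]≡n (≤-trans (m≤m+n t _) (<⇒≤ lo))))
        (≤-trans (≤-trans (∸-monoˡ-≤ t hi) (≤-reflexive (trans (m+n∸m≡n t _) (cong (2 ^ k +_) (+-identityʳ _))))) (n≤1+n _)) high)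

  middle-bound : ∀ a N l → t ≤ l → 3 * N * t < 8 * l * l → (∀ S → count S ≤ 32 * l → cliquesIn G S ≤ a) →
    ∀ S → count S ≤ N → cliquesIn G S ≤ a * suc N
  middle-bound a N l t≤l small base S le = cliques-peel G a (32 * l) N base low N S le (≤-trans le (m≤n+m N _))
    where
    low : ∀ S → 32 * l < count S → count S ≤ N → ∃ λ v → S v ≡ true × degree G S v ≤ 32 * l
    low S lo hi = lowDegree G S (32 * l) λ high → refute
      (Dense.linked-degree G S t l 0<t t≤l (≤-<-trans (*-monoˡ-≤ t (*-monoʳ-≤ 3 hi)) small) (count>0⇒∃ S (≤-<-trans z≤n lo)) (<⇒≤ ∘ high))

  -- Each branching removes one vertex for one summand `a`, so the cost is linear in `n`; later
  -- stages no longer depend on `n`.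
  far-bound : ∀ a → (∀ S → count S ≤ minDegree t → cliquesIn G S ≤ a) → numCliques G ≤ a * suc n
  far-bound a base = ≤-trans (numCliques≤cliquesIn G)
    (cliques-peel G a (minDegree t) (count (λ (u : Fin n) → true)) base low n (λ _ → true) ≤-refl (≤-trans (≤-reflexive count-full) (m≤n+m n _)))
    where
    low : ∀ S → minDegree t < count S → count S ≤ _ → ∃ λ v → S v ≡ true × degree G S v ≤ minDegree t
    low S lo _ = lowDegree G S (minDegree t) λ high → refute
      (linked-minDegree 0<t G S (proj₂ (count>0⇒∃ S (≤-<-trans z≤n lo))) (<⇒≤ ∘ high))

opaque
  -- The order `t⁴` comes from `t * (t * gap t)`, where `gap t` is quadratic. In `s = t - 1` the
  -- difference of the two sides has positive coefficients.
  minDegree-poly : ∀ t → 0 < t → minDegree t ≤ 64 * (t * t * (t * t))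
  minDegree-poly (suc s) _ = poly s
    where
    poly : ∀ s → (1 + s) * ((1 + s) * ((1 + s) * (1 + s) + (1 + s) + (1 + s) + 2) + (1 + s) * (1 + s)) +
      ((1 + s) * ((1 + s) * (1 + s) + (1 + s) + (1 + s) + 2) + (1 + s) * ((1 + s) * (1 + s) + (1 + s) + (1 + s) + 2)) +
      26 * (1 + s) + 10 + (1 + s) ≤ 64 * ((1 + s) * (1 + s) * ((1 + s) * (1 + s)))
    poly s = ≤-by (11 + 194 * s + 357 * (s * s) + 247 * (s * s * s) + 63 * (s * s * (s * s))) (z≤n {0}) (solve (s ∷ []))

-- The upper bound
--
-- With 8q ≤ l < 8q + 8, branching reduces sets of size minDegree t ≤ 2^(32q+38) to size 2^(20q+28),
-- 2^(14q+23) and 2^(11q+20) in turn. The last size has 2^(t + 60.5 q² + O(q)) cliques, and 60.5 < 8².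

triangular-double : ∀ k → triangular k + triangular k ≡ k * suc k
triangular-double zero    = refl
triangular-double (suc k) = trans (+-interchange (triangular k) (suc k) (triangular k) (suc k))
  (trans (cong (_+ (suc k + suc k)) (triangular-double k)) (lem k))
  where
  lem : ∀ k → k * suc k + (suc k + suc k) ≡ suc k * suc (suc k)
  lem k = solve (k ∷ [])

opaque
  halve : ∀ {a b} → a + a ≤ b + b → a ≤ b
  halve {a} {b} h = ≮⇒≥ λ lt → <⇒≱ (+-mono-< lt lt) h

  -- Twice the exponent is `2t + 121 q² + 583 q + 608`. The `7 q²` missing to `2 (8q)²` cover the
  -- lower terms for `q ≥ 100`.
  exponent-arith : ∀ q t l tri → 100 ≤ q → 8 * q ≤ l → tri + tri ≡ (11 * q + 20) * suc (11 * q + 20) →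
    suc (t + 1 + tri + suc (14 * q + 23) + suc (20 * q + 28) + suc (32 * q + 38)) ≤ t + l * l
  exponent-arith q t l tri big 8q≤l double =
    ≤-trans (halve (≤-by 11092 (+-mono-≤ (≤-reflexive double) (+-mono-≤ (times 7 (*-monoˡ-≤ q big)) (times 117 big))) (identity q t tri)))
      (+-monoʳ-≤ t (*-mono-≤ 8q≤l 8q≤l))
    where
    times : ∀ k {a b} → a ≤ b → k * a ≤ k * b
    times k = *-monoʳ-≤ k
    identity : ∀ q t tri → let L = suc (t + 1 + tri + suc (14 * q + 23) + suc (20 * q + 28) + suc (32 * q + 38)) in
      L + L + ((11 * q + 20) * suc (11 * q + 20) + (7 * (q * q) + 117 * q)) + 11092 ≡
      (t + 8 * q * (8 * q)) + (t + 8 * q * (8 * q)) + (tri + tri + (7 * (100 * q) + 117 * 100))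
    identity q t tri = solve (q ∷ t ∷ tri ∷ [])

  linear₁ : ∀ q → 14 * q + 23 + (8 * q + 8) ≤ suc (11 * q + 15 + (11 * q + 15))
  linear₁ q = ≤-by 0 (z≤n {0}) (solve (q ∷ []))
  linear₂ : ∀ q → 20 * q + 28 + (8 * q + 8) ≤ suc (14 * q + 18 + (14 * q + 18))
  linear₂ q = ≤-by 1 (z≤n {0}) (solve (q ∷ []))
  linear₃ : ∀ q → 32 * q + 38 + (8 * q + 8) ≤ suc (20 * q + 23 + (20 * q + 23))
  linear₃ q = ≤-by 1 (z≤n {0}) (solve (q ∷ []))
  linear₄ : ∀ q → 6 + ((8 * q + 8) + (8 * q + 8) + ((8 * q + 8) + (8 * q + 8))) ≡ 32 * q + 38
  linear₄ q = solve (q ∷ [])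
  shift : ∀ a c → 5 + (a + c) ≡ a + (5 + c)
  shift a c = solve (a ∷ c ∷ [])
  reach : ∀ a b q → 8 ≤ b → 8 ≤ a → 8 * q + 8 ≤ a * q + b
  reach a b q h₁ h₂ = +-mono-≤ (*-monoˡ-≤ q h₂) h₁

  power-arith : ∀ E e₀ e t → t < 2 ^ e₀ → E + e₀ ≤ suc (e + e) → 3 * 2 ^ E * t < 8 * 2 ^ e * 2 ^ e
  power-arith E e₀ e t t<2^e₀ le = begin-strict
    3 * 2 ^ E * t            ≤⟨ *-monoˡ-≤ t (*-monoˡ-≤ (2 ^ E) (s≤s (s≤s (s≤s (z≤n {1}))))) ⟩
    4 * 2 ^ E * t            <⟨ *-monoʳ-< (4 * 2 ^ E) {{>-nonZero (≤-trans (m^n>0 2 E) (m≤m+n _ _))}} t<2^e₀ ⟩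
    4 * 2 ^ E * 2 ^ e₀        ≡⟨ trans (*-assoc 4 (2 ^ E) _) (cong (4 *_) (sym (^-distribˡ-+-* 2 E e₀))) ⟩
    4 * 2 ^ (E + e₀)          ≤⟨ *-monoʳ-≤ 4 (^-monoʳ-≤ 2 le) ⟩
    4 * (2 * 2 ^ (e + e))    ≡⟨ trans (sym (*-assoc 4 2 (2 ^ (e + e)))) (trans (cong (8 *_) (^-distribˡ-+-* 2 e e)) (sym (*-assoc 8 (2 ^ e) _))) ⟩
    8 * 2 ^ e * 2 ^ e        ∎
    where open ≤-Reasoning

module _ {t : ℕ} (0<t : 0 < t) (G : Graph n) (none : ¬ StrongImmersion (K t) G) where
  open NoImmersion 0<t G none

  -- For `N = 2 ^ E` and `l = 2 ^ e` the condition `3 N t < 8 l²` follows from `E + e₀ ≤ 2e + 1`, so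
  -- `E` drops to about `(E + e₀) / 2`; the 5 is the logarithm of 32.
  middle-step : ∀ e₀ x E e → t < 2 ^ e₀ → e₀ ≤ e → E + e₀ ≤ suc (e + e) →
    (∀ S → count S ≤ 2 ^ (5 + e) → cliquesIn G S ≤ 2 ^ x) → ∀ S → count S ≤ 2 ^ E → cliquesIn G S ≤ 2 ^ (x + suc E)
  middle-step e₀ x E e t<2^e₀ e₀≤e le base S small = begin
    cliquesIn G S          ≤⟨ middle-bound (2 ^ x) (2 ^ E) (2 ^ e) (<⇒≤ (<-≤-trans t<2^e₀ (^-monoʳ-≤ 2 e₀≤e))) (power-arith E e₀ e t t<2^e₀ le)
                                (λ S le → base S (≤-trans le (≤-reflexive (sym (^-distribˡ-+-* 2 5 e))))) S small ⟩
    2 ^ x * suc (2 ^ E)    ≤⟨ *-monoʳ-≤ (2 ^ x) (1+2^≤ E) ⟩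
    2 ^ x * 2 ^ suc E      ≡⟨ ^-distribˡ-+-* 2 x (suc E) ⟨
    2 ^ (x + suc E)        ∎
    where open ≤-Reasoning

  minDegree≤2^ : ∀ e₀ → t < 2 ^ e₀ → minDegree t ≤ 2 ^ (6 + (e₀ + e₀ + (e₀ + e₀)))
  minDegree≤2^ e₀ t<2^e₀ = begin
    minDegree t                                   ≤⟨ minDegree-poly t 0<t ⟩
    64 * (t * t * (t * t))                        ≤⟨ *-monoʳ-≤ 64 (*-mono-≤ (*-mono-≤ le le) (*-mono-≤ le le)) ⟩
    64 * (2 ^ e₀ * 2 ^ e₀ * (2 ^ e₀ * 2 ^ e₀))        ≡⟨ cong (64 *_) (trans (cong₂ _*_ (sym (^-distribˡ-+-* 2 e₀ e₀)) (sym (^-distribˡ-+-* 2 e₀ e₀))) (sym (^-distribˡ-+-* 2 (e₀ + e₀) (e₀ + e₀)))) ⟩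
    64 * 2 ^ (e₀ + e₀ + (e₀ + e₀))                    ≡⟨ ^-distribˡ-+-* 2 6 (e₀ + e₀ + (e₀ + e₀)) ⟨
    2 ^ (6 + (e₀ + e₀ + (e₀ + e₀)))                   ∎
    where
    open ≤-Reasoning
    le : t ≤ 2 ^ e₀
    le = <⇒≤ t<2^e₀

  upper-bound : ∀ l → 800 ≤ l → t < 2 ^ suc l → 0 < n → numCliques G ≤ 2 ^ (t + l * l) * n
  upper-bound l big t<2^ 0<n = begin
    numCliques G                          ≤⟨ far-bound (2 ^ x₃) (λ S le → step₃ S (≤-trans le (≤-trans (minDegree≤2^ e₀ t<2^e₀) (≤-reflexive (cong (2 ^_) (linear₄ q)))))) ⟩
    2 ^ x₃ * suc n                        ≤⟨ *-monoʳ-≤ (2 ^ x₃) (≤-trans (+-monoˡ-≤ n 0<n) (≤-reflexive (cong (n +_) (sym (+-identityʳ n))))) ⟩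
    2 ^ x₃ * (2 * n)                      ≡⟨ trans (sym (*-assoc (2 ^ x₃) 2 n)) (cong (_* n) (*-comm (2 ^ x₃) 2)) ⟩
    2 ^ suc x₃ * n                        ≤⟨ *-monoˡ-≤ n (^-monoʳ-≤ 2 (exponent-arith q t l (triangular (11 * q + 20)) 100≤q 8q≤l (triangular-double (11 * q + 20)))) ⟩
    2 ^ (t + l * l) * n                   ∎
    where
    open ≤-Reasoning
    -- The powers 4, 5/2, 7/4 and 11/8 of `t` have common denominator 8.
    q = l / 8
    e₀ = 8 * q + 8
    8q≤l : 8 * q ≤ l
    8q≤l = ≤-trans (≤-reflexive (*-comm 8 q)) (m/n*n≤m l 8)
    100≤q : 100 ≤ q
    100≤q = /-monoˡ-≤ 8 big
    t<2^e₀ : t < 2 ^ e₀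
    t<2^e₀ = <-≤-trans t<2^ (^-monoʳ-≤ 2 (begin
      suc l                  ≡⟨ cong suc (m≡m%n+[m/n]*n l 8) ⟩
      suc (l % 8) + q * 8    ≤⟨ +-monoˡ-≤ (q * 8) (m%n<n l 8) ⟩
      8 + q * 8              ≡⟨ trans (+-comm 8 _) (cong (_+ 8) (*-comm q 8)) ⟩
      e₀                      ∎))
    x₀ = t + 1 + triangular (11 * q + 20)
    x₁ = x₀ + suc (14 * q + 23)
    x₂ = x₁ + suc (20 * q + 28)
    x₃ = x₂ + suc (32 * q + 38)
    step₀ : ∀ S → count S ≤ 2 ^ (5 + (11 * q + 15)) → cliquesIn G S ≤ 2 ^ x₀
    step₀ S le = near-bound (11 * q + 20) S (≤-trans le (≤-trans (≤-reflexive (cong (2 ^_) (shift (11 * q) 15))) (m≤n+m _ t)))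
    step₁ : ∀ S → count S ≤ 2 ^ (5 + (14 * q + 18)) → cliquesIn G S ≤ 2 ^ x₁
    step₁ S le = middle-step e₀ x₀ (14 * q + 23) (11 * q + 15) t<2^e₀ (reach 11 15 q (m≤m+n 8 7) (m≤m+n 8 3)) (linear₁ q) step₀ S
      (≤-trans le (≤-reflexive (cong (2 ^_) (shift (14 * q) 18))))
    step₂ : ∀ S → count S ≤ 2 ^ (5 + (20 * q + 23)) → cliquesIn G S ≤ 2 ^ x₂
    step₂ S le = middle-step e₀ x₁ (20 * q + 28) (14 * q + 18) t<2^e₀ (reach 14 18 q (m≤m+n 8 10) (m≤m+n 8 6)) (linear₂ q) step₁ S
      (≤-trans le (≤-reflexive (cong (2 ^_) (shift (20 * q) 23))))
    step₃ : ∀ S → count S ≤ 2 ^ (32 * q + 38) → cliquesIn G S ≤ 2 ^ x₃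
    step₃ = middle-step e₀ x₂ (32 * q + 38) (20 * q + 23) t<2^e₀ (reach 20 23 q (m≤m+n 8 15) (m≤m+n 8 12)) (linear₃ q) step₂

-- Disjoint cliques on suc s vertices

module _ (s : ℕ) where

  -- The offset o makes the family closed under removal of the first vertex.
  block : ℕ → Fin n → ℕ
  block o u = (toℕ u + o) / suc s

  blocks : ℕ → ∀ n → Graph n
  blocks o n = record
    { adj    = λ u v → not (u == v) ∧ (block o u ≡ᵇ block o v)
    ; symm   = λ u v → cong₂ (λ a b → not a ∧ b) (==-sym u v) (≡ᵇ-sym (block o u) (block o v))
    ; irrefl = λ u → cong (λ a → not a ∧ (block o u ≡ᵇ block o u)) (==-refl u) }
    where
    ≡ᵇ-sym : ∀ a b → (a ≡ᵇ b) ≡ (b ≡ᵇ a)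
    ≡ᵇ-sym zero    zero    = refl
    ≡ᵇ-sym zero    (suc b) = refl
    ≡ᵇ-sym (suc a) zero    = refl
    ≡ᵇ-sym (suc a) (suc b) = ≡ᵇ-sym a b

  blocks-adj : ∀ {o} {u v : Fin n} → adj (blocks o n) u v ≡ true → block o u ≡ block o v
  blocks-adj {o = o} {u} {v} h = ≡ᵇ⇒≡ _ _ (≡⇒T (proj₂ (∧-split {not (u == v)} h)))

  adj-blocks : ∀ {o} {u v : Fin n} → u ≢ v → block o u ≡ block o v → adj (blocks o n) u v ≡ true
  adj-blocks {o = o} {u} {v} ne e = ∧-join (not-false (≢⇒== ne)) (T⇒≡ (≡⇒≡ᵇ _ _ e))

  walk-block : ∀ {o} {u v : Fin n} → Walk (blocks o n) u v → block o u ≡ block o v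
  walk-block (stop u)     = refl
  walk-block {o = o} (step u {v} e p) = trans (blocks-adj {o = o} {u} {v} (T⇒≡ e)) (walk-block p)

  -- Two of the `s + 2` branch vertices agree modulo `s + 1` after the offset. The path between them
  -- puts them into one block, so they coincide.
  blocks-none : ∀ o → ¬ StrongImmersion (K (suc (suc s))) (blocks o n)
  blocks-none o I with pigeonhole ≤-refl (λ i → (toℕ (φ i) + o) mod suc s)
    where open StrongImmersion I
  ... | i , j , i<j , e = <ꟳ-irrefl (φ-inj (toℕ-injective (+-cancelʳ-≡ o _ _ (begin
      toℕ (φ i) + o                                              ≡⟨ m≡m%n+[m/n]*n (toℕ (φ i) + o) (suc s) ⟩
      (toℕ (φ i) + o) % suc s + block o (φ i) * suc s            ≡⟨ cong₂ (λ a b → a + b * suc s) rest (walk-block (Path.walk (path i<j edge))) ⟩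
      (toℕ (φ j) + o) % suc s + block o (φ j) * suc s            ≡⟨ m≡m%n+[m/n]*n (toℕ (φ j) + o) (suc s) ⟨
      toℕ (φ j) + o                                              ∎)))) i<j
    where
    open StrongImmersion I
    open ≡-Reasoning
    edge : Adj (K (suc (suc s))) i j
    edge = ≡⇒T (not-false (≢⇒== {u = i} {j} λ { refl → <ꟳ-irrefl refl i<j }))
    rest : (toℕ (φ i) + o) % suc s ≡ (toℕ (φ j) + o) % suc s
    rest = trans (sym (toℕ-fromℕ< (m%n<n (toℕ (φ i) + o) (suc s)))) (trans (cong toℕ e) (toℕ-fromℕ< (m%n<n (toℕ (φ j) + o) (suc s))))

  initial : ∀ {n} → ℕ → Subset n → Bool
  initial c       []ᵛ      = true
  initial zero    (b ∷ᵛ A) = not b ∧ initial zero A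
  initial (suc c) (b ∷ᵛ A) = initial c A

  initial-< : ∀ {n} c (A : Subset n) → initial c A ≡ true → ∀ u → lookup A u ≡ true → toℕ u < c
  initial-< zero    (true  ∷ᵛ A) () u h
  initial-< zero    (false ∷ᵛ A) i zero ()
  initial-< zero    (false ∷ᵛ A) i (suc u) h = contradiction (initial-< zero A i u h) λ ()
  initial-< (suc c) (b ∷ᵛ A) i zero h    = s≤s z≤n
  initial-< (suc c) (b ∷ᵛ A) i (suc u) h = s≤s (initial-< c A i u h)

  sumS-initial : ∀ n c → c ≤ n → 2 ^ c ≤ sumS n (λ A → ⟦ initial c A ⟧)
  sumS-initial zero    zero    le = ≤-refl
  sumS-initial (suc n) zero    le = ≤-trans (sumS-initial n zero z≤n) (m≤m+n _ _)
  sumS-initial (suc n) (suc c) le = +-mono-≤ (sumS-initial n c (s≤s⁻¹ le)) (≤-trans (≤-reflexive (+-identityʳ _)) (sumS-initial n c (s≤s⁻¹ le)))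

  private
    tail : ∀ {n b} {A : Subset n} {u} → suc u ∈ (b ∷ᵛ A) → u ∈ A
    tail {A = A} {u} h = lookup⇒[]= u A ([]=⇒lookup h)

  clique-outside : ∀ o {n} (A : Subset n) → IsClique (blocks (suc o) n) A → IsClique (blocks o (suc n)) (outside ∷ᵛ A)
  clique-outside o A cl zero    v       () v∈ ne
  clique-outside o A cl (suc u) zero    u∈ () ne
  clique-outside o {n} A cl (suc u) (suc v) u∈ v∈ ne = ≡⇒T (adj-blocks {o = o} ne
    (trans (cong (_/ suc s) (sym (+-suc (toℕ u) o))) (trans
      (blocks-adj {o = suc o} {u} {v} (T⇒≡ (cl u v (tail u∈) (tail v∈) λ e → ne (cong suc e))))
      (cong (_/ suc s) (+-suc (toℕ v) o)))))

  clique-inside : ∀ j {n} (A : Subset n) → initial s A ≡ true → IsClique (blocks (j * suc s) (suc n)) (inside ∷ᵛ A)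
  clique-inside j {n} A i u v u∈ v∈ ne = ≡⇒T (adj-blocks {o = j * suc s} ne (trans (at u u∈) (sym (at v v∈))))
    where
    at : ∀ u → u ∈ (inside ∷ᵛ A) → block (j * suc s) u ≡ j
    at u u∈ = begin
      (toℕ u + j * suc s) / suc s       ≡⟨ +-distrib-/-∣ʳ (toℕ u) (divides j refl) ⟩
      toℕ u / suc s + j * suc s / suc s ≡⟨ cong₂ _+_ (m<n⇒m/n≡0 (small u u∈)) (m*n/n≡m j (suc s)) ⟩
      j                                 ∎
      where
      open ≡-Reasoning
      small : ∀ u → u ∈ (inside ∷ᵛ A) → toℕ u < suc s
      small zero    _  = s≤s z≤n
      small (suc u) u∈ = s≤s (initial-< s A i u ([]=⇒lookup (tail u∈)))

  numCliques-def : ∀ {n} (G : Graph n) → numCliques G ≡ sumS n (λ A → ⟦ does (isClique? G A) ⟧)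
  numCliques-def {n} G = length-filter-subsets n (isClique? G)

  drop-one : ∀ o n → numCliques (blocks (suc o) n) ≤ sumS n (λ A → ⟦ does (isClique? (blocks o (suc n)) (outside ∷ᵛ A)) ⟧)
  drop-one o n = ≤-trans (≤-reflexive (numCliques-def (blocks (suc o) n))) (sumS-mono n λ A → does-mono (isClique? (blocks (suc o) n) A) (isClique? (blocks o (suc n)) (outside ∷ᵛ A)) (clique-outside o A))

  drop-many : ∀ k o n → numCliques (blocks (k + o) n) ≤ numCliques (blocks o (k + n))
  drop-many zero    o n = ≤-refl
  drop-many (suc k) o n = begin
    numCliques (blocks (suc k + o) n)     ≡⟨ cong (λ o → numCliques (blocks o n)) (+-suc k o) ⟨
    numCliques (blocks (k + suc o) n)     ≤⟨ drop-many k (suc o) n ⟩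
    numCliques (blocks (suc o) (k + n))   ≤⟨ ≤-trans (drop-one o (k + n)) (m≤m+n _ _) ⟩
    sumS (suc k + n) (λ A → ⟦ does (isClique? (blocks o (suc k + n)) A) ⟧) ≡⟨ numCliques-def (blocks o (suc k + n)) ⟨
    numCliques (blocks o (suc k + n))     ∎
    where open ≤-Reasoning

  -- Only cliques through the first vertex of each block are counted: any of the `2 ^ s` sets of its
  -- other vertices may be added. Dropping the block raises the offset to the next multiple of
  -- `suc s`.
  many-cliques : ∀ q j r → q * 2 ^ s ≤ numCliques (blocks (j * suc s) (q * suc s + r))
  many-cliques zero    j r = z≤n
  many-cliques (suc q) j r = begin
    2 ^ s + q * 2 ^ s                                                ≡⟨ +-comm (2 ^ s) _ ⟩
    q * 2 ^ s + 2 ^ s                                                ≤⟨ +-mono-≤ outer inner ⟩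
    sumS N (λ A → ⟦ does (isClique? B (outside ∷ᵛ A)) ⟧) + sumS N (λ A → ⟦ does (isClique? B (inside ∷ᵛ A)) ⟧) ≡⟨ numCliques-def B ⟨
    numCliques B                                                     ≡⟨ cong (λ n → numCliques (blocks (j * suc s) (suc n))) (sym (+-assoc s (q * suc s) r)) ⟩
    numCliques (blocks (j * suc s) (suc q * suc s + r))              ∎
    where
    open ≤-Reasoning
    N = s + (q * suc s + r)
    B = blocks (j * suc s) (suc N)
    outer : q * 2 ^ s ≤ sumS N (λ A → ⟦ does (isClique? B (outside ∷ᵛ A)) ⟧)
    outer = ≤-trans (many-cliques q (suc j) r) (≤-trans (≤-reflexive (cong (λ o → numCliques (blocks o (q * suc s + r))) (sym (+-suc s (j * suc s)))))
      (≤-trans (drop-many s (suc (j * suc s)) (q * suc s + r)) (drop-one (j * suc s) N)))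
    inner : 2 ^ s ≤ sumS N (λ A → ⟦ does (isClique? B (inside ∷ᵛ A)) ⟧)
    inner = ≤-trans (sumS-initial N s (m≤m+n s _)) (sumS-mono N λ A → lem A)
      where
      lem : ∀ A → ⟦ initial s A ⟧ ≤ ⟦ does (isClique? B (inside ∷ᵛ A)) ⟧
      lem A = ⟦⟧-mono λ i → dec-true (isClique? B (inside ∷ᵛ A)) (clique-inside j A i)

opaque
  -- As `n` is at least `s + 2`, `q` is positive, so the remainder at most doubles `q * suc s`. Here
  -- `l` stands for a power of two that exceeds half of `s + 2`.
  quotient-arith : ∀ s n q r l x c → n ≡ r + q * suc s → r < suc s → suc (suc s) ≤ n → suc (suc s) < 2 * l → q * x ≤ c →
    n * (4 * x) ≤ 16 * l * c
  quotient-arith s _ zero r l x c refl r<s big t<l qx = contradiction (≤-trans big (≤-trans (≤-reflexive (+-identityʳ r)) (<⇒≤ r<s))) (n≮n _)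
  quotient-arith s _ (suc q) r l x c refl r<s big t<l qx = begin
    (r + suc q * suc s) * (4 * x)             ≤⟨ *-monoˡ-≤ (4 * x) (+-monoˡ-≤ (suc q * suc s) (≤-trans (<⇒≤ r<s) (m≤m+n (suc s) (q * suc s)))) ⟩
    (suc q * suc s + suc q * suc s) * (4 * x) ≡⟨ eq₁ s q x ⟩
    8 * suc s * (suc q * x)                   ≤⟨ *-mono-≤ (*-monoʳ-≤ 8 (≤-trans (n≤1+n (suc s)) (<⇒≤ t<l))) qx ⟩
    8 * (2 * l) * c                           ≡⟨ eq₂ l c ⟩
    16 * l * c                                ∎
    where
    open ≤-Reasoning
    eq₁ : ∀ s q x → (suc q * suc s + suc q * suc s) * (4 * x) ≡ 8 * suc s * (suc q * x)
    eq₁ s q x = solve (s ∷ q ∷ x ∷ [])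
    eq₂ : ∀ l c → 8 * (2 * l) * c ≡ 16 * l * c
    eq₂ l c = solve (l ∷ c ∷ [])

lower-bound : ∀ t l n → 2 ≤ t → t < 2 ^ suc l → t ≤ n →
  Σ[ G ∈ Graph n ] (¬ StrongImmersion (K t) G) × n * 2 ^ t ≤ 2 ^ (4 + l) * numCliques G
lower-bound (suc zero) l n (s≤s ()) t<2^ t≤n
lower-bound (suc (suc s)) l n _ t<2^ t≤n = blocks s 0 n , blocks-none s 0 , (begin
  n * 2 ^ (2 + s)                    ≡⟨ cong (n *_) (^-distribˡ-+-* 2 2 s) ⟩
  n * (4 * 2 ^ s)                    ≤⟨ quotient-arith s n (n / suc s) (n % suc s) (2 ^ l) (2 ^ s) _ (m≡m%n+[m/n]*n n (suc s)) (m%n<n n (suc s)) t≤n t<2^ many ⟩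
  16 * 2 ^ l * numCliques (blocks s 0 n)  ≡⟨ cong (_* numCliques (blocks s 0 n)) (^-distribˡ-+-* 2 4 l) ⟨
  2 ^ (4 + l) * numCliques (blocks s 0 n) ∎)
  where
  open ≤-Reasoning
  many : n / suc s * 2 ^ s ≤ numCliques (blocks s 0 n)
  many = ≤-trans (many-cliques s (n / suc s) 0 (n % suc s)) (≤-reflexive (cong (λ n → numCliques (blocks s 0 n))
    (trans (+-comm _ (n % suc s)) (sym (m≡m%n+[m/n]*n n (suc s))))))

-- Rational bounds for powers of two

ι : ℕ → ℚᵘ
ι k = ℤ.+ k ℚ./ 1

ι-mono-≤ : ∀ {a b} → a ≤ b → ι a ℚ.≤ ι b
ι-mono-≤ le = *≤* (ℤₚ.*-monoʳ-≤-nonNeg (ℤ.+ 1) (ℤ.+≤+ le))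

ι-mono-< : ∀ {a b} → a < b → ι a ℚ.< ι b
ι-mono-< lt = *<* (ℤₚ.*-monoʳ-<-pos (ℤ.+ 1) (ℤ.+<+ lt))

ι-cancel-< : ∀ {a b} → ι a ℚ.< ι b → a < b
ι-cancel-< lt = ≰⇒> λ le → ℚₚ.<⇒≱ lt (ι-mono-≤ le)

ι-* : ∀ a b → ι a ℚ.* ι b ≡ ι (a * b)
ι-* a b = cong (λ z → mkℚᵘ z 0) (sym (ℤₚ.pos-* a b))

ι-+ : ∀ a b → ι a ℚ.+ ι b ≡ ι (a + b)
ι-+ a b = cong (λ z → mkℚᵘ z 0) (trans (cong₂ ℤ._+_ (ℤₚ.*-identityʳ (ℤ.+ a)) (ℤₚ.*-identityʳ (ℤ.+ b))) (sym (ℤₚ.pos-+ a b)))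

ι-nonNeg : ∀ a → ℚ.NonNegative (ι a)
ι-nonNeg a = _

2^-pos : ∀ k → ℚ.Positive (ι (2 ^ k))
2^-pos k = ℚ.positive (ι-mono-< (m^n>0 2 k))

*-interchange : ∀ a b c d → (a ℚ.* b) ℚ.* (c ℚ.* d) ℚ.≃ (a ℚ.* c) ℚ.* (b ℚ.* d)
*-interchange = CommutativeSemigroupProperties.interchange (CommutativeMonoid.commutativeSemigroup ℚₚ.*-1-commutativeMonoid)

-- The factor `2 ^ a` on the side of `q` replaces a negative exponent.
^ℕ-≥ : ∀ {q} a b → ι (2 ^ b) ℚ.≤ q ℚ.* ι (2 ^ a) → ∀ d → ι (2 ^ (d * b)) ℚ.≤ (q ^ℕ d) ℚ.* ι (2 ^ (d * a))
^ℕ-≥ a b h zero = ℚₚ.≤-refl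
^ℕ-≥ {q} a b h (suc d) = begin
  ι (2 ^ (b + d * b))                                   ≡⟨ trans (cong ι (^-distribˡ-+-* 2 b (d * b))) (sym (ι-* (2 ^ b) (2 ^ (d * b)))) ⟩
  ι (2 ^ b) ℚ.* ι (2 ^ (d * b))                         ≤⟨ ℚₚ.*-mono-≤-nonNeg {{ι-nonNeg _}} {{ι-nonNeg _}} h (^ℕ-≥ a b h d) ⟩
  (q ℚ.* ι (2 ^ a)) ℚ.* ((q ^ℕ d) ℚ.* ι (2 ^ (d * a)))  ≃⟨ *-interchange q (ι (2 ^ a)) (q ^ℕ d) (ι (2 ^ (d * a))) ⟩
  (q ℚ.* (q ^ℕ d)) ℚ.* (ι (2 ^ a) ℚ.* ι (2 ^ (d * a)))  ≡⟨ cong ((q ℚ.* (q ^ℕ d)) ℚ.*_) (trans (ι-* (2 ^ a) (2 ^ (d * a))) (cong ι (sym (^-distribˡ-+-* 2 a (d * a))))) ⟩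
  (q ℚ.* (q ^ℕ d)) ℚ.* ι (2 ^ (a + d * a))              ∎
  where open ℚₚ.≤-Reasoning

^ℕ-≤ : ∀ {q} b → 0ℚᵘ ℚ.< q → q ℚ.≤ ι (2 ^ b) → ∀ d → q ^ℕ d ℚ.≤ ι (2 ^ (d * b)) × 0ℚᵘ ℚ.≤ q ^ℕ d
^ℕ-≤ b pos h zero = ℚₚ.≤-refl , *≤* (ℤ.+≤+ z≤n)
^ℕ-≤ {q} b pos h (suc d) with ^ℕ-≤ b pos h d
... | le , nn = (begin
  q ℚ.* (q ^ℕ d)                ≤⟨ ℚₚ.*-mono-≤-nonNeg {{ℚ.nonNegative (ℚₚ.<⇒≤ pos)}} {{ℚ.nonNegative nn}} h le ⟩
  ι (2 ^ b) ℚ.* ι (2 ^ (d * b)) ≡⟨ trans (ι-* (2 ^ b) (2 ^ (d * b))) (cong ι (sym (^-distribˡ-+-* 2 b (d * b)))) ⟩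
  ι (2 ^ (b + d * b))           ∎) , ℚₚ.≤-trans (ℚₚ.≤-reflexive (ℚₚ.≃-sym (ℚₚ.*-zeroʳ q))) (ℚₚ.*-monoʳ-≤-nonNeg q {{ℚ.nonNegative (ℚₚ.<⇒≤ pos)}} nn)
  where open ℚₚ.≤-Reasoning

1/-shift : ∀ d .{{_ : NonZero d}} x y → x ≤ y * d → (ℤ.+ 1 ℚ./ d) ℚ.* ι x ℚ.≤ ι y
1/-shift (suc d) x y le = *≤* (subst₂ ℤ._≤_
  (sym (trans (ℤₚ.*-identityʳ (ℤ.+ 1 ℤ.* ℤ.+ x)) (ℤₚ.*-identityˡ (ℤ.+ x))))
  (trans (cong (λ k → ℤ.+ (y * k)) (sym (*-identityʳ (suc d)))) (ℤₚ.pos-* y (suc d * 1)))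
  (ℤ.+≤+ le))

2^ℤ-shift : ∀ z k l → z ℤ.+ ℤ.+ k ℤ.≤ ℤ.+ l → (2^ℤ z) ℚ.* ι (2 ^ k) ℚ.≤ ι (2 ^ l)
2^ℤ-shift (ℤ.+ j) k l h = ℚₚ.≤-trans (ℚₚ.≤-reflexive (ℚₚ.≃-reflexive (trans (ι-* (2 ^ j) (2 ^ k)) (cong ι (sym (^-distribˡ-+-* 2 j k))))))
  (ι-mono-≤ (^-monoʳ-≤ 2 (ℤₚ.drop‿+≤+ h)))
2^ℤ-shift ℤ.-[1+ j ] k l h = 1/-shift (2 ^ suc j) {{m^n≢0 2 (suc j)}} (2 ^ k) (2 ^ l)
  (≤-trans (^-monoʳ-≤ 2 (ℤₚ.drop‿+≤+ (subst (ℤ._≤ ℤ.+ (l + suc j)) cancel (ℤₚ.+-monoˡ-≤ (ℤ.+ suc j) h)))) (≤-reflexive (^-distribˡ-+-* 2 l (suc j))))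
  where
  cancel : (ℤ.-[1+ j ] ℤ.+ ℤ.+ k) ℤ.+ ℤ.+ suc j ≡ ℤ.+ k
  cancel = trans (cong (ℤ._+ ℤ.+ suc j) (ℤₚ.+-comm ℤ.-[1+ j ] (ℤ.+ k))) (trans (ℤₚ.+-assoc (ℤ.+ k) ℤ.-[1+ j ] (ℤ.+ suc j))
    (trans (cong (λ z → (ℤ.+ k) ℤ.+ z) (ℤₚ.+-inverseˡ (ℤ.+ suc j))) (ℤₚ.+-identityʳ (ℤ.+ k))))

2^ℤ-≥ : ∀ z b → ℤ.+ b ℤ.≤ z → ι (2 ^ b) ℚ.≤ 2^ℤ z
2^ℤ-≥ (ℤ.+ j) b (ℤ.+≤+ le) = ι-mono-≤ (^-monoʳ-≤ 2 le)

-- The hypothesis on the numerator of r says r + a ≤ b.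
<2^-elim : ∀ q r a b → 0ℚᵘ ℚ.< q → q <2^ r → ℚ.↥ r ℤ.+ ℤ.+ (ℚ.↧ₙ r * a) ℤ.≤ ℤ.+ (ℚ.↧ₙ r * b) → q ℚ.* ι (2 ^ a) ℚ.< ι (2 ^ b)
<2^-elim q r a b pos (inj₁ q≤0) h = contradiction q≤0 (ℚₚ.<⇒≱ pos)
<2^-elim q r a b pos (inj₂ lt) h = ℚₚ.≰⇒> λ le → ℚₚ.<-irrefl ℚₚ.≃-refl (begin-strict
  ι (2 ^ (ℚ.↧ₙ r * b))                            ≤⟨ ^ℕ-≥ {q} a b le (ℚ.↧ₙ r) ⟩
  (q ^ℕ (ℚ.↧ₙ r)) ℚ.* ι (2 ^ (ℚ.↧ₙ r * a))          <⟨ ℚₚ.*-monoˡ-<-pos (ι (2 ^ (ℚ.↧ₙ r * a))) {{2^-pos (ℚ.↧ₙ r * a)}} lt ⟩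
  (2^ℤ (ℚ.↥ r)) ℚ.* ι (2 ^ (ℚ.↧ₙ r * a))          ≤⟨ 2^ℤ-shift (ℚ.↥ r) (ℚ.↧ₙ r * a) (ℚ.↧ₙ r * b) h ⟩
  ι (2 ^ (ℚ.↧ₙ r * b))                            ∎)
  where open ℚₚ.≤-Reasoning

2^<-elim : ∀ q r b → 2^ r < q → ι b ℚ.≤ r → ι (2 ^ b) ℚ.< q
2^<-elim q r b (pos , lt) le = ℚₚ.≰⇒> λ q≤ → ℚₚ.<-irrefl ℚₚ.≃-refl (begin-strict
  2^ℤ (ℚ.↥ r)             <⟨ lt ⟩
  q ^ℕ (ℚ.↧ₙ r)             ≤⟨ proj₁ (^ℕ-≤ b pos q≤ (ℚ.↧ₙ r)) ⟩
  ι (2 ^ (ℚ.↧ₙ r * b))    ≤⟨ 2^ℤ-≥ (ℚ.↥ r) (ℚ.↧ₙ r * b) (scale le) ⟩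
  2^ℤ (ℚ.↥ r)             ∎)
  where
  open ℚₚ.≤-Reasoning
  scale : ι b ℚ.≤ r → ℤ.+ (ℚ.↧ₙ r * b) ℤ.≤ ℚ.↥ r
  scale (*≤* h) = subst₂ ℤ._≤_ (trans (sym (ℤₚ.pos-* b (ℚ.↧ₙ r))) (cong ℤ.+_ (*-comm b (ℚ.↧ₙ r)))) (ℤₚ.*-identityʳ (ℚ.↥ r)) h

≤-numerator : ∀ r b → r ℚ.≤ ι b → ℚ.↥ r ℤ.≤ ℤ.+ (ℚ.↧ₙ r * b)
≤-numerator r b (*≤* h) = subst₂ ℤ._≤_ (ℤₚ.*-identityʳ (ℚ.↥ r)) (trans (sym (ℤₚ.pos-* b (ℚ.↧ₙ r))) (cong ℤ.+_ (*-comm b (ℚ.↧ₙ r)))) h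

<2^-elim₀ : ∀ q r b → 0ℚᵘ ℚ.< q → q <2^ r → r ℚ.≤ ι b → q ℚ.< ι (2 ^ b)
<2^-elim₀ q r b pos lt le = ℚₚ.≤-<-trans (ℚₚ.≤-reflexive (ℚₚ.≃-sym (ℚₚ.*-identityʳ q)))
  (<2^-elim q r 0 b pos lt (subst (ℤ._≤ ℤ.+ (ℚ.↧ₙ r * b)) (sym (trans (cong (λ k → ℚ.↥ r ℤ.+ ℤ.+ k) (*-zeroʳ (ℚ.↧ₙ r))) (ℤₚ.+-identityʳ (ℚ.↥ r)))) (≤-numerator r b le)))

<2^-elim₁ : ∀ q r a → 0ℚᵘ ℚ.< q → q <2^ r → r ℚ.≤ ℚ.- ι a → q ℚ.* ι (2 ^ a) ℚ.< ι 1
<2^-elim₁ q r a pos lt le = <2^-elim q r a 0 pos lt (subst (ℚ.↥ r ℤ.+ ℤ.+ (ℚ.↧ₙ r * a) ℤ.≤_) (cong ℤ.+_ (sym (*-zeroʳ (ℚ.↧ₙ r)))) (scale le))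
  where
  scale : r ℚ.≤ ℚ.- ι a → ℚ.↥ r ℤ.+ ℤ.+ (ℚ.↧ₙ r * a) ℤ.≤ ℤ.+ 0
  scale (*≤* h) = subst (ℚ.↥ r ℤ.+ ℤ.+ (ℚ.↧ₙ r * a) ℤ.≤_) (ℤₚ.+-inverseˡ (ℤ.+ (ℚ.↧ₙ r * a))) (ℤₚ.+-monoˡ-≤ (ℤ.+ (ℚ.↧ₙ r * a))
    (subst₂ ℤ._≤_ (ℤₚ.*-identityʳ (ℚ.↥ r)) (trans (sym (ℤₚ.neg-distribˡ-* (ℤ.+ a) (ℤ.+ ℚ.↧ₙ r))) (cong ℤ.-_ (trans (sym (ℤₚ.pos-* a (ℚ.↧ₙ r))) (cong ℤ.+_ (*-comm a (ℚ.↧ₙ r)))))) h))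

-- Comparison with the real bounds

module _ {t l : ℕ} (2^l≤t : 2 ^ l ≤ t) (t<2^ : t < 2 ^ suc l) where

  log-lower : ∀ {b} → upper (log₂ (fromℕ t)) b → ι l ℚ.< b
  log-lower {b} (q , t<q , q<2^b) = ℚₚ.≰⇒> λ b≤l → ℚₚ.<-asym
    (<2^-elim₀ q b l (ℚₚ.≤-<-trans (ι-mono-≤ z≤n) t<q) q<2^b b≤l)
    (ℚₚ.≤-<-trans (ι-mono-≤ 2^l≤t) t<q)

  log-upper : ∀ {a} → lower (log₂ (fromℕ t)) a → a ℚ.< ι (suc l)
  log-upper {a} (q , q<t , 2^a<q) = ℚₚ.≰⇒> λ le → ℚₚ.<-asym (2^<-elim q a (suc l) 2^a<q le) (ℚₚ.<-trans q<t (ι-mono-< t<2^))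

  0<upper : ∀ {b} → upper (log₂ (fromℕ t)) b → 0ℚᵘ ℚ.< b
  0<upper {b} ub = ℚₚ.≤-<-trans (ι-mono-≤ z≤n) (log-lower {b} ub)

  square-lower : ∀ {v} → upper (log₂ (fromℕ t) ²) v → ι (l * l) ℚ.< v
  square-lower (a , b , c , d , (_ , ub) , (_ , ud) , _ , _ , _ , bd<v) = ℚₚ.≤-<-trans
    (ℚₚ.≤-trans (ℚₚ.≤-reflexive (ℚₚ.≃-reflexive (sym (ι-* l l))))
      (ℚₚ.*-mono-≤-nonNeg {{ι-nonNeg l}} {{ι-nonNeg l}} (ℚₚ.<⇒≤ (log-lower {b} ub)) (ℚₚ.<⇒≤ (log-lower {d} ud)))) bd<v

  square-upper : ∀ {v} → lower (log₂ (fromℕ t) ²) v → v ℚ.≤ ι (suc l * suc l)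
  square-upper {v} (a , b , c , d , (la , _) , (lc , ud) , v<ac , v<ad , _ , _) with ℚₚ.≤-total a 0ℚᵘ
  -- If `a` and `c` are both negative, `a * c` may be large; the positive upper approximation `d` is
  -- used instead.
  ... | inj₁ a≤0 = ℚₚ.<⇒≤ (begin-strict
    v                       <⟨ v<ad ⟩
    a ℚ.* d                 ≤⟨ ℚₚ.*-monoˡ-≤-nonNeg d {{ℚ.nonNegative (ℚₚ.<⇒≤ (0<upper {d} ud))}} a≤0 ⟩
    0ℚᵘ ℚ.* d               ≃⟨ ℚₚ.*-zeroˡ d ⟩
    ι 0                     ≤⟨ ι-mono-≤ z≤n ⟩
    ι (suc l * suc l)       ∎)
    where open ℚₚ.≤-Reasoning
  ... | inj₂ 0≤a = ℚₚ.<⇒≤ (begin-strict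
    v                       <⟨ v<ac ⟩
    a ℚ.* c                 ≤⟨ ℚₚ.*-monoʳ-≤-nonNeg a {{ℚ.nonNegative 0≤a}} (ℚₚ.<⇒≤ (log-upper {c} lc)) ⟩
    a ℚ.* ι (suc l)         ≤⟨ ℚₚ.*-monoˡ-≤-nonNeg (ι (suc l)) {{ι-nonNeg _}} {a} {ι (suc l)} (ℚₚ.<⇒≤ (log-upper {a} la)) ⟩
    ι (suc l) ℚ.* ι (suc l) ≡⟨ ι-* (suc l) (suc l) ⟩
    ι (suc l * suc l)       ∎)
    where open ℚₚ.≤-Reasoning

  exponent-lower : ∀ {r} → upper (fromℕ t +ℝ log₂ (fromℕ t) ²) r → ι (t + l * l) ℚ.≤ r
  exponent-lower {r} (u , v , t<u , lv , uv<r) = ℚₚ.<⇒≤ (begin-strict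
    ι (t + l * l)          ≡⟨ ι-+ t (l * l) ⟨
    ι t ℚ.+ ι (l * l)      <⟨ ℚₚ.+-mono-< t<u (square-lower {v} lv) ⟩
    u ℚ.+ v                <⟨ uv<r ⟩
    r                      ∎)
    where open ℚₚ.≤-Reasoning

  exponent-upper : ∀ {r} → lower (fromℕ t +ℝ log₂ (fromℕ t) ²) r → r ℚ.≤ ι (t + suc l * suc l)
  exponent-upper {r} (u , v , u<t , lv , r<uv) = ℚₚ.<⇒≤ (begin-strict
    r                           <⟨ r<uv ⟩
    u ℚ.+ v                     ≤⟨ ℚₚ.+-mono-≤ (ℚₚ.<⇒≤ u<t) (square-upper {v} lv) ⟩
    ι t ℚ.+ ι (suc l * suc l)   ≡⟨ ι-+ t (suc l * suc l) ⟩
    ι (t + suc l * suc l)       ∎)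
    where open ℚₚ.≤-Reasoning

  -- The order is a negation: a rational `q` strictly between the two sides would give `k < k`, as
  -- `b` and `d` approximate the factors from above.
  real-upper : ∀ {k n} → k ≤ 2 ^ (t + l * l) * n → fromℕ k ≤ℝ 2^ℝ (fromℕ t +ℝ log₂ (fromℕ t) ²) *ℝ fromℕ n
  real-upper {k} {n} le (q , (a , b , c , d , (_ , r , ur , 2^r<b) , (_ , n<d) , _ , _ , _ , bd<q) , q<k) = ℚₚ.<-irrefl ℚₚ.≃-refl (begin-strict
    ι k                             ≤⟨ ι-mono-≤ le ⟩
    ι (2 ^ (t + l * l) * n)         ≡⟨ ι-* (2 ^ (t + l * l)) n ⟨
    ι (2 ^ (t + l * l)) ℚ.* ι n     ≤⟨ ℚₚ.*-mono-≤-nonNeg {{ι-nonNeg _}} {{ι-nonNeg _}} (ℚₚ.<⇒≤ (2^<-elim b r (t + l * l) 2^r<b (exponent-lower {r} ur))) (ℚₚ.<⇒≤ n<d) ⟩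
    b ℚ.* d                         <⟨ bd<q ⟩
    q                               <⟨ q<k ⟩
    ι k                             ∎)
    where open ℚₚ.≤-Reasoning

  positive-left : ∀ {x y} → 0ℚᵘ ℚ.< x ℚ.* y → 0ℚᵘ ℚ.< y → 0ℚᵘ ℚ.< x
  positive-left {x} {y} xy y>0 = ℚₚ.≰⇒> λ x≤0 → ℚₚ.<⇒≱ xy (ℚₚ.≤-trans
    (ℚₚ.*-monoˡ-≤-nonNeg y {{ℚ.nonNegative (ℚₚ.<⇒≤ y>0)}} x≤0) (ℚₚ.≤-reflexive (ℚₚ.*-zeroˡ y)))

  positive-right : ∀ {x y} → 0ℚᵘ ℚ.< x ℚ.* y → 0ℚᵘ ℚ.< x → 0ℚᵘ ℚ.< y
  positive-right {x} {y} xy = positive-left (ℚₚ.<-≤-trans xy (ℚₚ.≤-reflexive (ℚₚ.*-comm x y)))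

  scaled-lower : ∀ A {r} → lower (-ℝ (fromℚ (ι A) *ℝ log₂ (fromℕ t) ²)) r → r ℚ.≤ ℚ.- ι (A * (l * l))
  scaled-lower A {r} (a , b , c , d , (_ , A<b) , (_ , ud) , _ , _ , _ , bd<-r) = ℚₚ.≤-trans (ℚₚ.≤-reflexive (ℚₚ.≃-sym (ℚₚ.neg-involutive r)))
    (ℚₚ.neg-mono-≤ (ℚₚ.<⇒≤ (begin-strict
      ι (A * (l * l))        ≡⟨ ι-* A (l * l) ⟨
      ι A ℚ.* ι (l * l)      ≤⟨ ℚₚ.*-mono-≤-nonNeg {{ι-nonNeg _}} {{ι-nonNeg _}} (ℚₚ.<⇒≤ A<b) (ℚₚ.<⇒≤ (square-lower {d} ud)) ⟩
      b ℚ.* d                <⟨ bd<-r ⟩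
      ℚ.- r                  ∎)))
    where open ℚₚ.≤-Reasoning

  real-lower : ∀ A {k n} → 2 ^ (t + suc l * suc l) * n ≤ 2 ^ (A * (l * l)) * k →
    2^ℝ (-ℝ (fromℚ (ι A) *ℝ log₂ (fromℕ t) ²)) *ℝ 2^ℝ (fromℕ t +ℝ log₂ (fromℕ t) ²) *ℝ fromℕ n ≤ℝ fromℕ k
  real-lower A {k} {n} le (q , k<q , (a , b , c , d ,
      ((a₁ , b₁ , c₁ , d₁ , ((r , lr , a₁<2^r) , (_ , _ , b₁>0 , _)) , ((s , ls , c₁<2^s) , (_ , _ , d₁>0 , _)) , a<a₁c₁ , a<a₁d₁ , a<b₁c₁ , _) , _) ,
      (c<n , n<d) , q<ac , q<ad , _ , _)) = <⇒≱ (ι-cancel-< (begin-strict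
    ι (2 ^ (A * (l * l)) * k)              ≡⟨ trans (cong ι (*-comm _ k)) (sym (ι-* k (2 ^ (A * (l * l))))) ⟩
    ι k ℚ.* P                              <⟨ ℚₚ.*-monoˡ-<-pos P {{2^-pos (A * (l * l))}} k<q ⟩
    q ℚ.* P                                ≤⟨ ℚₚ.*-monoˡ-≤-nonNeg P {{ι-nonNeg _}} (ℚₚ.<⇒≤ q<ac) ⟩
    (a ℚ.* c) ℚ.* P                        ≤⟨ ℚₚ.*-monoˡ-≤-nonNeg P {{ι-nonNeg _}} (ℚₚ.*-monoʳ-≤-nonNeg a {{ℚ.nonNegative (ℚₚ.<⇒≤ a>0)}} (ℚₚ.<⇒≤ c<n)) ⟩
    (a ℚ.* ι n) ℚ.* P                      ≤⟨ ℚₚ.*-monoˡ-≤-nonNeg P {{ι-nonNeg _}} (ℚₚ.*-monoˡ-≤-nonNeg (ι n) {{ι-nonNeg _}} (ℚₚ.<⇒≤ a<a₁c₁)) ⟩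
    ((a₁ ℚ.* c₁) ℚ.* ι n) ℚ.* P            ≃⟨ ℚₚ.*-assoc (a₁ ℚ.* c₁) (ι n) P ⟩
    (a₁ ℚ.* c₁) ℚ.* (ι n ℚ.* P)            ≃⟨ ℚₚ.*-cong (ℚₚ.≃-refl {a₁ ℚ.* c₁}) (ℚₚ.*-comm (ι n) P) ⟩
    (a₁ ℚ.* c₁) ℚ.* (P ℚ.* ι n)            ≃⟨ *-interchange a₁ c₁ P (ι n) ⟩
    (a₁ ℚ.* P) ℚ.* (c₁ ℚ.* ι n)            ≤⟨ ℚₚ.*-mono-≤-nonNeg
                                                {{ℚ.nonNegative (ℚₚ.<⇒≤ (positive-product a₁>0 (ι-mono-< (m^n>0 2 (A * (l * l))))))}}
                                                {{ℚ.nonNegative (nonNeg-product (ℚₚ.<⇒≤ c₁>0) n)}}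
                                                (ℚₚ.<⇒≤ (<2^-elim₁ a₁ r (A * (l * l)) a₁>0 a₁<2^r (scaled-lower A {r} lr)))
                                                (ℚₚ.*-monoˡ-≤-nonNeg (ι n) {{ι-nonNeg _}} (ℚₚ.<⇒≤ (<2^-elim₀ c₁ s (t + suc l * suc l) c₁>0 c₁<2^s (exponent-upper {s} ls)))) ⟩
    ι 1 ℚ.* (ι (2 ^ (t + suc l * suc l)) ℚ.* ι n) ≃⟨ ℚₚ.*-identityˡ _ ⟩
    ι (2 ^ (t + suc l * suc l)) ℚ.* ι n    ≡⟨ ι-* (2 ^ (t + suc l * suc l)) n ⟩
    ι (2 ^ (t + suc l * suc l) * n)        ∎)) le
    where
    open ℚₚ.≤-Reasoning
    P = ι (2 ^ (A * (l * l)))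
    -- Lower approximations may be negative. Positivity passes from `q` down to each factor by way
    -- of a positive upper approximation of the other one.
    q>0 : 0ℚᵘ ℚ.< q
    q>0 = ℚₚ.≤-<-trans (ι-mono-≤ z≤n) k<q
    a>0 : 0ℚᵘ ℚ.< a
    a>0 = positive-left (ℚₚ.<-trans q>0 q<ad) (ℚₚ.≤-<-trans (ι-mono-≤ z≤n) n<d)
    a₁>0 : 0ℚᵘ ℚ.< a₁
    a₁>0 = positive-left (ℚₚ.<-trans a>0 a<a₁d₁) d₁>0
    c₁>0 : 0ℚᵘ ℚ.< c₁
    c₁>0 = positive-right (ℚₚ.<-trans a>0 a<b₁c₁) b₁>0
    nonNeg-product : ∀ {x} → 0ℚᵘ ℚ.≤ x → ∀ n → 0ℚᵘ ℚ.≤ x ℚ.* ι n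
    nonNeg-product x≥0 n = ℚₚ.≤-trans (ℚₚ.≤-reflexive (ℚₚ.≃-sym (ℚₚ.*-zeroˡ (ι n)))) (ℚₚ.*-monoˡ-≤-nonNeg (ι n) {{ι-nonNeg n}} x≥0)
    positive-product : ∀ {x y} → 0ℚᵘ ℚ.< x → 0ℚᵘ ℚ.< y → 0ℚᵘ ℚ.< x ℚ.* y
    positive-product {x} {y} x>0 y>0 = ℚₚ.≤-<-trans (ℚₚ.≤-reflexive (ℚₚ.≃-sym (ℚₚ.*-zeroˡ y))) (ℚₚ.*-monoˡ-<-pos y {{ℚ.positive y>0}} x>0)

-- Rounded logarithms, the constants and the conclusion

log-floor : ∀ t → 0 < t → ∃ λ l → 2 ^ l ≤ t × t < 2 ^ suc l
log-floor (suc zero) _ = 0 , ≤-refl , ≤-refl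
log-floor (suc (suc t)) _ with log-floor (suc t) (s≤s z≤n)
... | l , lo , hi with suc (suc t) <? 2 ^ suc l
...   | yes lt = l , m≤n⇒m≤1+n lo , lt
...   | no ¬lt = suc l , ≮⇒≥ ¬lt , ≤-<-trans hi (^-monoʳ-< 2 (s≤s (s≤s z≤n)) (n<1+n (suc l)))

opaque
  -- The exponent is `8 * 100`, since `exponent-arith` asks for `q ≥ 100`.
  threshold : ℕ
  threshold = 2 ^ 800

  threshold-log : ∀ {t l} → threshold ≤ t → t < 2 ^ suc l → 800 ≤ l
  threshold-log le lt = ≮⇒≥ λ l<800 → <⇒≱ (<-≤-trans lt (^-monoʳ-≤ 2 l<800)) le

  threshold-pos : 0 < threshold
  threshold-pos = m^n>0 2 800

  -- Origin of `A = 3`: one `l * l` absorbs `2^((log₂ t)²)`, the others cover the rounding of the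
  -- logarithm and the factor `2 ^ (4 + l)` lost by the disjoint cliques.
  exponents : ∀ l → 800 ≤ l → suc l * suc l + (4 + l) ≤ 3 * (l * l)
  exponents l big = ≤-by (l * l) (+-mono-≤ 5≤l 4l≤l²) (solve (l ∷ []))
    where
    5≤l : 5 ≤ l
    5≤l = ≤-trans (m≤m+n 5 795) big
    4l≤l² : 4 * l ≤ l * l
    4l≤l² = *-monoˡ-≤ l (≤-trans (m≤m+n 4 796) big)

rescale : ∀ t l n k → 800 ≤ l → n * 2 ^ t ≤ 2 ^ (4 + l) * k → 2 ^ (t + suc l * suc l) * n ≤ 2 ^ (3 * (l * l)) * k
rescale t l n k big le = begin
  2 ^ (t + suc l * suc l) * n               ≡⟨ cong (λ e → 2 ^ e * n) (+-comm t _) ⟩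
  2 ^ (suc l * suc l + t) * n               ≡⟨ trans (cong (_* n) (^-distribˡ-+-* 2 (suc l * suc l) t)) (trans (*-assoc (2 ^ (suc l * suc l)) (2 ^ t) n) (cong (2 ^ (suc l * suc l) *_) (*-comm (2 ^ t) n))) ⟩
  2 ^ (suc l * suc l) * (n * 2 ^ t)         ≤⟨ *-monoʳ-≤ (2 ^ (suc l * suc l)) le ⟩
  2 ^ (suc l * suc l) * (2 ^ (4 + l) * k)   ≡⟨ trans (sym (*-assoc (2 ^ (suc l * suc l)) (2 ^ (4 + l)) k)) (cong (_* k) (sym (^-distribˡ-+-* 2 (suc l * suc l) (4 + l)))) ⟩
  2 ^ (suc l * suc l + (4 + l)) * k         ≤⟨ *-monoˡ-≤ k (^-monoʳ-≤ 2 (exponents l big)) ⟩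
  2 ^ (3 * (l * l)) * k                     ∎
  where open ≤-Reasoning

theorem1p1 : Σ[ t₀ ∈ ℕ ]
    ((∀ (t n : ℕ) → t₀ ≤ t → 1 ≤ n →
    (G : Graph n) → ¬ StrongImmersion (K t) G →
    fromℕ (numCliques G)
    ≤ℝ 2^ℝ (fromℕ t +ℝ (log₂ (fromℕ t)) ²) *ℝ fromℕ n)
    × (Σ[ A ∈ ℚᵘ ] (0ℚᵘ <ℚ A ×
    (∀ (t n : ℕ) → t₀ ≤ t → t ≤ n →
    Σ[ G ∈ Graph n ] ((¬ StrongImmersion (K t) G) ×
    2^ℝ (-ℝ (fromℚ A *ℝ (log₂ (fromℕ t)) ²))
    *ℝ 2^ℝ (fromℕ t +ℝ (log₂ (fromℕ t)) ²) *ℝ fromℕ n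
    ≤ℝ fromℕ (numCliques G))))))
theorem1p1 = threshold
  , (λ t n t₀≤t 1≤n G none →
       let 0<t = ≤-trans threshold-pos t₀≤t
           l , lo , hi = log-floor t 0<t
       in real-upper {l = l} lo hi (upper-bound 0<t G none l (threshold-log t₀≤t hi) hi 1≤n))
  , ι 3 , ι-mono-< {0} {3} (s≤s z≤n)
  , λ t n t₀≤t t≤n →
       let l , lo , hi = log-floor t (≤-trans threshold-pos t₀≤t)
           big = threshold-log t₀≤t hi
           G , none , le = lower-bound t l n (≤-trans (^-monoʳ-≤ 2 {1} (≤-trans (s≤s z≤n) big)) lo) hi t≤n
       in G , none , real-lower {l = l} lo hi 3 (rescale t l n (numCliques G) big le)
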